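{- (i) Let $\gamma>0$ and $\varepsilon>0$. Then for any graph $G_n$ on $n$ vertices with at least $\gamma n^2$ edges and any $p=p(n)\geq n^{ -1/2+\varepsilon}$, asymptotically almost surely $G_n\cup G(n,p)\rightarrow(K_4)$. (ii) For $0<\gamma<\frac14$ there exists (for each $n$) a graph $G_n$ on $n$ vertices with at least $\gamma n^2$ edges such that for $p=p(n)=o(n^{ -1/2})$, asymptotically almost surely $G_n\cup G(n,p)\not\rightarrow(K_4)$.
   Context: $G(n,p)$ is the binomial random graph on the vertex set of $G_n$, each edge present independently with probability $p$; $G_n\cup G(n,p)$ is the union of edge sets. "Asymptotically almost surely" means with probability tending to $1$ as $n\to\infty$ (in (i), uniformly over all such $G_n$). $G\rightarrow(K_4)$ means every 2-colouring of $E(G)$ contains a monochromatic copy of $K_4$; $G\not\rightarrow(K_4)$ is its negation.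
   Formalization: The edge probabilities p(n), and γ and ε, are rational rather than real; in (ii) the bound of at least γn² edges is asserted for all sufficiently large n (it is impossible for n = 1). -}

module Defs where

open import Data.Nat as ℕ using (ℕ; zero; suc)
open import Data.Integer using (+_)
open import Data.Rational using (ℚ; 0ℚ; 1ℚ; _+_; _*_; _-_; _/_; _≤_; _<_)
open import Data.Bool using (Bool; true; false; _∨_; if_then_else_)
open import Data.Fin as Fin using (Fin)
open import Data.Fin.Properties using (_<?_)
open import Data.List as List using (List; []; _∷_; length; lookup; allFin; concatMap)
open import Data.List.Relation.Unary.All using (All)
open import Data.List.Relation.Unary.Unique.Propositional using (Unique)
open import Data.Vec as Vec using (Vec; toList; zipWith)
open import Data.Product using (Σ; ∃; ∃-syntax; _×_; _,_)
open import Relation.Nullary using (¬_; does)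
open import Relation.Binary.PropositionalEquality using (_≡_)

ℕtoℚ : ℕ → ℚ
ℕtoℚ n = + n / 1

_^ℚ_ : ℚ → ℕ → ℚ
q ^ℚ zero  = 1ℚ
q ^ℚ suc k = q * (q ^ℚ k)

pairs : (n : ℕ) → List (Fin n × Fin n)
pairs n = concatMap (λ i → concatMap (λ j → if does (i <? j) then (i , j) ∷ [] else []) (allFin n)) (allFin n)

N : ℕ → ℕ
N n = length (pairs n)

-- a (simple, undirected) graph on vertex set Fin n is a subset of the
-- potential edges, given by its indicator vector
Graph : ℕ → Set
Graph n = Vec Bool (N n)

Edge : {n : ℕ} → Graph n → Fin n → Fin n → Set
Edge {n} G i j = ∃[ k ] (lookup (pairs n) k ≡ (i , j) × Vec.lookup G k ≡ true)

sumℕ : List ℕ → ℕ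
sumℕ [] = 0
sumℕ (x ∷ xs) = x ℕ.+ sumℕ xs

sumℚ : List ℚ → ℚ
sumℚ [] = 0ℚ
sumℚ (x ∷ xs) = x + sumℚ xs

bit : Bool → ℕ
bit true  = 1
bit false = 0

numEdges : (n : ℕ) → Graph n → ℕ
numEdges n G = sumℕ (List.map bit (toList G))

union : (n : ℕ) → Graph n → Graph n → Graph n
union n G H = zipWith _∨_ G H

-- 2-colourings: the colour of the edge {i , j} with i < j is c i j
Colouring : ℕ → Set
Colouring n = Fin n → Fin n → Bool

MonoK4 : {n : ℕ} → Graph n → Colouring n → Set
MonoK4 {n} G χ =
  Σ (Fin n) λ a → Σ (Fin n) λ b → Σ (Fin n) λ c → Σ (Fin n) λ d → Σ Bool λ col →
    (a Fin.< b) × (b Fin.< c) × (c Fin.< d) ×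
    (Edge G a b × Edge G a c × Edge G a d × Edge G b c × Edge G b d × Edge G c d) ×
    (χ a b ≡ col × χ a c ≡ col × χ a d ≡ col × χ b c ≡ col × χ b d ≡ col × χ c d ≡ col)

-- G → (K4): every 2-colouring of E(G) has a monochromatic K4
-- (colours on non-edges are irrelevant, so quantifying over colourings of all
-- pairs is the same as quantifying over colourings of E(G))
ArrowsK4 : (n : ℕ) → Graph n → Set
ArrowsK4 n G = (χ : Colouring n) → MonoK4 G χ

-- G(n,p): the outcome is the indicator vector of the random edge set; each of
-- the N n potential edges is present independently with probability p.
-- Probability of a single outcome:
weight : {m : ℕ} → ℚ → Vec Bool m → ℚ
weight p Vec.[] = 1ℚ
weight p (true Vec.∷ ω) = p * weight p ω
weight p (false Vec.∷ ω) = (1ℚ - p) * weight p ω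

PrAtLeast : (n : ℕ) → ℚ → (Graph n → Set) → ℚ → Set
PrAtLeast n p A q =
  Σ (List (Graph n)) λ S → Unique S × All A S × q ≤ sumℚ (List.map (weight p) S)

IsProb : (ℕ → ℚ) → Set
IsProb p = (n : ℕ) → 0ℚ ≤ p n × p n ≤ 1ℚ

{-# OPTIONS --safe #-}
module Submission where

-- (i) Dependent random choice in the majority colour of G yields, if there is no monochromatic K4, a set S of
-- size n^(1-o(1)) spanning no random edge of that colour: such an edge with a large common neighbourhood T would be
-- completed by an edge of T, unless T spans only random edges of the other colour. By Janson's inequality every set of
-- size n^(1-o(1)) contains a K4 of G(n,p), so S or T yields a K4 of the other colour.
--
-- (ii) Take G complete bipartite. Colour one side without monochromatic triangles, split the other side into two
-- halves whose inner edges have the colour of the half so that no monochromatic K4 arises, and give a cross edge the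
-- colour opposite to the half of its endpoint. Such colourings exist unless G(n,p) contains a connected cluster of
-- triangles (or of K4's) with at least twice as many edges as vertices. A cluster is explored along a path of
-- triangles (K4's), in which each step multiplies the expected number by O(np²) = o(1) and each surplus edge
-- by O(p); so the expected number of dense clusters is dominated by the small ones and tends to 0.

open import Defs
open import Data.Nat as ℕ using (ℕ; zero; suc; z≤n; s≤s)
open import Relation.Binary.PropositionalEquality
open import Data.Product using (_,_; _×_; proj₁; proj₂; Σ; ∃-syntax)
open import Data.List as List using (List; []; _++_; _∷_; allFin; cartesianProduct; concatMap; drop; filter; filterᵇ; length; map; tabulate; take)
open import Data.List.Membership.Propositional using (_∈_; _∉_; find; lose)
open import Data.List.Membership.Propositional.Properties using (∈-++⁺ʳ; ∈-++⁺ˡ; ∈-++⁻; ∈-allFin; ∈-cartesianProduct⁻; ∈-concatMap⁺; ∈-concatMap⁻; ∈-filter⁺; ∈-filter⁻; ∈-map⁺; ∈-map⁻; ∈-tabulate⁻)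
open import Relation.Nullary using (Dec; does; no; yes; ¬_)
open import Relation.Nullary.Decidable using (_×-dec_; _→-dec_; _⊎-dec_; dec-true; decidable-stable; map′; ¬?)
open import Relation.Unary using (Decidable)
open import Relation.Binary using (tri<; tri>; tri≈)
open import Function using (_∘_)
open import Data.Bool using (Bool; T; _∧_; _∨_; false; if_then_else_; not; true)
open import Data.Fin as Fin using (Fin; fromℕ<; suc; toℕ; zero)
open import Data.List.Relation.Unary.Unique.Propositional using (Unique)
open import Data.List.Properties using (filter-notAll; length-++; length-drop; length-filter; length-map; length-tabulate; length-take; map-tabulate; take++drop≡id)
open import Data.Sum as Sum using (_⊎_; inj₁; inj₂)
open import Data.Empty using (⊥; ⊥-elim)
open import Data.List.Relation.Unary.Any as Any using (Any; here; there)
open import Data.List.Relation.Unary.All as All using (All; []; _∷_)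
open import Data.List.Relation.Unary.AllPairs as AllPairs using (AllPairs; []; _∷_)
import Data.Bool.Properties as BoolP
import Data.Fin.Properties as FinP
import Data.Integer.Properties as ℤP
import Data.List.Membership.DecPropositional as DecMem
import Data.List.Relation.Unary.All.Properties as AllP
import Data.List.Relation.Unary.AllPairs.Properties as AllPairsP
import Data.List.Relation.Unary.Any.Properties as AnyP
import Data.List.Relation.Unary.Unique.DecPropositional as DecUnique
import Data.List.Relation.Unary.Unique.Propositional.Properties as Uniq
import Data.Nat.Properties as ℕP
import Data.Rational.Unnormalised as ℚᵘ
import Data.Rational.Unnormalised.Properties as ℚᵘP
import Data.Vec.Properties as VecP

-- In (ii), fewer than 2|V| edges mean average degree below 4, hence a vertex with at most three
-- edges: three edges at a vertex can be coloured last, and a vertex whose K4's use only three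
-- neighbours can be placed last. On the other hand, 2|V| edges have weight n^|V| p^(2|V|) =
-- (np²)^|V|. A path of triangles has 2|V| - 3 edges and a tree of K4's 2|V| - 2, so three and two
-- surplus edges are sought. Following a path, a step chooses only its new vertices; the few choices
-- among old vertices cost a factor |V| ≤ 2^|V|, absorbed by np² → 0.
--
-- In (i) the sets S and T depend on the random graph and the colouring, so all 2^n vertex sets are
-- handled at once, each failing with probability at most 2^(-2n). At sizes a small power of n below
-- n, the expected number of K4's far exceeds n, while a given K4 has at most ½ overlapping ones in
-- conditional expectation; this permits a product form of Janson's inequality. Real exponents are
-- avoided by taking all sizes as powers of one integer t with t^K ≤ n < (t+1)^K.

module Rat where
  open import Data.Integer as ℤ using (+_)
  open import Data.Rational
  open import Data.Rational.Properties
  open import Data.Rational.Solver using (module +-*-Solver)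
  open +-*-Solver

  0≤1 : 0ℚ ≤ 1ℚ
  0≤1 = nonNegative⁻¹ 1ℚ

  *-mono : ∀ {a b c d} → 0ℚ ≤ b → 0ℚ ≤ c → a ≤ b → c ≤ d → a * c ≤ b * d
  *-mono {a} {b} {c} {d} 0≤b 0≤c a≤b c≤d =
    ≤-trans (*-monoʳ-≤-nonNeg c {{nonNegative 0≤c}} a≤b) (*-monoˡ-≤-nonNeg b {{nonNegative 0≤b}} c≤d)

  *-monoˡ : ∀ {c a b} → 0ℚ ≤ c → a ≤ b → c * a ≤ c * b
  *-monoˡ {c} 0≤c = *-monoˡ-≤-nonNeg c {{nonNegative 0≤c}}

  *-monoʳ : ∀ {c a b} → 0ℚ ≤ c → a ≤ b → a * c ≤ b * c
  *-monoʳ {c} 0≤c = *-monoʳ-≤-nonNeg c {{nonNegative 0≤c}}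

  0≤* : ∀ {a b} → 0ℚ ≤ a → 0ℚ ≤ b → 0ℚ ≤ a * b
  0≤* {a} {b} 0≤a 0≤b = subst (_≤ a * b) (*-zeroʳ a) (*-monoˡ 0≤a 0≤b)

  0≤+ : ∀ {a b} → 0ℚ ≤ a → 0ℚ ≤ b → 0ℚ ≤ a + b
  0≤+ = +-mono-≤

  x≤x+y : ∀ {x y} → 0ℚ ≤ y → x ≤ x + y
  x≤x+y {x} {y} 0≤y = subst (_≤ x + y) (+-identityʳ x) (+-monoʳ-≤ x 0≤y)

  x≤y+x : ∀ {x y} → 0ℚ ≤ y → x ≤ y + x
  x≤y+x {x} {y} 0≤y = subst (_≤ y + x) (+-identityˡ x) (+-monoˡ-≤ x 0≤y)

  sub≤ : ∀ {a b c} → a ≤ c + b → a - b ≤ c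
  sub≤ {a} {b} {c} h = subst (a - b ≤_) (solve 2 (λ c b → (c :+ b) :- b := c) refl c b) (+-monoˡ-≤ (- b) h)

  ≤sub : ∀ {a b c} → a + b ≤ c → a ≤ c - b
  ≤sub {a} {b} {c} h = subst (_≤ c - b) (solve 2 (λ c b → (c :+ b) :- b := c) refl a b) (+-monoˡ-≤ (- b) h)

  0≤sub : ∀ {a b} → a ≤ b → 0ℚ ≤ b - a
  0≤sub {a} {b} h = ≤sub {0ℚ} {a} {b} (subst (_≤ b) (sym (+-identityˡ a)) h)

  sub≤self : ∀ {a b} → 0ℚ ≤ b → a - b ≤ a
  sub≤self {a} {b} h = sub≤ {a} {b} {a} (x≤x+y h)

  sub-mono : ∀ {a b c d} → a ≤ b → d ≤ c → a - c ≤ b - d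
  sub-mono {a} {b} {c} {d} h k = +-mono-≤ {a} {b} { - c } { - d } h (neg-antimono-≤ k)

  ^-nonneg : ∀ {p} k → 0ℚ ≤ p → 0ℚ ≤ p ^ℚ k
  ^-nonneg zero h = 0≤1
  ^-nonneg (suc k) h = 0≤* h (^-nonneg k h)

  ^-≤1 : ∀ {p} k → 0ℚ ≤ p → p ≤ 1ℚ → p ^ℚ k ≤ 1ℚ
  ^-≤1 zero _ _ = ≤-refl
  ^-≤1 {p} (suc k) 0≤p p≤1 = *-mono 0≤1 (^-nonneg k 0≤p) p≤1 (^-≤1 k 0≤p p≤1)

  ^-mono : ∀ {p q} k → 0ℚ ≤ p → p ≤ q → p ^ℚ k ≤ q ^ℚ k
  ^-mono zero _ _ = ≤-refl
  ^-mono (suc k) 0≤p p≤q = *-mono (≤-trans 0≤p p≤q) (^-nonneg k 0≤p) p≤q (^-mono k 0≤p p≤q)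

  ^-+ : ∀ p a b → p ^ℚ (a ℕ.+ b) ≡ p ^ℚ a * p ^ℚ b
  ^-+ p zero b = sym (*-identityˡ _)
  ^-+ p (suc a) b = trans (cong (p *_) (^-+ p a b)) (sym (*-assoc p _ _))

  ^-antimono : ∀ {p a b} → 0ℚ ≤ p → p ≤ 1ℚ → a ℕ.≤ b → p ^ℚ b ≤ p ^ℚ a
  ^-antimono {p} {a} {b} 0≤p p≤1 a≤b =
    subst₂ (λ x y → p ^ℚ x ≤ y) (ℕP.m+[n∸m]≡n a≤b) (*-identityʳ _)
      (≤-trans (≤-reflexive (^-+ p a (b ℕ.∸ a))) (*-monoˡ (^-nonneg a 0≤p) (^-≤1 (b ℕ.∸ a) 0≤p p≤1)))

  ^-distrib-* : ∀ p q k → (p * q) ^ℚ k ≡ p ^ℚ k * q ^ℚ k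
  ^-distrib-* p q zero = refl
  ^-distrib-* p q (suc k) = trans (cong ((p * q) *_) (^-distrib-* p q k))
    (solve 4 (λ a b c d → (a :* b) :* (c :* d) := (a :* c) :* (b :* d)) refl p q (p ^ℚ k) (q ^ℚ k))

  private
    -- The fraction `+ n / 1` is normalised by a gcd that does not compute for a variable `n`.
    -- Unnormalised rationals keep the literal denominator 1, so the laws below become integer
    -- identities.
    toᵘ : ∀ n → toℚᵘ (ℕtoℚ n) ℚᵘ.≃ ℚᵘ.mkℚᵘ (+ n) 0
    toᵘ n = toℚᵘ-fromℚᵘ (ℚᵘ.mkℚᵘ (+ n) 0)

  ℕtoℚ-+ : ∀ m n → ℕtoℚ (m ℕ.+ n) ≡ ℕtoℚ m + ℕtoℚ n
  ℕtoℚ-+ m n = toℚᵘ-injective (ℚᵘP.≃-trans (toᵘ (m ℕ.+ n))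
    (ℚᵘP.≃-trans (ℚᵘ.*≡* (cong (ℤ._* + 1) (cong₂ ℤ._+_ (sym (ℤP.*-identityʳ (+ m))) (sym (ℤP.*-identityʳ (+ n))))))
    (ℚᵘP.≃-sym (ℚᵘP.≃-trans (toℚᵘ-homo-+ (ℕtoℚ m) (ℕtoℚ n)) (ℚᵘP.+-cong (toᵘ m) (toᵘ n))))))

  ℕtoℚ-* : ∀ m n → ℕtoℚ (m ℕ.* n) ≡ ℕtoℚ m * ℕtoℚ n
  ℕtoℚ-* m n = toℚᵘ-injective (ℚᵘP.≃-trans (toᵘ (m ℕ.* n))
    (ℚᵘP.≃-trans (ℚᵘ.*≡* (cong (ℤ._* + 1) (ℤP.pos-* m n)))
    (ℚᵘP.≃-sym (ℚᵘP.≃-trans (toℚᵘ-homo-* (ℕtoℚ m) (ℕtoℚ n)) (ℚᵘP.*-cong (toᵘ m) (toᵘ n))))))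

  ℕtoℚ-mono : ∀ {m n} → m ℕ.≤ n → ℕtoℚ m ≤ ℕtoℚ n
  ℕtoℚ-mono {m} {n} m≤n = toℚᵘ-cancel-≤ (ℚᵘP.≤-respʳ-≃ (ℚᵘP.≃-sym (toᵘ n)) (ℚᵘP.≤-respˡ-≃ (ℚᵘP.≃-sym (toᵘ m))
    (ℚᵘ.*≤* (ℤP.*-monoʳ-≤-nonNeg (+ 1) (ℤ.+≤+ m≤n)))))

  ℕtoℚ-cancel : ∀ {m n} → ℕtoℚ m ≤ ℕtoℚ n → m ℕ.≤ n
  ℕtoℚ-cancel {m} {n} h with ℚᵘP.≤-respʳ-≃ (toᵘ n) (ℚᵘP.≤-respˡ-≃ (toᵘ m) (toℚᵘ-mono-≤ h))
  ... | ℚᵘ.*≤* k = ℤP.drop‿+≤+ (ℤP.*-cancelʳ-≤-pos (+ m) (+ n) (+ 1) k)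

  0≤ℕ : ∀ n → 0ℚ ≤ ℕtoℚ n
  0≤ℕ n = ℕtoℚ-mono {0} {n} ℕ.z≤n

  ℕtoℚ-^ : ∀ m k → ℕtoℚ (m ℕ.^ k) ≡ ℕtoℚ m ^ℚ k
  ℕtoℚ-^ m zero = refl
  ℕtoℚ-^ m (suc k) = trans (ℕtoℚ-* m (m ℕ.^ k)) (cong (ℕtoℚ m *_) (ℕtoℚ-^ m k))

  -- A positive rational has numerator at least 1, so its own denominator is a sufficient multiple.
  archimedean : ∀ {x} → 0ℚ < x → ∃[ m ] 1ℚ ≤ ℕtoℚ m * x
  archimedean {x@(mkℚ (+ zero) _ _)} 0<x with positive 0<x
  ... | ()
  archimedean {x@(mkℚ ℤ.-[1+ _ ] _ _)} 0<x with positive 0<x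
  ... | ()
  archimedean {x@(mkℚ (+ suc a) d _)} _ = suc d , toℚᵘ-cancel-≤ (ℚᵘP.≤-respʳ-≃
    (ℚᵘP.≃-sym (ℚᵘP.≃-trans (toℚᵘ-homo-* (ℕtoℚ (suc d)) x) (ℚᵘP.*-congʳ {toℚᵘ x} (toᵘ (suc d)))))
    (ℚᵘ.*≤* (ℤ.+≤+ (subst₂ ℕ._≤_ (sym (ℕP.*-identityˡ (suc (d ℕ.+ 0)))) (sym (ℕP.*-identityʳ (suc d ℕ.* suc a)))
      (subst (ℕ._≤ suc d ℕ.* suc a) (cong suc (sym (ℕP.+-identityʳ d))) (ℕP.m≤m*n (suc d) (suc a)))))))

  reciprocal : ∀ q → 1 ℕ.≤ q → ∃[ u ] (0ℚ ≤ u × ℕtoℚ q * u ≡ 1ℚ)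
  reciprocal (suc q) _ = u , 0≤u , toℚᵘ-injective (ℚᵘP.≃-trans (toℚᵘ-homo-* (ℕtoℚ (suc q)) u)
      (ℚᵘP.≃-trans (ℚᵘP.*-cong (toᵘ (suc q)) (toℚᵘ-fromℚᵘ (ℚᵘ.mkℚᵘ (+ 1) q)))
      (ℚᵘ.*≡* (cong +_ (trans (ℕP.*-identityʳ (suc q ℕ.* 1)) (trans (ℕP.*-identityʳ (suc q))
        (sym (trans (ℕP.*-identityˡ (suc (q ℕ.+ 0))) (cong suc (ℕP.+-identityʳ q))))))))))
    where
    u = + 1 / suc q
    0≤u : 0ℚ ≤ u
    0≤u = toℚᵘ-cancel-≤ (ℚᵘP.≤-respʳ-≃ (ℚᵘP.≃-sym (toℚᵘ-fromℚᵘ (ℚᵘ.mkℚᵘ (+ 1) q))) (ℚᵘP.nonNegative⁻¹ (ℚᵘ.mkℚᵘ (+ 1) q)))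

-- Finite sums of rationals.

module Sums where
  open Rat
  open import Data.Rational
  open import Data.Rational.Properties
  open import Data.Rational.Solver using (module +-*-Solver)
  open +-*-Solver using (solve; _:+_; _:=_; _:*_)
  open import Level using (Level)

  private
    variable
      a b : Level
      A : Set a
      B : Set b

  ∑ : List A → (A → ℚ) → ℚ
  ∑ xs f = sumℚ (map f xs)

  ∑-nonneg : ∀ (xs : List A) {f : A → ℚ} → (∀ x → 0ℚ ≤ f x) → 0ℚ ≤ ∑ xs f
  ∑-nonneg [] h = ≤-refl
  ∑-nonneg (x ∷ xs) h = 0≤+ (h x) (∑-nonneg xs h)

  ∑-mono : ∀ (xs : List A) {f g : A → ℚ} → (∀ x → x ∈ xs → f x ≤ g x) → ∑ xs f ≤ ∑ xs g
  ∑-mono [] h = ≤-refl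
  ∑-mono (x ∷ xs) h = +-mono-≤ (h x (here refl)) (∑-mono xs (λ y y∈ → h y (there y∈)))

  ∑-cong : ∀ (xs : List A) {f g : A → ℚ} → (∀ x → f x ≡ g x) → ∑ xs f ≡ ∑ xs g
  ∑-cong [] h = refl
  ∑-cong (x ∷ xs) h = cong₂ _+_ (h x) (∑-cong xs h)

  ∑-++ : ∀ (xs ys : List A) {f : A → ℚ} → ∑ (xs ++ ys) f ≡ ∑ xs f + ∑ ys f
  ∑-++ [] ys = sym (+-identityˡ _)
  ∑-++ (x ∷ xs) ys {f} = trans (cong (f x +_) (∑-++ xs ys)) (sym (+-assoc (f x) _ _))

  ∑-concatMap : ∀ (xs : List A) (g : A → List B) {f : B → ℚ} →
    ∑ (concatMap g xs) f ≡ ∑ xs (λ x → ∑ (g x) f)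
  ∑-concatMap [] g = refl
  ∑-concatMap (x ∷ xs) g {f} = trans (∑-++ (g x) (concatMap g xs)) (cong (∑ (g x) f +_) (∑-concatMap xs g))

  ∑-map : ∀ (xs : List A) (g : A → B) {f : B → ℚ} → ∑ (map g xs) f ≡ ∑ xs (f ∘ g)
  ∑-map [] g = refl
  ∑-map (x ∷ xs) g {f} = cong (f (g x) +_) (∑-map xs g)

  ∑-*ˡ : ∀ (xs : List A) c {f : A → ℚ} → ∑ xs (λ x → c * f x) ≡ c * ∑ xs f
  ∑-*ˡ [] c = sym (*-zeroʳ c)
  ∑-*ˡ (x ∷ xs) c {f} = trans (cong (c * f x +_) (∑-*ˡ xs c)) (sym (*-distribˡ-+ c (f x) _))

  ∑-const : ∀ (xs : List A) c → ∑ xs (λ _ → c) ≡ ℕtoℚ (length xs) * c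
  ∑-const [] c = sym (*-zeroˡ c)
  ∑-const (x ∷ xs) c = trans (cong (c +_) (∑-const xs c))
    (trans (cong (_+ ℕtoℚ (length xs) * c) (sym (*-identityˡ c)))
    (trans (sym (*-distribʳ-+ c 1ℚ (ℕtoℚ (length xs)))) (cong (_* c) (sym (ℕtoℚ-+ 1 (length xs))))))

  ∑-≤-length : ∀ (xs : List A) {f : A → ℚ} c → (∀ x → x ∈ xs → f x ≤ c) → ∑ xs f ≤ ℕtoℚ (length xs) * c
  ∑-≤-length xs {f} c h = ≤-trans (∑-mono xs h) (≤-reflexive (∑-const xs c))

  ∑-filter : ∀ {p} {P : A → Set p} (P? : Decidable P) (xs : List A) {f : A → ℚ} →
    (∀ x → 0ℚ ≤ f x) → ∑ (filter P? xs) f ≤ ∑ xs f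
  ∑-filter P? [] h = ≤-refl
  ∑-filter P? (x ∷ xs) {f} h with P? x
  ... | yes _ = +-monoʳ-≤ (f x) (∑-filter P? xs h)
  ... | no _ = ≤-trans (∑-filter P? xs h) (x≤y+x (h x))

-- The product measure on edge sets: expectation, union bound, monotonicity in p.

module Prob where
  open Rat
  open Sums
  open import Data.Vec as Vec using (Vec; []; _∷_; lookup; _[_]≔_)
  open import Data.Vec.Properties using (lookup∘updateAt; lookup∘updateAt′; ∷-injectiveʳ)
  open import Data.Rational
  open import Data.Rational.Properties
  open import Data.Rational.Solver using (module +-*-Solver)
  open +-*-Solver using (solve; _:+_; _:=_; _:*_; :-_; _:-_; con)

  private
    variable
      m : ℕ

  -- Expectation by conditioning on the first coordinate, so that independence and monotonicity go
  -- by induction on the number of coordinates. The link with `weight` is made in `E≡∑`.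
  E : ∀ {m} → ℚ → (Vec Bool m → ℚ) → ℚ
  E {zero} p f = f []
  E {suc m} p f = p * E p (f ∘ (true ∷_)) + (1ℚ - p) * E p (f ∘ (false ∷_))

  ind : Bool → ℚ
  ind true = 1ℚ
  ind false = 0ℚ

  0≤ind : ∀ b → 0ℚ ≤ ind b
  0≤ind true = 0≤1
  0≤ind false = ≤-refl

  ind≤1 : ∀ b → ind b ≤ 1ℚ
  ind≤1 true = ≤-refl
  ind≤1 false = 0≤1

  ind-mono : ∀ {b c} → (b ≡ true → c ≡ true) → ind b ≤ ind c
  ind-mono {false} {c} _ = 0≤ind c
  ind-mono {true} h rewrite h refl = ≤-refl

  E-cong : ∀ p {f g : Vec Bool m → ℚ} → (∀ ω → f ω ≡ g ω) → E p f ≡ E p g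
  E-cong {zero} p h = h []
  E-cong {suc m} p h = cong₂ (λ x y → p * x + (1ℚ - p) * y) (E-cong p (h ∘ (true ∷_))) (E-cong p (h ∘ (false ∷_)))

  E-const : ∀ m p c → E {m} p (λ _ → c) ≡ c
  E-const zero p c = refl
  E-const (suc m) p c rewrite E-const m p c = solve 2 (λ p c → p :* c :+ (con 1ℚ :- p) :* c := c) refl p c

  E-+ : ∀ p (f g : Vec Bool m → ℚ) → E p (λ ω → f ω + g ω) ≡ E p f + E p g
  E-+ {zero} p f g = refl
  E-+ {suc m} p f g
    rewrite E-+ p (f ∘ (true ∷_)) (g ∘ (true ∷_)) | E-+ p (f ∘ (false ∷_)) (g ∘ (false ∷_)) =
    solve 6 (λ p q a b c d → p :* (a :+ b) :+ q :* (c :+ d) := (p :* a :+ q :* c) :+ (p :* b :+ q :* d)) refl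
      p (1ℚ - p) (E p (f ∘ (true ∷_))) (E p (g ∘ (true ∷_))) (E p (f ∘ (false ∷_))) (E p (g ∘ (false ∷_)))

  E-*ˡ : ∀ p c (f : Vec Bool m → ℚ) → E p (λ ω → c * f ω) ≡ c * E p f
  E-*ˡ {zero} p c f = refl
  E-*ˡ {suc m} p c f
    rewrite E-*ˡ p c (f ∘ (true ∷_)) | E-*ˡ p c (f ∘ (false ∷_)) =
    solve 5 (λ p q c a b → p :* (c :* a) :+ q :* (c :* b) := c :* (p :* a :+ q :* b)) refl
      p (1ℚ - p) c (E p (f ∘ (true ∷_))) (E p (f ∘ (false ∷_)))

  E-neg : ∀ p (f : Vec Bool m → ℚ) → E p (λ ω → - f ω) ≡ - E p f
  E-neg p f = trans (E-cong p (λ ω → neg≡ (f ω))) (trans (E-*ˡ p (- 1ℚ) f) (sym (neg≡ (E p f))))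
    where
    neg≡ : ∀ x → - x ≡ (- 1ℚ) * x
    neg≡ = solve 1 (λ x → :- x := (:- con 1ℚ) :* x) refl

  E-sub : ∀ p (f g : Vec Bool m → ℚ) → E p (λ ω → f ω - g ω) ≡ E p f - E p g
  E-sub p f g = trans (E-+ p f (λ ω → - g ω)) (cong (E p f +_) (E-neg p g))

  E-∑ : ∀ {a} {A : Set a} p (xs : List A) (f : A → Vec Bool m → ℚ) →
    E p (λ ω → ∑ xs (λ x → f x ω)) ≡ ∑ xs (λ x → E p (f x))
  E-∑ {m} p [] f = E-const m p 0ℚ
  E-∑ p (x ∷ xs) f = trans (E-+ p (f x) (λ ω → ∑ xs (λ y → f y ω))) (cong (E p (f x) +_) (E-∑ p xs f))

  set : Fin m → Vec Bool m → Vec Bool m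
  set i ω = ω [ i ]≔ true

  -- Independence of one coordinate: the factor `ind (lookup ω i)` leaves only outcomes fixed by
  -- `set i`, and `f ∘ set i` does not depend on coordinate `i`.
  E-lookup : ∀ p (i : Fin m) (f : Vec Bool m → ℚ) →
    E p (λ ω → ind (lookup ω i) * f ω) ≡ p * E p (f ∘ set i)
  E-lookup {suc m} p zero f
    rewrite E-cong p (λ ω → *-identityˡ (f (true ∷ ω))) | E-cong p (λ ω → *-zeroˡ (f (false ∷ ω)))
          | E-const m p 0ℚ =
    solve 2 (λ p a → p :* a :+ (con 1ℚ :- p) :* con 0ℚ := p :* (p :* a :+ (con 1ℚ :- p) :* a)) refl p (E p (f ∘ (true ∷_)))
  E-lookup {suc m} p (suc i) f
    rewrite E-lookup p i (f ∘ (true ∷_)) | E-lookup p i (f ∘ (false ∷_)) =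
    solve 4 (λ p q a b → p :* (p :* a) :+ q :* (p :* b) := p :* (p :* a :+ q :* b)) refl p (1ℚ - p)
      (E p (f ∘ (true ∷_) ∘ set i)) (E p (f ∘ (false ∷_) ∘ set i))

  infix 4 _⊑_
  _⊑_ : Vec Bool m → Vec Bool m → Set
  ω ⊑ ω′ = ∀ i → lookup ω i ≡ true → lookup ω′ i ≡ true

  setAll : List (Fin m) → Vec Bool m → Vec Bool m
  setAll [] ω = ω
  setAll (i ∷ I) ω = set i (setAll I ω)

  set-lookup : ∀ (i : Fin m) ω → lookup (set i ω) i ≡ true
  set-lookup i ω = lookup∘updateAt i ω

  set-lookup′ : ∀ {i j : Fin m} ω → j ≢ i → lookup (set i ω) j ≡ lookup ω j
  set-lookup′ {i = i} {j} ω j≢i = lookup∘updateAt′ j i j≢i ω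

  ⊑-set : ∀ (i : Fin m) ω → ω ⊑ set i ω
  ⊑-set i ω j h with j FinP.≟ i
  ... | yes refl = set-lookup i ω
  ... | no j≢i = trans (set-lookup′ ω j≢i) h

  ⊑-setAll : ∀ (I : List (Fin m)) ω → ω ⊑ setAll I ω
  ⊑-setAll [] ω j h = h
  ⊑-setAll (i ∷ I) ω j h = ⊑-set i (setAll I ω) j (⊑-setAll I ω j h)

  setAll-lookup′ : ∀ {I : List (Fin m)} {j} ω → j ∉ I → lookup (setAll I ω) j ≡ lookup ω j
  setAll-lookup′ {I = []} ω j∉ = refl
  setAll-lookup′ {I = i ∷ I} ω j∉ =
    trans (set-lookup′ (setAll I ω) (λ e → j∉ (here e))) (setAll-lookup′ ω (λ h → j∉ (there h)))

  allT : List (Fin m) → Vec Bool m → Bool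
  allT [] ω = true
  allT (i ∷ I) ω = lookup ω i ∧ allT I ω

  allT⁺ : ∀ {I : List (Fin m)} {ω} → (∀ i → i ∈ I → lookup ω i ≡ true) → allT I ω ≡ true
  allT⁺ {I = []} h = refl
  allT⁺ {I = i ∷ I} h rewrite h i (here refl) = allT⁺ (λ j j∈ → h j (there j∈))

  allT⁻ : ∀ {I : List (Fin m)} {ω} → allT I ω ≡ true → ∀ i → i ∈ I → lookup ω i ≡ true
  allT⁻ {I = j ∷ I} {ω} h i i∈ with lookup ω j in eq
  allT⁻ {I = j ∷ I} {ω} h i (here refl) | true = eq
  allT⁻ {I = j ∷ I} {ω} h i (there i∈) | true = allT⁻ {I = I} h i i∈

  none : List (List (Fin m)) → Vec Bool m → Bool
  none [] ω = true
  none (I ∷ Is) ω = not (allT I ω) ∧ none Is ω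

  none⁻ : ∀ {Is : List (List (Fin m))} {ω} → none Is ω ≡ true → ∀ I → I ∈ Is → allT I ω ≡ false
  none⁻ {Is = J ∷ Is} {ω} h I I∈ with allT J ω in eq
  none⁻ {Is = J ∷ Is} {ω} h I (here refl) | false = eq
  none⁻ {Is = J ∷ Is} {ω} h I (there I∈) | false = none⁻ {Is = Is} h I I∈

  allT-⊑ : ∀ (I : List (Fin m)) {ω ω′} → ω ⊑ ω′ → allT I ω ≡ true → allT I ω′ ≡ true
  allT-⊑ I h k = allT⁺ (λ i i∈ → h i (allT⁻ {I = I} k i i∈))

  none-⊑ : ∀ (Is : List (List (Fin m))) {ω ω′} → ω ⊑ ω′ → none Is ω′ ≡ true → none Is ω ≡ true
  none-⊑ [] h k = refl
  none-⊑ (I ∷ Is) {ω} {ω′} h k with allT I ω in eq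
  ... | false = none-⊑ Is {ω} {ω′} h (right (allT I ω′) k)
    where
    right : ∀ b {c} → not b ∧ c ≡ true → c ≡ true
    right false e = e
  ... | true rewrite allT-⊑ I {ω} {ω′} h eq = k

  ind-∧ : ∀ b c → ind (b ∧ c) ≡ ind b * ind c
  ind-∧ true c = sym (*-identityˡ (ind c))
  ind-∧ false c = sym (*-zeroˡ (ind c))

  ind-not : ∀ b → ind (not b) ≡ 1ℚ - ind b
  ind-not true = refl
  ind-not false = refl

  allTSet : ∀ {i : Fin m} {I} ω → i ∉ I → allT I (set i ω) ≡ allT I ω
  allTSet {I = []} ω i∉ = refl
  allTSet {I = j ∷ I} ω i∉ =
    cong₂ _∧_ (set-lookup′ ω (λ e → i∉ (here (sym e)))) (allTSet ω (λ h → i∉ (there h)))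

  E-none-step : ∀ p (I : List (Fin m)) Is →
    E p (λ ω → ind (none (I ∷ Is) ω)) ≡ E p (λ ω → ind (none Is ω)) - E p (λ ω → ind (allT I ω) * ind (none Is ω))
  E-none-step p I Is = trans (E-cong p pointwise) (E-sub p (λ ω → ind (none Is ω)) (λ ω → ind (allT I ω) * ind (none Is ω)))
    where
    pointwise : ∀ ω → ind (not (allT I ω) ∧ none Is ω) ≡ ind (none Is ω) - ind (allT I ω) * ind (none Is ω)
    pointwise ω = trans (ind-∧ (not (allT I ω)) (none Is ω)) (trans (cong (_* ind (none Is ω)) (ind-not (allT I ω)))
      (solve 2 (λ a b → (con 1ℚ :- a) :* b := b :- a :* b) refl (ind (allT I ω)) (ind (none Is ω))))

  module _ {p : ℚ} (0≤p : 0ℚ ≤ p) (p≤1 : p ≤ 1ℚ) where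

    E-mono : ∀ {f g : Vec Bool m → ℚ} → (∀ ω → f ω ≤ g ω) → E p f ≤ E p g
    E-mono {m = zero} h = h []
    E-mono {m = suc m} h = +-mono-≤ (*-monoˡ 0≤p (E-mono (h ∘ (true ∷_)))) (*-monoˡ (0≤sub p≤1) (E-mono (h ∘ (false ∷_))))

    E-nonneg : ∀ {f : Vec Bool m → ℚ} → (∀ ω → 0ℚ ≤ f ω) → 0ℚ ≤ E p f
    E-nonneg {m = m} {f} h = subst (_≤ E p f) (E-const m p 0ℚ) (E-mono h)

    -- A repeated coordinate lowers the power of p but not the event, so this direction holds for
    -- every list, in particular for clique masks.
    E-allT≥ : ∀ (I : List (Fin m)) {f : Vec Bool m → ℚ} → (∀ ω → 0ℚ ≤ f ω) →
      p ^ℚ length I * E p (f ∘ setAll I) ≤ E p (λ ω → ind (allT I ω) * f ω)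
    E-allT≥ [] {f} h = ≤-reflexive (trans (*-identityˡ _) (E-cong p (λ ω → sym (*-identityˡ (f ω)))))
    E-allT≥ (i ∷ I) {f} h = begin
      p * p ^ℚ length I * E p (f ∘ set i ∘ setAll I) ≡⟨ *-assoc p _ _ ⟩
      p * (p ^ℚ length I * E p (f ∘ set i ∘ setAll I)) ≤⟨ *-monoˡ 0≤p (E-allT≥ I (h ∘ set i)) ⟩
      p * E p (λ ω → ind (allT I ω) * f (set i ω)) ≤⟨ *-monoˡ 0≤p (E-mono (λ ω → *-monoʳ (h (set i ω)) (ind-mono (allT-⊑ I (⊑-set i ω))))) ⟩
      p * E p (λ ω → ind (allT I (set i ω)) * f (set i ω)) ≡⟨ sym (E-lookup p i (λ ω → ind (allT I ω) * f ω)) ⟩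
      E p (λ ω → ind (lookup ω i) * (ind (allT I ω) * f ω)) ≡⟨ E-cong p (λ ω → trans (sym (*-assoc (ind (lookup ω i)) _ _)) (cong (_* f ω) (sym (ind-∧ (lookup ω i) _)))) ⟩
      E p (λ ω → ind (lookup ω i ∧ allT I ω) * f ω) ∎
      where open ≤-Reasoning

    E-allT : ∀ {I : List (Fin m)} → Unique I → ∀ (f : Vec Bool m → ℚ) →
      E p (λ ω → ind (allT I ω) * f ω) ≡ p ^ℚ length I * E p (f ∘ setAll I)
    E-allT [] f = trans (E-cong p (λ ω → *-identityˡ (f ω))) (sym (*-identityˡ _))
    E-allT {I = i ∷ I} (i∉ ∷ u) f = begin
      E p (λ ω → ind (lookup ω i ∧ allT I ω) * f ω) ≡⟨ E-cong p (λ ω → trans (cong (_* f ω) (ind-∧ (lookup ω i) _)) (*-assoc (ind (lookup ω i)) _ _)) ⟩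
      E p (λ ω → ind (lookup ω i) * (ind (allT I ω) * f ω)) ≡⟨ E-lookup p i (λ ω → ind (allT I ω) * f ω) ⟩
      p * E p (λ ω → ind (allT I (set i ω)) * f (set i ω)) ≡⟨ cong (p *_) (E-cong p (λ ω → cong (λ b → ind b * f (set i ω)) (allTSet ω (λ h → All.lookup i∉ h refl)))) ⟩
      p * E p (λ ω → ind (allT I ω) * f (set i ω)) ≡⟨ cong (p *_) (E-allT u (f ∘ set i)) ⟩
      p * (p ^ℚ length I * E p (f ∘ set i ∘ setAll I)) ≡⟨ sym (*-assoc p _ _) ⟩
      p * p ^ℚ length I * E p (f ∘ set i ∘ setAll I) ∎
      where open ≡-Reasoning

    -- The first-moment bound: each step of the induction gives up the event that `I` is fully
    -- present, which has probability `p ^ℚ length I` because its coordinates are distinct.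
    none-union : ∀ (Is : List (List (Fin m))) → (∀ I → I ∈ Is → Unique I) →
      1ℚ - ∑ Is (λ I → p ^ℚ length I) ≤ E p (λ ω → ind (none Is ω))
    none-union {m = m} [] u = ≤-reflexive (sym (E-const m p 1ℚ))
    none-union {m = m} (I ∷ Is) u = begin
      1ℚ - (p ^ℚ length I + S) ≡⟨ solve 2 (λ a b → con 1ℚ :- (a :+ b) := (con 1ℚ :- b) :- a) refl (p ^ℚ length I) S ⟩
      (1ℚ - S) - p ^ℚ length I ≤⟨ sub-mono (none-union Is (λ J J∈ → u J (there J∈))) allT≤ ⟩
      E p (λ ω → ind (none Is ω)) - E p (λ ω → ind (allT I ω) * ind (none Is ω)) ≡⟨ sym (E-none-step p I Is) ⟩
      E p (λ ω → ind (none (I ∷ Is) ω)) ∎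
      where
      open ≤-Reasoning
      S = ∑ Is (λ J → p ^ℚ length J)
      allT≤ : E p (λ ω → ind (allT I ω) * ind (none Is ω)) ≤ p ^ℚ length I
      allT≤ = begin
        E p (λ ω → ind (allT I ω) * ind (none Is ω)) ≤⟨ E-mono (λ ω → *-monoˡ (0≤ind (allT I ω)) (ind≤1 (none Is ω))) ⟩
        E p (λ ω → ind (allT I ω) * 1ℚ) ≡⟨ E-allT (u I (here refl)) (λ _ → 1ℚ) ⟩
        p ^ℚ length I * E {m} p (λ _ → 1ℚ) ≡⟨ cong (p ^ℚ length I *_) (E-const m p 1ℚ) ⟩
        p ^ℚ length I * 1ℚ ≡⟨ *-identityʳ _ ⟩
        p ^ℚ length I ∎

  -- Instead of coupling two random graphs: the expectation is affine in the probability of the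
  -- first coordinate, with slope E f₁ - E f₀, which is nonnegative for increasing `f`. This lets
  -- (i) be proved at a convenient smaller probability.
  E-monoᵖ : ∀ {p q} → 0ℚ ≤ p → p ≤ q → q ≤ 1ℚ → (f : Vec Bool m → ℚ) →
    (∀ ω ω′ → ω ⊑ ω′ → f ω ≤ f ω′) → E p f ≤ E q f
  E-monoᵖ {m = zero} _ _ _ f _ = ≤-refl
  E-monoᵖ {m = suc m} {p} {q} 0≤p p≤q q≤1 f mono = begin
    p * E p f₁ + (1ℚ - p) * E p f₀ ≤⟨ +-mono-≤ (*-monoˡ 0≤p (rec f₁ (λ ω ω′ h → mono (true ∷ ω) (true ∷ ω′) (ext {true} {ω} {ω′} h))))
                                           (*-monoˡ (0≤sub (≤-trans p≤q q≤1)) (rec f₀ (λ ω ω′ h → mono (false ∷ ω) (false ∷ ω′) (ext {false} {ω} {ω′} h)))) ⟩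
    p * E q f₁ + (1ℚ - p) * E q f₀ ≡⟨ solve 3 (λ p a b → p :* a :+ (con 1ℚ :- p) :* b := b :+ p :* (a :- b)) refl p (E q f₁) (E q f₀) ⟩
    E q f₀ + p * (E q f₁ - E q f₀) ≤⟨ +-monoʳ-≤ (E q f₀) (*-monoʳ (0≤sub f₀≤f₁) p≤q) ⟩
    E q f₀ + q * (E q f₁ - E q f₀) ≡⟨ solve 3 (λ p a b → b :+ p :* (a :- b) := p :* a :+ (con 1ℚ :- p) :* b) refl q (E q f₁) (E q f₀) ⟩
    q * E q f₁ + (1ℚ - q) * E q f₀ ∎
    where
    open ≤-Reasoning
    f₁ = f ∘ (true ∷_)
    f₀ = f ∘ (false ∷_)
    rec = E-monoᵖ {m = m} 0≤p p≤q q≤1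
    ext : ∀ {b} {ω ω′ : Vec Bool m} → ω ⊑ ω′ → (b ∷ ω) ⊑ (b ∷ ω′)
    ext h zero e = e
    ext h (suc i) e = h i e
    f₀≤f₁ : E q f₀ ≤ E q f₁
    f₀≤f₁ = E-mono (≤-trans 0≤p p≤q) q≤1 (λ ω → mono (false ∷ ω) (true ∷ ω) λ { zero () ; (suc i) e → e })

  outcomes : ∀ m → List (Vec Bool m)
  outcomes zero = [] ∷ []
  outcomes (suc m) = map (true ∷_) (outcomes m) ++ map (false ∷_) (outcomes m)

  outcomes-unique : ∀ m → Unique (outcomes m)
  outcomes-unique zero = [] ∷ []
  outcomes-unique (suc m) = Uniq.++⁺ (Uniq.map⁺ ∷-injectiveʳ (outcomes-unique m)) (Uniq.map⁺ ∷-injectiveʳ (outcomes-unique m)) disjoint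
    where
    disjoint : ∀ {ω} → ¬ (ω ∈ map (true ∷_) (outcomes m) × ω ∈ map (false ∷_) (outcomes m))
    disjoint (h , k) with ∈-map⁻ _ h | ∈-map⁻ _ k
    ... | _ , _ , refl | _ , _ , ()

  E≡∑ : ∀ p (f : Vec Bool m → ℚ) → E p f ≡ ∑ (outcomes m) (λ ω → weight p ω * f ω)
  E≡∑ {zero} p f = sym (trans (+-identityʳ _) (*-identityˡ _))
  E≡∑ {suc m} p f = begin
    p * E p f₁ + (1ℚ - p) * E p f₀ ≡⟨ cong₂ (λ x y → p * x + (1ℚ - p) * y) (E≡∑ p f₁) (E≡∑ p f₀) ⟩
    p * ∑ Ω (λ ω → weight p ω * f₁ ω) + (1ℚ - p) * ∑ Ω (λ ω → weight p ω * f₀ ω) ≡⟨ sym (cong₂ _+_ (∑-*ˡ Ω p) (∑-*ˡ Ω (1ℚ - p))) ⟩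
    ∑ Ω (λ ω → p * (weight p ω * f₁ ω)) + ∑ Ω (λ ω → (1ℚ - p) * (weight p ω * f₀ ω))
      ≡⟨ cong₂ _+_ (∑-cong Ω (λ ω → sym (*-assoc p _ _))) (∑-cong Ω (λ ω → sym (*-assoc (1ℚ - p) _ _))) ⟩
    ∑ Ω (λ ω → weight p (true ∷ ω) * f₁ ω) + ∑ Ω (λ ω → weight p (false ∷ ω) * f₀ ω) ≡⟨ sym (cong₂ _+_ (∑-map Ω (true ∷_)) (∑-map Ω (false ∷_))) ⟩
    ∑ (map (true ∷_) Ω) (λ ω → weight p ω * f ω) + ∑ (map (false ∷_) Ω) (λ ω → weight p ω * f ω) ≡⟨ sym (∑-++ (map (true ∷_) Ω) _) ⟩
    ∑ (outcomes (suc m)) (λ ω → weight p ω * f ω) ∎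
    where
    open ≡-Reasoning
    Ω = outcomes m
    f₁ = f ∘ (true ∷_)
    f₀ = f ∘ (false ∷_)

  -- `PrAtLeast` asks for an explicit list of outcomes; a Boolean condition sufficient for `A`
  -- supplies it by filtering.
  prAtLeast : ∀ {n p q} {A : Graph n → Set} (f : Graph n → Bool) → (∀ ω → f ω ≡ true → A ω) →
    q ≤ E p (ind ∘ f) → PrAtLeast n p A q
  prAtLeast {n} {p} {q} {A} f sound q≤ =
    List.filter P? (outcomes (N n)) , Uniq.filter⁺ P? (outcomes-unique (N n)) ,
    All.map (λ {ω} → sound ω) (AllP.all-filter P? (outcomes (N n))) ,
    ≤-trans q≤ (≤-reflexive (trans (E≡∑ p (ind ∘ f)) (sum-filter (outcomes (N n)))))
    where
    import Data.List.Relation.Unary.All.Properties as AllP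
    import Data.Bool.Properties as BoolP
    P? = λ ω → f ω BoolP.≟ true
    sum-filter : ∀ Ω → ∑ Ω (λ ω → weight p ω * ind (f ω)) ≡ ∑ (List.filter P? Ω) (weight p)
    sum-filter [] = refl
    sum-filter (ω ∷ Ω) with f ω
    ... | true = cong₂ _+_ (*-identityʳ (weight p ω)) (sum-filter Ω)
    ... | false = trans (cong₂ _+_ (*-zeroʳ (weight p ω)) (sum-filter Ω)) (+-identityˡ _)

-- A product form of Janson's inequality.

module Janson where
  open Rat
  open Sums
  open Prob
  open import Data.Vec as Vec using (Vec)
  open import Data.Rational
  open import Data.Rational.Properties
  open import Data.Rational.Solver using (module +-*-Solver)
  open +-*-Solver using (solve; _:+_; _:=_; _:*_; :-_; _:-_; con)

  module Lower {m : ℕ} {p : ℚ} (0≤p : 0ℚ ≤ p) (p≤1 : p ≤ 1ℚ)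
    {T : Set} (mask : T → List (Fin m)) (w : T → T → ℚ) (0≤w : ∀ y x → 0ℚ ≤ w y x) where

    Pr : List (List (Fin m)) → ℚ
    Pr Is = E p (ind ∘ none Is)

    -- Given that `mask x` is present, `mask y` can be completed only if `J` is present. Hence
    -- `w y x` bounds the conditional probability of y given x.
    Overlap : T → T → Set
    Overlap x y = Σ (List (Fin m)) λ J →
      Unique J × (∀ i → i ∈ J → i ∈ mask y × i ∉ mask x) × p ^ℚ length J ≤ w y x

    Related : T → T → Set
    Related x y = (∀ i → i ∈ mask y → i ∉ mask x) ⊎ Overlap x y

    module _ (x : T) where

      I = mask x

      disjoint overlapping : ∀ {ys} → All (Related x) ys → List (List (Fin m))
      disjoint [] = []
      disjoint (_∷_ {y} (inj₁ _) r) = mask y ∷ disjoint r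
      disjoint (inj₂ _ ∷ r) = disjoint r
      overlapping [] = []
      overlapping (inj₁ _ ∷ r) = overlapping r
      overlapping (inj₂ (J , _) ∷ r) = J ∷ overlapping r

      overlapping-unique : ∀ {ys} (r : All (Related x) ys) → ∀ J → J ∈ overlapping r → Unique J
      overlapping-unique (inj₁ _ ∷ r) J J∈ = overlapping-unique r J J∈
      overlapping-unique (inj₂ (_ , u , _) ∷ r) J (here refl) = u
      overlapping-unique (inj₂ _ ∷ r) J (there J∈) = overlapping-unique r J J∈

      overlapping-weight : ∀ {ys} (r : All (Related x) ys) →
        ∑ (overlapping r) (λ J → p ^ℚ length J) ≤ ∑ ys (λ y → w y x)
      overlapping-weight [] = ≤-refl
      overlapping-weight (_∷_ {y} (inj₁ _) r) = ≤-trans (overlapping-weight r) (x≤y+x (0≤w y x))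
      overlapping-weight (inj₂ (_ , _ , _ , h) ∷ r) = +-mono-≤ h (overlapping-weight r)

      none-disjoint : ∀ {ys} (r : All (Related x) ys) ω →
        none (map mask ys) ω ≡ true → none (disjoint r) ω ≡ true
      none-disjoint [] ω h = refl
      none-disjoint (_∷_ {y} (inj₁ _) r) ω h with allT (mask y) ω
      ... | false = none-disjoint r ω h
      none-disjoint (_∷_ {y} (inj₂ _) r) ω h with allT (mask y) ω
      ... | false = none-disjoint r ω h

      hits : ∀ {ys} → All (Related x) ys → Vec Bool m → ℚ
      hits r ω = ∑ (overlapping r) (λ J → ind (allT J ω))

      0≤hits : ∀ {ys} (r : All (Related x) ys) ω → 0ℚ ≤ hits r ω
      0≤hits r ω = ∑-nonneg (overlapping r) (λ J → 0≤ind (allT J ω))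

      -- If neither a mask of `disjoint r` nor a `J` is complete in ω, then switching on `I`
      -- completes no mask of `ys`. If some `J` is complete, then `hits` is at least 1 and the left
      -- side is at most 0.
      pointwise : ∀ {ys} (r : All (Related x) ys) ω →
        ind (none (disjoint r) ω) * (1ℚ - hits r ω) ≤ ind (none (map mask ys) (setAll I ω))
      pointwise [] ω = ≤-refl
      pointwise (_∷_ {y} {ys} (inj₁ dis) r) ω with allT (mask y) ω in eq
      ... | true = subst (_≤ rhs) (sym (*-zeroˡ (1ℚ - hits r ω))) (0≤ind (none (mask y ∷ map mask ys) (setAll I ω)))
        where rhs = ind (none (mask y ∷ map mask ys) (setAll I ω))
      ... | false with allT (mask y) (setAll I ω) in eq′
      ...   | false = pointwise r ω
      ...   | true with trans (sym eq) (allT⁺ {I = mask y} (λ i i∈ →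
                trans (sym (setAll-lookup′ ω (dis i i∈))) (allT⁻ {I = mask y} eq′ i i∈)))
      ...     | ()
      pointwise (_∷_ {y} {ys} (inj₂ (J , _ , sub , _)) r) ω with allT J ω in eq
      ... | true = begin
        d * (1ℚ - (1ℚ + hits r ω)) ≡⟨ cong (d *_) (solve 1 (λ h → con 1ℚ :- (con 1ℚ :+ h) := :- h) refl (hits r ω)) ⟩
        d * (- hits r ω) ≤⟨ *-monoˡ (0≤ind (none (disjoint r) ω)) (neg-antimono-≤ (0≤hits r ω)) ⟩
        d * 0ℚ ≡⟨ *-zeroʳ d ⟩
        0ℚ ≤⟨ 0≤ind (none (mask y ∷ map mask ys) (setAll I ω)) ⟩
        ind (none (mask y ∷ map mask ys) (setAll I ω)) ∎
        where
        open ≤-Reasoning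
        d = ind (none (disjoint r) ω)
      ... | false with allT (mask y) (setAll I ω) in eq′
      ...   | true with trans (sym eq) (allT⁺ {I = J} (λ i i∈ →
                trans (sym (setAll-lookup′ ω (proj₂ (sub i i∈)))) (allT⁻ {I = mask y} eq′ i (proj₁ (sub i i∈)))))
      ...     | ()
      pointwise (_∷_ {y} {ys} (inj₂ (J , _ , sub , _)) r) ω | false | false =
        subst (λ h → ind (none (disjoint r) ω) * (1ℚ - h) ≤ ind (none (map mask ys) (setAll I ω)))
          (sym (+-identityˡ (hits r ω))) (pointwise r ω)

      -- The right side is the probability of avoiding `ys` given that `mask x` is present. Masks
      -- disjoint from it are unaffected; the others cost at most half of `Pr D`, because each `J`
      -- is negatively correlated with the decreasing event `none D`.
      conditioned : ∀ {ys} → All (Related x) ys → ∑ ys (λ y → w y x) ≤ ½ →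
        ½ * Pr (map mask ys) ≤ E p (λ ω → ind (none (map mask ys) (setAll I ω)))
      conditioned {ys} r w≤½ = begin
        ½ * Pr (map mask ys) ≤⟨ *-monoˡ 0≤½ (E-mono 0≤p p≤1 (λ ω → ind-mono (none-disjoint r ω))) ⟩
        ½ * P ≡⟨ *-comm ½ P ⟩
        P * ½ ≤⟨ *-monoˡ 0≤P (sub-mono {1ℚ} {1ℚ} ≤-refl (≤-trans (overlapping-weight r) w≤½)) ⟩
        P * (1ℚ - ∑ Js (λ J → p ^ℚ length J)) ≡⟨ solve 2 (λ P s → P :* (con 1ℚ :- s) := P :- P :* s) refl P _ ⟩
        P - P * ∑ Js (λ J → p ^ℚ length J) ≡⟨ cong (λ s → P - s) (sym (∑-*ˡ Js P)) ⟩
        P - ∑ Js (λ J → P * p ^ℚ length J) ≤⟨ sub-mono {P} ≤-refl (∑-mono Js (λ J J∈ → correlation J (overlapping-unique r J J∈))) ⟩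
        P - ∑ Js (λ J → E p (λ ω → ind (none D ω) * ind (allT J ω))) ≡⟨ cong (λ s → P - s) (sym (E-∑ p Js (λ J ω → ind (none D ω) * ind (allT J ω)))) ⟩
        P - E p (λ ω → ∑ Js (λ J → ind (none D ω) * ind (allT J ω))) ≡⟨ sym (E-sub p (ind ∘ none D) (λ ω → ∑ Js (λ J → ind (none D ω) * ind (allT J ω)))) ⟩
        E p (λ ω → ind (none D ω) - ∑ Js (λ J → ind (none D ω) * ind (allT J ω)))
          ≡⟨ E-cong p (λ ω → trans (cong (λ s → ind (none D ω) - s) (∑-*ˡ Js (ind (none D ω))))
               (solve 2 (λ P s → P :- P :* s := P :* (con 1ℚ :- s)) refl (ind (none D ω)) (hits r ω))) ⟩
        E p (λ ω → ind (none D ω) * (1ℚ - hits r ω)) ≤⟨ E-mono 0≤p p≤1 (pointwise r) ⟩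
        E p (λ ω → ind (none (map mask ys) (setAll I ω))) ∎
        where
        open ≤-Reasoning
        D = disjoint r
        Js = overlapping r
        P = Pr D
        0≤½ : 0ℚ ≤ ½
        0≤½ = nonNegative⁻¹ ½
        0≤P : 0ℚ ≤ P
        0≤P = E-nonneg 0≤p p≤1 (λ ω → 0≤ind (none D ω))
        -- Setting the coordinates in J to true can only destroy the decreasing event none D.
        correlation : ∀ J → Unique J → E p (λ ω → ind (none D ω) * ind (allT J ω)) ≤ P * p ^ℚ length J
        correlation J u = begin
          E p (λ ω → ind (none D ω) * ind (allT J ω)) ≡⟨ E-cong p (λ ω → *-comm (ind (none D ω)) _) ⟩
          E p (λ ω → ind (allT J ω) * ind (none D ω)) ≡⟨ E-allT 0≤p p≤1 u (ind ∘ none D) ⟩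
          p ^ℚ length J * E p (ind ∘ none D ∘ setAll J)
            ≤⟨ *-monoˡ (^-nonneg (length J) 0≤p) (E-mono 0≤p p≤1 (λ ω → ind-mono (none-⊑ D {ω} {setAll J ω} (⊑-setAll J ω)))) ⟩
          p ^ℚ length J * P ≡⟨ *-comm _ P ⟩
          P * p ^ℚ length J ∎

    data Compatible : List T → Set where
      [] : Compatible []
      _∷_ : ∀ {x ys} → All (Related x) ys × ∑ ys (λ y → w y x) ≤ ½ → Compatible ys → Compatible (x ∷ ys)

    -- Conditioned on avoiding the later masks, `mask x` is still present with probability at least
    -- ½ π, so every mask contributes a factor 1 - ½ π.
    janson : ∀ {π} → 0ℚ ≤ π → π ≤ 1ℚ → (∀ x → π ≤ p ^ℚ length (mask x)) →
      ∀ {xs} → Compatible xs → Pr (map mask xs) ≤ (1ℚ - ½ * π) ^ℚ length xs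
    janson 0≤π π≤1 π≤ [] = ≤-reflexive (E-const m p 1ℚ)
    janson {π} 0≤π π≤1 π≤ (_∷_ {x} {ys} (r , w≤½) c) = begin
      Pr (mask x ∷ map mask ys) ≡⟨ E-none-step p (mask x) (map mask ys) ⟩
      P - E p (λ ω → ind (allT (mask x) ω) * ind (none (map mask ys) ω))
        ≤⟨ sub-mono {P} ≤-refl (≤-trans
             (*-mono (^-nonneg (length (mask x)) 0≤p) (0≤* (nonNegative⁻¹ ½) 0≤P) (π≤ x) (conditioned x r w≤½))
             (E-allT≥ 0≤p p≤1 (mask x) (λ ω → 0≤ind (none (map mask ys) ω)))) ⟩
      P - π * (½ * P) ≡⟨ solve 2 (λ P π → P :- π :* (con ½ :* P) := (con 1ℚ :- con ½ :* π) :* P) refl P π ⟩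
      (1ℚ - ½ * π) * P ≤⟨ *-monoˡ (0≤sub (*-mono 0≤1 0≤π ½≤1 π≤1)) (janson 0≤π π≤1 π≤ c) ⟩
      (1ℚ - ½ * π) * (1ℚ - ½ * π) ^ℚ length ys ∎
      where
      open ≤-Reasoning
      P = Pr (map mask ys)
      0≤P : 0ℚ ≤ P
      0≤P = E-nonneg 0≤p p≤1 (λ ω → 0≤ind (none (map mask ys) ω))
      ½≤1 : ½ ≤ 1ℚ
      ½≤1 = *≤* (Data.Integer.+≤+ (ℕ.s≤s ℕ.z≤n))
        where import Data.Integer

-- Edges of the complete graph as coordinates of the random vector.

module Slots where
  open import Data.Nat as ℕ using (ℕ; zero; suc; _≤_; _<_; z≤n; s≤s; _+_)
  open import Data.List using (lookup)
  open import Data.List.Relation.Binary.Disjoint.Propositional using (Disjoint)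
  open import Data.List.Membership.Propositional.Properties
  open import Data.Vec as Vec using (Vec; []; _∷_; toList)
  open import Data.Product.Properties using (≡-dec; ,-injectiveˡ; ,-injectiveʳ)

  unique-concatMap : ∀ {a b} {A : Set a} {B : Set b} (g : A → List B) {xs : List A} → Unique xs →
    (∀ x → Unique (g x)) → (∀ {x y} → x ≢ y → Disjoint (g x) (g y)) → Unique (concatMap g xs)
  unique-concatMap g u ug dis =
    Uniq.concat⁺ (AllP.map⁺ (All.universal ug _)) (AllPairsP.map⁺ (AllPairs.map dis u))

  ∈-remove : ∀ {a} {A : Set a} {x : A} {ys} → x ∈ ys →
    ∃[ zs ] (length ys ≡ suc (length zs) × (∀ {z} → z ∈ ys → z ≢ x → z ∈ zs))
  ∈-remove {ys = y ∷ ys} (here refl) = ys , refl , λ { (here refl) z≢ → ⊥-elim (z≢ refl) ; (there z∈) _ → z∈ }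
  ∈-remove {ys = y ∷ ys} (there x∈) with ∈-remove x∈
  ... | zs , eq , h = y ∷ zs , cong suc eq , λ { (here refl) _ → here refl ; (there z∈) z≢ → there (h z∈ z≢) }

  unique-length : ∀ {a} {A : Set a} {xs ys : List A} → Unique xs → (∀ {x} → x ∈ xs → x ∈ ys) → length xs ≤ length ys
  unique-length [] _ = z≤n
  unique-length {xs = x ∷ xs} (x∉ ∷ u) h with ∈-remove (h (here refl))
  ... | zs , eq , k = subst (suc (length xs) ≤_) (sym eq)
          (s≤s (unique-length u (λ y∈ → k (h (there y∈)) (λ e → All.lookup x∉ y∈ (sym e)))))

  lookup-injective : ∀ {a} {A : Set a} {xs : List A} → Unique xs → ∀ {i j} → lookup xs i ≡ lookup xs j → i ≡ j
  lookup-injective (_ ∷ _) {zero} {zero} e = refl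
  lookup-injective {xs = x ∷ xs} (x∉ ∷ _) {zero} {suc j} e = ⊥-elim (All.lookup x∉ (∈-lookup j) e)
  lookup-injective {xs = x ∷ xs} (x∉ ∷ _) {suc i} {zero} e = ⊥-elim (All.lookup x∉ (∈-lookup i) (sym e))
  lookup-injective (_ ∷ u) {suc i} {suc j} e = cong suc (lookup-injective u e)

  ∈-guard⁻ : ∀ {p a} {P : Set p} {A : Set a} (P? : Dec P) {x y : A} → y ∈ (if does P? then x ∷ [] else []) → y ≡ x × P
  ∈-guard⁻ (yes p) (here e) = e , p

  ∈-guard⁺ : ∀ {p a} {P : Set p} {A : Set a} (P? : Dec P) {x : A} → P → x ∈ (if does P? then x ∷ [] else [])
  ∈-guard⁺ (yes _) _ = here refl
  ∈-guard⁺ (no ¬p) p = ⊥-elim (¬p p)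

  unique-guard : ∀ {p a} {P : Set p} {A : Set a} (P? : Dec P) {x : A} → Unique (if does P? then x ∷ [] else [])
  unique-guard (yes _) = [] ∷ []
  unique-guard (no _) = []


  -- An identification of the edges of the complete graph on Fin n with Fin M.
  record Slotting (n M : ℕ) : Set₁ where
    field
      Joins : Fin M → Fin n → Fin n → Set
      Joins? : ∀ k x y → Dec (Joins k x y)
      Joins-sym : ∀ {k x y} → Joins k x y → Joins k y x
      Joins-≢ : ∀ {k x y} → Joins k x y → x ≢ y
      Joins-unique : ∀ {k l x y} → Joins k x y → Joins l x y → k ≡ l
      Joins-ends : ∀ {k x y u v} → Joins k x y → Joins k u v → (u ≡ x × v ≡ y) ⊎ (u ≡ y × v ≡ x)
      joining : ∀ {x y} → x ≢ y → ∃[ k ] Joins k x y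
      joined : ∀ k → ∃[ x ] ∃[ y ] Joins k x y

    Joins-apart : ∀ {k l a b c d} → Joins k a b → Joins l c d → a ≢ c → a ≢ d → k ≢ l
    Joins-apart j j′ a≢c a≢d refl with Joins-ends j′ j
    ... | inj₁ (e , _) = a≢c e
    ... | inj₂ (e , _) = a≢d e

    -- A list with at most one entry, empty for x = y, in place of an optional slot: it can be used
    -- directly in the list comprehensions that enumerate explorations.
    slots : Fin n → Fin n → List (Fin M)
    slots x y = filter (λ k → Joins? k x y) (allFin M)

    ∈-slots⁺ : ∀ {k x y} → Joins k x y → k ∈ slots x y
    ∈-slots⁺ {k} {x} {y} j = ∈-filter⁺ (λ k → Joins? k x y) (∈-allFin k) j

    ∈-slots⁻ : ∀ {k x y} → k ∈ slots x y → Joins k x y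
    ∈-slots⁻ {k} {x} {y} k∈ = proj₂ (∈-filter⁻ (λ k → Joins? k x y) {xs = allFin M} k∈)

    length-slots : ∀ x y → length (slots x y) ≤ 1
    length-slots x y = atMostOne (slots x y) (Uniq.filter⁺ (λ k → Joins? k x y) (Uniq.allFin⁺ M))
      (λ k∈ l∈ → Joins-unique (∈-slots⁻ k∈) (∈-slots⁻ l∈))
      where
      atMostOne : ∀ (ks : List (Fin M)) → Unique ks → (∀ {k l} → k ∈ ks → l ∈ ks → k ≡ l) → length ks ≤ 1
      atMostOne [] _ _ = z≤n
      atMostOne (k ∷ []) _ _ = s≤s z≤n
      atMostOne (k ∷ l ∷ ks) ((k≢l ∷ _) ∷ _) h = ⊥-elim (k≢l (h (here refl) (there (here refl))))

    Adj : Vec Bool M → Fin n → Fin n → Set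
    Adj G x y = ∃[ k ] (Joins k x y × Vec.lookup G k ≡ true)

    Adj⇒≢ : ∀ {G x y} → Adj G x y → x ≢ y
    Adj⇒≢ (_ , j , _) = Joins-≢ j

    Adj-sym : ∀ {G x y} → Adj G x y → Adj G y x
    Adj-sym (k , j , e) = k , Joins-sym j , e

    Adj? : ∀ G x y → Dec (Adj G x y)
    Adj? G x y = FinP.any? (λ k → Joins? k x y ×-dec (Vec.lookup G k BoolP.≟ true))

  module _ {n : ℕ} where

    cell : Fin n → Fin n → List (Fin n × Fin n)
    cell i j = if does (i FinP.<? j) then (i , j) ∷ [] else []

    ∈-cell⁻ : ∀ i j {e} → e ∈ cell i j → e ≡ (i , j) × i Fin.< j
    ∈-cell⁻ i j = ∈-guard⁻ (i FinP.<? j)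

    ∈-cell⁺ : ∀ {i j} → i Fin.< j → (i , j) ∈ cell i j
    ∈-cell⁺ {i} {j} = ∈-guard⁺ (i FinP.<? j)

    row : Fin n → List (Fin n × Fin n)
    row i = concatMap (cell i) (allFin n)

    ∈-row⁻ : ∀ i {e} → e ∈ row i → ∃[ j ] (e ≡ (i , j) × i Fin.< j)
    ∈-row⁻ i e∈ with find (∈-concatMap⁻ (cell i) {xs = allFin n} e∈)
    ... | j , _ , e∈c = j , ∈-cell⁻ i j e∈c

    unique-cell : ∀ i j → Unique (cell i j)
    unique-cell i j = unique-guard (i FinP.<? j)

    unique-pairs : Unique (pairs n)
    unique-pairs = unique-concatMap row (Uniq.allFin⁺ n)
      (λ i → unique-concatMap (cell i) (Uniq.allFin⁺ n) (unique-cell i)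
        (λ {x} {y} x≢y (h , k) → x≢y (,-injectiveʳ (trans (sym (proj₁ (∈-cell⁻ i x h))) (proj₁ (∈-cell⁻ i y k))))))
      (λ {x} {y} x≢y (h , k) → x≢y (,-injectiveˡ (trans (sym (proj₁ (proj₂ (∈-row⁻ x h)))) (proj₁ (proj₂ (∈-row⁻ y k))))))

    ends : Fin (N n) → Fin n × Fin n
    ends = lookup (pairs n)

    ends-injective : ∀ {k l} → ends k ≡ ends l → k ≡ l
    ends-injective = lookup-injective unique-pairs

    ends-< : ∀ {k x y} → ends k ≡ (x , y) → x Fin.< y
    ends-< {k} e with find (∈-concatMap⁻ row {xs = allFin n} (∈-lookup {xs = pairs n} k))
    ... | i , _ , e∈ with ∈-row⁻ i e∈
    ...   | j , e′ , i<j with trans (sym e) e′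
    ...     | refl = i<j

    ends-surjective : ∀ {x y} → x Fin.< y → ∃[ k ] ends k ≡ (x , y)
    ends-surjective {x} {y} x<y = Any.index mem , sym (AnyP.lookup-index mem)
      where
      mem : (x , y) ∈ pairs n
      mem = ∈-concatMap⁺ row (lose (∈-allFin x) (∈-concatMap⁺ (cell x) (lose (∈-allFin y) (∈-cell⁺ x<y))))

    -- `pairs n` lists each pair once and increasingly, whereas explorations meet an edge from
    -- either end.
    data Ends (k : Fin (N n)) (x y : Fin n) : Set where
      fwd : ends k ≡ (x , y) → Ends k x y
      bwd : ends k ≡ (y , x) → Ends k x y

    Ends? : ∀ k x y → Dec (Ends k x y)
    Ends? k x y = map′ Sum.[ fwd , bwd ]′ (λ { (fwd e) → inj₁ e ; (bwd e) → inj₂ e })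
      (≡-dec FinP._≟_ FinP._≟_ (ends k) (x , y) ⊎-dec ≡-dec FinP._≟_ FinP._≟_ (ends k) (y , x))

    Ends-sym : ∀ {k x y} → Ends k x y → Ends k y x
    Ends-sym (fwd e) = bwd e
    Ends-sym (bwd e) = fwd e

    Ends-≢ : ∀ {k x y} → Ends k x y → x ≢ y
    Ends-≢ (fwd e) refl = FinP.<-irrefl refl (ends-< e)
    Ends-≢ (bwd e) refl = FinP.<-irrefl refl (ends-< e)

    Ends-unique : ∀ {k l x y} → Ends k x y → Ends l x y → k ≡ l
    Ends-unique (fwd e) (fwd f) = ends-injective (trans e (sym f))
    Ends-unique (bwd e) (bwd f) = ends-injective (trans e (sym f))
    Ends-unique (fwd e) (bwd f) = ⊥-elim (FinP.<-asym (ends-< e) (ends-< f))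
    Ends-unique (bwd e) (fwd f) = ⊥-elim (FinP.<-asym (ends-< e) (ends-< f))

    Ends-ends : ∀ {k x y u v} → Ends k x y → Ends k u v → (u ≡ x × v ≡ y) ⊎ (u ≡ y × v ≡ x)
    Ends-ends (fwd e) (fwd f) with trans (sym e) f
    ... | refl = inj₁ (refl , refl)
    Ends-ends (fwd e) (bwd f) with trans (sym e) f
    ... | refl = inj₂ (refl , refl)
    Ends-ends (bwd e) (fwd f) with trans (sym e) f
    ... | refl = inj₂ (refl , refl)
    Ends-ends (bwd e) (bwd f) with trans (sym e) f
    ... | refl = inj₁ (refl , refl)

    ends-joining : ∀ {x y} → x ≢ y → ∃[ k ] Ends k x y
    ends-joining {x} {y} x≢y with FinP.<-cmp x y
    ... | tri< x<y _ _ = proj₁ (ends-surjective x<y) , fwd (proj₂ (ends-surjective x<y))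
    ... | tri≈ _ x≡y _ = ⊥-elim (x≢y x≡y)
    ... | tri> _ _ y<x = proj₁ (ends-surjective y<x) , bwd (proj₂ (ends-surjective y<x))

    pairSlotting : Slotting n (N n)
    pairSlotting = record
      { Joins = Ends ; Joins? = Ends? ; Joins-sym = Ends-sym ; Joins-≢ = Ends-≢ ; Joins-unique = Ends-unique
      ; Joins-ends = Ends-ends ; joining = ends-joining ; joined = λ k → _ , _ , fwd refl }

    open Slotting pairSlotting using (Adj)

    Adj⇒Edge : ∀ {G : Graph n} {x y} → x Fin.< y → Adj G x y → Edge G x y
    Adj⇒Edge x<y (k , fwd e , t) = k , e , t
    Adj⇒Edge x<y (k , bwd e , t) = ⊥-elim (FinP.<-asym x<y (ends-< e))

    edgeSlots : Graph n → List (Fin (N n))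
    edgeSlots G = filter (λ k → Vec.lookup G k BoolP.≟ true) (allFin (N n))

    numEdges≡ : ∀ G → numEdges n G ≡ length (edgeSlots G)
    numEdges≡ G = bits G
      where
      shift : ∀ {m} (b : Bool) (v : Vec Bool m) (ks : List (Fin m)) →
        length (filter (λ k → Vec.lookup (b ∷ v) k BoolP.≟ true) (map suc ks)) ≡ length (filter (λ k → Vec.lookup v k BoolP.≟ true) ks)
      shift b v [] = refl
      shift b v (k ∷ ks) with Vec.lookup v k
      ... | true = cong suc (shift b v ks)
      ... | false = shift b v ks
      bits : ∀ {m} (v : Vec Bool m) → sumℕ (map bit (toList v)) ≡ length (filter (λ k → Vec.lookup v k BoolP.≟ true) (allFin m))
      bits [] = refl
      bits {suc m} (b ∷ v) = trans (step b) (cong (λ ks → length (filter (λ k → Vec.lookup (b ∷ v) k BoolP.≟ true) (zero ∷ ks))) (map-tabulate (λ i → i) suc))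
        where
        step : ∀ b → bit b + sumℕ (map bit (toList v)) ≡ length (filter (λ k → Vec.lookup (b ∷ v) k BoolP.≟ true) (zero ∷ map suc (allFin m)))
        step true = cong suc (trans (bits v) (sym (shift true v (allFin m))))
        step false = trans (bits v) (sym (shift false v (allFin m)))

-- Enumeration of all possible explorations and their expected number.

module Scripts where
  open Rat
  open Sums
  open Slots
  open import Data.Rational
  open import Data.Rational.Properties
  open import Data.Rational.Solver using (module +-*-Solver)
  open +-*-Solver using (solve; _:+_; _:=_; _:*_; :-_; _:-_; con)

  infixl 5 _>>=_
  _>>=_ : ∀ {a b} {A : Set a} {B : Set b} → List A → (A → List B) → List B
  xs >>= f = concatMap f xs

  ∈->>= : ∀ {a b} {A : Set a} {B : Set b} {xs : List A} {f : A → List B} {x y} → x ∈ xs → y ∈ f x → y ∈ (xs >>= f)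
  ∈->>= {f = f} x∈ y∈ = ∈-concatMap⁺ f (lose x∈ y∈)

  -- All intermediate states are kept, because a path may close after any number of steps.
  iterate : ∀ {a} {A : Set a} → (A → List A) → ℕ → A → List A
  iterate f zero s = s ∷ []
  iterate f (suc t) s = s ∷ (f s >>= iterate f t)

  iterate-self : ∀ {a} {A : Set a} {f : A → List A} t {s} → s ∈ iterate f t s
  iterate-self zero = here refl
  iterate-self (suc t) = here refl

  iterate-step : ∀ {a} {A : Set a} {f : A → List A} {t s s′ s″} → s′ ∈ f s → s″ ∈ iterate f t s′ → s″ ∈ iterate f (suc t) s
  iterate-step s′∈ s″∈ = there (∈->>= s′∈ s″∈)

  module Script {n M : ℕ} (𝒮 : Slotting n M) where
    open Slotting 𝒮

    -- visited vertices and the slots of the edges found so far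
    State : Set
    State = List (Fin n) × List (Fin M)

    new : Fin n → State → State
    new z (vs , es) = z ∷ vs , es

    join : Fin n → Fin n → State → List State
    join x y (vs , es) = map (λ k → vs , k ∷ es) (slots x y)

    ∈-join : ∀ {k x y vs es} → Joins k x y → (vs , k ∷ es) ∈ join x y (vs , es)
    ∈-join j = ∈-map⁺ _ (∈-slots⁺ j)

    attach : Fin n → Fin n → Fin n → State → List State
    attach x y z s = join x z (new z s) >>= join y z

    quad : Fin n → Fin n → Fin n → Fin n → State → List State
    quad x a b c s = join x a (new a s) >>= (λ s → join x b (new b s)) >>= join a b
      >>= (λ s → join x c (new c s)) >>= join a c >>= join b c

    close : State → List State
    close s = proj₁ s >>= λ u → proj₁ s >>= λ w → join u w s

    attachAny : State → List State
    attachAny s = proj₁ s >>= λ x → proj₁ s >>= λ y → allFin n >>= λ z → attach x y z s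

    -- The next triangle hangs on the edge `y z` just found, so a step costs only the n choices of
    -- `z` and two edges. A free choice of the base edge would cost a factor that grows with the
    -- exploration.
    triStep : (Fin n × Fin n) × State → List ((Fin n × Fin n) × State)
    triStep ((x , y) , s) = allFin n >>= λ z → map ((y , z) ,_) (attach x y z s)

    triRound : State → List State
    triRound s = proj₁ s >>= λ x → proj₁ s >>= λ y → iterate triStep n ((x , y) , s) >>= (close ∘ proj₂)

    triStart : List State
    triStart = allFin n >>= λ x → allFin n >>= λ y → join x y (y ∷ x ∷ [] , [])

    -- The three rounds close three surplus edges on top of 2|V| − 3.
    triScripts : List State
    triScripts = triStart >>= triRound >>= triRound >>= triRound

    -- The next K4 hangs on the new vertex `a`. Three new vertices and six edges make the step cost
    -- (np²)³.
    quadStep : Fin n × State → List (Fin n × State)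
    quadStep (x , s) = allFin n >>= λ a → allFin n >>= λ b → allFin n >>= λ c → map (a ,_) (quad x a b c s)

    -- A K4 that meets the visited set in two or three vertices is completed by attaching each
    -- missing vertex to two visited ones; the last edge of the K4 is then the surplus edge. With no
    -- attachment, the surplus edge lies between visited vertices.
    closers : State → List State
    closers s = s ∷ attachAny s ++ (attachAny s >>= attachAny)

    quadRound : State → List State
    quadRound s = proj₁ s >>= λ x → iterate quadStep n (x , s) >>= (closers ∘ proj₂) >>= close

    quadStart : List State
    quadStart = map (λ x → x ∷ [] , []) (allFin n)

    -- The two rounds close two surplus edges on top of 2|V| − 2.
    quadScripts : List State
    quadScripts = quadStart >>= quadRound >>= quadRound

    module Weight {p : ℚ} (0≤p : 0ℚ ≤ p) where

      -- p^|es| is the probability of distinct edges `es`; the power of `D` is a reserve that pays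
      -- for choices among visited vertices. At D = 1 the weight is the summand of the union bound.
      φ : ℕ → State → ℚ
      φ D (vs , es) = ℕtoℚ D ^ℚ length vs * p ^ℚ length es

      0≤φ : ∀ D s → 0ℚ ≤ φ D s
      0≤φ D (vs , es) = 0≤* (^-nonneg (length vs) (0≤ℕ D)) (^-nonneg (length es) 0≤p)

      -- f multiplies the weight by at most c, trading the base D for D′.
      infix 4 _⟨_,_,_⟩
      _⟨_,_,_⟩ : (State → List State) → ℕ → ℚ → ℕ → Set
      f ⟨ D , c , D′ ⟩ = ∀ s → ∑ (f s) (φ D) ≤ c * φ D′ s

      ∑->>= : ∀ {a} {A B : Set a} (xs : List A) {f : A → List B} {g : B → ℚ} {h : A → ℚ} →
        (∀ x → x ∈ xs → ∑ (f x) g ≤ h x) → ∑ (xs >>= f) g ≤ ∑ xs h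
      ∑->>= xs {f} le = ≤-trans (≤-reflexive (∑-concatMap xs f)) (∑-mono xs le)

      ∑->>=-length : ∀ {A B : Set} (xs : List A) {f : A → List B} {g : B → ℚ} c →
        (∀ x → x ∈ xs → ∑ (f x) g ≤ c) → ∑ (xs >>= f) g ≤ ℕtoℚ (length xs) * c
      ∑->>=-length xs c le = ≤-trans (∑->>= xs le) (≤-reflexive (∑-const xs c))

      ∑->>=-* : ∀ {A B : Set} (xs : List A) {f : A → List B} {g : B → ℚ} c {h : A → ℚ} →
        (∀ x → ∑ (f x) g ≤ c * h x) → ∑ (xs >>= f) g ≤ c * ∑ xs h
      ∑->>=-* xs c le = ≤-trans (∑->>= xs (λ x _ → le x)) (≤-reflexive (∑-*ˡ xs c))

      >>=-weight : ∀ {f g D D′ D″ c c′} → 0ℚ ≤ c → g ⟨ D , c , D′ ⟩ → f ⟨ D′ , c′ , D″ ⟩ →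
        (λ s → f s >>= g) ⟨ D , c * c′ , D″ ⟩
      >>=-weight {f} {g} {D} {D′} {D″} {c} {c′} 0≤c hg hf s = begin
        ∑ (f s >>= g) (φ D) ≤⟨ ∑->>=-* (f s) c hg ⟩
        c * ∑ (f s) (φ D′) ≤⟨ *-monoˡ 0≤c (hf s) ⟩
        c * (c′ * φ D″ s) ≡⟨ sym (*-assoc c c′ _) ⟩
        c * c′ * φ D″ s ∎
        where open ≤-Reasoning

      join-weight : ∀ D x y → join x y ⟨ D , p , D ⟩
      join-weight D x y (vs , es) = begin
        ∑ (map (λ k → vs , k ∷ es) (slots x y)) (φ D) ≡⟨ ∑-map (slots x y) _ ⟩
        ∑ (slots x y) (λ _ → d * (p * q)) ≡⟨ ∑-const (slots x y) _ ⟩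
        ℕtoℚ (length (slots x y)) * (d * (p * q)) ≤⟨ *-monoʳ (0≤* (^-nonneg (length vs) (0≤ℕ D)) (^-nonneg (suc (length es)) 0≤p)) (ℕtoℚ-mono (length-slots x y)) ⟩
        1ℚ * (d * (p * q)) ≡⟨ solve 3 (λ d p q → con 1ℚ :* (d :* (p :* q)) := p :* (d :* q)) refl d p q ⟩
        p * (d * q) ∎
        where
        open ≤-Reasoning
        d = ℕtoℚ D ^ℚ length vs
        q = p ^ℚ length es

      new-weight : ∀ D z s → φ D (new z s) ≡ ℕtoℚ D * φ D s
      new-weight D z (vs , es) = *-assoc (ℕtoℚ D) _ _

      joinNew-weight : ∀ D x z → (λ s → join x z (new z s)) ⟨ D , p * ℕtoℚ D , D ⟩
      joinNew-weight D x z s = ≤-trans (join-weight D x z (new z s))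
        (≤-reflexive (trans (cong (p *_) (new-weight D z s)) (sym (*-assoc p _ _))))

      attach-weight : ∀ D x y z → attach x y z ⟨ D , p * (p * ℕtoℚ D) , D ⟩
      attach-weight D x y z = >>=-weight {λ s → join x z (new z s)} {join y z} {D} {D} {D} 0≤p (join-weight D y z) (joinNew-weight D x z)

      quad-weight : ∀ D x a b c → quad x a b c ⟨ D , p * (p * (p * ℕtoℚ D * (p * (p * ℕtoℚ D * (p * ℕtoℚ D))))) , D ⟩
      quad-weight D x a b c =
        >>=-weight {q₅} {join b c} {D} {D} {D} 0≤p (join-weight D b c)
        (>>=-weight {q₄} {join a c} {D} {D} {D} 0≤p (join-weight D a c)
        (>>=-weight {q₃} {λ s → join x c (new c s)} {D} {D} {D} (0≤* 0≤p (0≤ℕ D)) (joinNew-weight D x c)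
        (>>=-weight {q₂} {join a b} {D} {D} {D} 0≤p (join-weight D a b)
        (>>=-weight {q₁} {λ s → join x b (new b s)} {D} {D} {D} (0≤* 0≤p (0≤ℕ D)) (joinNew-weight D x b)
          (joinNew-weight D x a)))))
        where
        q₁ q₂ q₃ q₄ q₅ : State → List State
        q₁ s = join x a (new a s)
        q₂ s = q₁ s >>= λ s → join x b (new b s)
        q₃ s = q₂ s >>= join a b
        q₄ s = q₃ s >>= λ s → join x c (new c s)
        q₅ s = q₄ s >>= join a c

      k≤2^k : ∀ k → k ℕ.≤ 2 ℕ.^ k
      k≤2^k zero = ℕ.z≤n
      k≤2^k (suc k) = ℕP.≤-trans (ℕP.+-mono-≤ (ℕ.>-nonZero⁻¹ (2 ℕ.^ k) {{ℕP.m^n≢0 2 k}}) (k≤2^k k)) (ℕP.+-monoʳ-≤ (2 ℕ.^ k) (ℕP.m≤m+n _ 0))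

      base-mono : ∀ {D D′} s → D ℕ.≤ D′ → φ D s ≤ φ D′ s
      base-mono {D} (vs , es) D≤ = *-monoʳ (^-nonneg (length es) 0≤p) (^-mono (length vs) (0≤ℕ D) (ℕtoℚ-mono D≤))

      -- Choosing one of k visited vertices costs k ≤ 2^k, that is, a doubling of the base.
      choose-weight : ∀ D s → ℕtoℚ (length (proj₁ s)) * φ D s ≤ φ (2 ℕ.* D) s
      choose-weight D (vs , es) = begin
        ℕtoℚ l * (d * q) ≤⟨ *-monoʳ (0≤φ D (vs , es)) (ℕtoℚ-mono (k≤2^k l)) ⟩
        ℕtoℚ (2 ℕ.^ l) * (d * q) ≡⟨ sym (*-assoc (ℕtoℚ (2 ℕ.^ l)) d q) ⟩
        ℕtoℚ (2 ℕ.^ l) * d * q ≡⟨ cong (λ e → e * d * q) (ℕtoℚ-^ 2 l) ⟩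
        ℕtoℚ 2 ^ℚ l * d * q ≡⟨ cong (_* q) (sym (^-distrib-* (ℕtoℚ 2) (ℕtoℚ D) l)) ⟩
        (ℕtoℚ 2 * ℕtoℚ D) ^ℚ l * q ≡⟨ cong (λ e → e ^ℚ l * q) (sym (ℕtoℚ-* 2 D)) ⟩
        φ (2 ℕ.* D) (vs , es) ∎
        where
        open ≤-Reasoning
        l = length vs
        d = ℕtoℚ D ^ℚ l
        q = p ^ℚ length es

      visited-weight : ∀ {f : Fin n → State → List State} {D D′ c} → 0ℚ ≤ c → (∀ x → f x ⟨ D , c , D′ ⟩) →
        (λ s → proj₁ s >>= λ x → f x s) ⟨ D , c , 2 ℕ.* D′ ⟩
      visited-weight {f} {D} {D′} {c} 0≤c h s = begin
        ∑ (proj₁ s >>= λ x → f x s) (φ D) ≤⟨ ∑->>=-length (proj₁ s) _ (λ x _ → h x s) ⟩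
        ℕtoℚ (length (proj₁ s)) * (c * φ D′ s) ≡⟨ solve 3 (λ l c q → l :* (c :* q) := c :* (l :* q)) refl (ℕtoℚ (length (proj₁ s))) c (φ D′ s) ⟩
        c * (ℕtoℚ (length (proj₁ s)) * φ D′ s) ≤⟨ *-monoˡ 0≤c (choose-weight D′ s) ⟩
        c * φ (2 ℕ.* D′) s ∎
        where open ≤-Reasoning

      close-weight : ∀ D → close ⟨ D , p , 2 ℕ.* (2 ℕ.* D) ⟩
      close-weight D = visited-weight {λ u s → proj₁ s >>= λ w → join u w s} {D} {2 ℕ.* D} {p} 0≤p
        (λ u → visited-weight {join u} {D} {D} 0≤p (join-weight D u))

      allFin-weight : ∀ {A : Set} {f : Fin n → List A} {g : A → ℚ} c →
        (∀ x → ∑ (f x) g ≤ c) → ∑ (allFin n >>= f) g ≤ ℕtoℚ n * c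
      allFin-weight {f = f} {g} c h = subst (λ l → ∑ (allFin n >>= f) g ≤ ℕtoℚ l * c) (length-tabulate {n = n} (λ i → i))
        (∑->>=-length (allFin n) c (λ x _ → h x))

      -- A geometric series: the bound does not depend on the number `t` of steps, so paths of every
      -- length are summed at the cost of a factor 2.
      iterate-weight : ∀ {A : Set} {f : A → List A} {g : A → ℚ} → (∀ s → 0ℚ ≤ g s) → (∀ s → ∑ (f s) g ≤ ½ * g s) →
        ∀ t s → ∑ (iterate f t s) g ≤ ℕtoℚ 2 * g s
      iterate-weight {g = g} 0≤g h zero s = begin
        g s + 0ℚ ≤⟨ +-monoʳ-≤ (g s) (0≤g s) ⟩
        g s + g s ≡⟨ solve 1 (λ a → a :+ a := con (ℕtoℚ 2) :* a) refl (g s) ⟩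
        ℕtoℚ 2 * g s ∎
        where open ≤-Reasoning
      iterate-weight {f = f} {g} 0≤g h (suc t) s = begin
        g s + ∑ (f s >>= iterate f t) g ≤⟨ +-monoʳ-≤ (g s) (∑->>=-* (f s) (ℕtoℚ 2) (iterate-weight 0≤g h t)) ⟩
        g s + ℕtoℚ 2 * ∑ (f s) g ≤⟨ +-monoʳ-≤ (g s) (*-monoˡ (0≤ℕ 2) (h s)) ⟩
        g s + ℕtoℚ 2 * (½ * g s) ≡⟨ solve 1 (λ a → a :+ con (ℕtoℚ 2) :* (con ½ :* a) := con (ℕtoℚ 2) :* a) refl (g s) ⟩
        ℕtoℚ 2 * g s ∎
        where open ≤-Reasoning

      -- 8192 = 64 · 128 is the largest base that a path step meets, namely in the earlier round of
      -- `quadScripts`. Even there a step must lose a factor 2 for the paths to sum geometrically.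
      module Sparse (ν≤ : ℕtoℚ n * (p * p) * ℕtoℚ 8192 ≤ ½) where

        ν = ℕtoℚ n * (p * p)

        0≤ν : 0ℚ ≤ ν
        0≤ν = 0≤* (0≤ℕ n) (0≤* 0≤p 0≤p)

        ν-bound : ∀ {D} → D ℕ.≤ 8192 → ν * ℕtoℚ D ≤ ½
        ν-bound D≤ = ≤-trans (*-monoˡ 0≤ν (ℕtoℚ-mono D≤)) ν≤

        ν-bound₁ : ∀ D → D ℕ.≤ 8192 → ν * ℕtoℚ D ≤ 1ℚ
        ν-bound₁ D D≤ = ≤-trans (ν-bound D≤) (≤ᵇ⇒≤ _)

        triStep-weight : ∀ {D} → D ℕ.≤ 8192 → ∀ s → ∑ (triStep s) (φ D ∘ proj₂) ≤ ½ * φ D (proj₂ s)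
        triStep-weight {D} D≤ ((x , y) , s) = begin
          ∑ (triStep ((x , y) , s)) (φ D ∘ proj₂)
            ≤⟨ allFin-weight _ (λ z → ≤-trans (≤-reflexive (∑-map (attach x y z s) ((y , z) ,_))) (attach-weight D x y z s)) ⟩
          ℕtoℚ n * (p * (p * ℕtoℚ D) * φ D s)
            ≡⟨ solve 4 (λ n p d q → n :* (p :* (p :* d) :* q) := n :* (p :* p) :* d :* q) refl (ℕtoℚ n) p (ℕtoℚ D) (φ D s) ⟩
          ν * ℕtoℚ D * φ D s ≤⟨ *-monoʳ (0≤φ D s) (ν-bound D≤) ⟩
          ½ * φ D s ∎
          where open ≤-Reasoning

        -- Four visited vertices are chosen, two for the starting edge and two for the surplus edge,
        -- so the base is doubled four times. The factor 2 is the sum over path lengths, and `p` is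
        -- the surplus edge.
        triRound-weight : ∀ D → 4 ℕ.* D ℕ.≤ 8192 → triRound ⟨ D , p * ℕtoℚ 2 , 2 ℕ.* (2 ℕ.* (2 ℕ.* (2 ℕ.* D))) ⟩
        triRound-weight D 4D≤ =
          visited-weight {λ x s → proj₁ s >>= λ y → chain x y s} {D} {2 ℕ.* D′} 0≤2p λ x →
          visited-weight {chain x} {D} {D′} 0≤2p λ y s → begin
            ∑ (chain x y s) (φ D) ≤⟨ ∑->>=-* (iterate triStep n ((x , y) , s)) p (λ c → close-weight D (proj₂ c)) ⟩
            p * ∑ (iterate triStep n ((x , y) , s)) (φ D′ ∘ proj₂)
              ≤⟨ *-monoˡ 0≤p (iterate-weight (0≤φ D′ ∘ proj₂) (triStep-weight D′≤) n ((x , y) , s)) ⟩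
            p * (ℕtoℚ 2 * φ D′ s) ≡⟨ sym (*-assoc p _ _) ⟩
            p * ℕtoℚ 2 * φ D′ s ∎
          where
          open ≤-Reasoning
          D′ = 2 ℕ.* (2 ℕ.* D)
          D′≤ : D′ ℕ.≤ 8192
          D′≤ = subst (ℕ._≤ 8192) (ℕP.*-assoc 2 2 D) 4D≤
          0≤2p : 0ℚ ≤ p * ℕtoℚ 2
          0≤2p = 0≤* 0≤p (0≤ℕ 2)
          chain : Fin n → Fin n → State → List State
          chain x y s = iterate triStep n ((x , y) , s) >>= (close ∘ proj₂)

        -- The first edge contributes n² p and the three surplus edges p each, together n² p⁴ = ν².
        -- The base grows by 16 in each round, up to 4096 for the two starting vertices, so the
        -- constant is 2³ · 4096².
        triScripts-weight : ∑ triScripts (φ 1) ≤ ν * ν * ℕtoℚ 134217728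
        triScripts-weight = begin
          ∑ triScripts (φ 1) ≤⟨ ∑->>=-* (triStart >>= triRound >>= triRound) (p * two) (triRound-weight 1 (ℕP.≤ᵇ⇒≤ 4 8192 _)) ⟩
          p * two * ∑ (triStart >>= triRound >>= triRound) (φ 16)
            ≤⟨ *-monoˡ 0≤2p (∑->>=-* (triStart >>= triRound) (p * two) (triRound-weight 16 (ℕP.≤ᵇ⇒≤ 64 8192 _))) ⟩
          p * two * (p * two * ∑ (triStart >>= triRound) (φ 256))
            ≤⟨ *-monoˡ 0≤2p (*-monoˡ 0≤2p (∑->>=-* triStart (p * two) (triRound-weight 256 (ℕP.≤ᵇ⇒≤ 1024 8192 _)))) ⟩
          p * two * (p * two * (p * two * ∑ triStart (φ 4096)))
            ≤⟨ *-monoˡ 0≤2p (*-monoˡ 0≤2p (*-monoˡ 0≤2p (allFin-weight _ (λ x → allFin-weight _ (λ y → join-weight 4096 x y _))))) ⟩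
          p * two * (p * two * (p * two * (ℕtoℚ n * (ℕtoℚ n * (p * (ℕtoℚ 4096 * (ℕtoℚ 4096 * 1ℚ) * 1ℚ))))))
            ≡⟨ solve 2 (λ p n → p :* con two :* (p :* con two :* (p :* con two :* (n :* (n :* (p :* (con (ℕtoℚ 4096) :* (con (ℕtoℚ 4096) :* con 1ℚ) :* con 1ℚ))))))
                 := n :* (p :* p) :* (n :* (p :* p)) :* con (ℕtoℚ 134217728)) refl p (ℕtoℚ n) ⟩
          ν * ν * ℕtoℚ 134217728 ∎
          where
          open ≤-Reasoning
          two = ℕtoℚ 2
          0≤2p : 0ℚ ≤ p * two
          0≤2p = 0≤* 0≤p (0≤ℕ 2)

        quadStep-weight : ∀ {D} → D ℕ.≤ 8192 → ∀ s → ∑ (quadStep s) (φ D ∘ proj₂) ≤ ½ * φ D (proj₂ s)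
        quadStep-weight {D} D≤ (x , s) = begin
          ∑ (quadStep (x , s)) (φ D ∘ proj₂)
            ≤⟨ allFin-weight _ (λ a → allFin-weight _ (λ b → allFin-weight _ (λ c →
                 ≤-trans (≤-reflexive (∑-map (quad x a b c s) (a ,_))) (quad-weight D x a b c s)))) ⟩
          m * (m * (m * (p * (p * (p * d * (p * (p * d * (p * d))))) * φ D s)))
            ≡⟨ solve 4 (λ n p d q → n :* (n :* (n :* (p :* (p :* (p :* d :* (p :* (p :* d :* (p :* d))))) :* q)))
                 := (n :* (p :* p) :* d) :* (n :* (p :* p) :* d) :* (n :* (p :* p) :* d) :* q) refl m p d (φ D s) ⟩
          (ν * d) * (ν * d) * (ν * d) * φ D s ≤⟨ *-monoʳ (0≤φ D s) cube≤½ ⟩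
          ½ * φ D s ∎
          where
          open ≤-Reasoning
          m = ℕtoℚ n
          d = ℕtoℚ D
          0≤νd : 0ℚ ≤ ν * d
          0≤νd = 0≤* 0≤ν (0≤ℕ D)
          νd≤1 : ν * d ≤ 1ℚ
          νd≤1 = ν-bound₁ D D≤
          cube≤½ : (ν * d) * (ν * d) * (ν * d) ≤ ½
          cube≤½ = begin
            (ν * d) * (ν * d) * (ν * d) ≤⟨ *-mono (0≤* 0≤1 0≤1) 0≤νd (*-mono 0≤1 0≤νd νd≤1 νd≤1) (ν-bound D≤) ⟩
            1ℚ * 1ℚ * ½ ≡⟨ refl ⟩
            ½ ∎

        attachAny-weight : ∀ D → D ℕ.≤ 8192 → attachAny ⟨ D , 1ℚ , 2 ℕ.* (2 ℕ.* D) ⟩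
        attachAny-weight D D≤ =
          visited-weight {λ x s → proj₁ s >>= λ y → allFin n >>= λ z → attach x y z s} {D} {2 ℕ.* D} {1ℚ} 0≤1 λ x →
          visited-weight {λ y s → allFin n >>= λ z → attach x y z s} {D} {D} {1ℚ} 0≤1 λ y s → begin
            ∑ (allFin n >>= λ z → attach x y z s) (φ D) ≤⟨ allFin-weight _ (λ z → attach-weight D x y z s) ⟩
            ℕtoℚ n * (p * (p * ℕtoℚ D) * φ D s)
              ≡⟨ solve 4 (λ n p d q → n :* (p :* (p :* d) :* q) := n :* (p :* p) :* d :* q) refl (ℕtoℚ n) p (ℕtoℚ D) (φ D s) ⟩
            ν * ℕtoℚ D * φ D s ≤⟨ *-monoʳ (0≤φ D s) (ν-bound₁ D D≤) ⟩
            1ℚ * φ D s ∎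
          where open ≤-Reasoning

        closers-weight : ∀ D → 4 ℕ.* D ℕ.≤ 8192 → closers ⟨ D , ℕtoℚ 3 , 2 ℕ.* (2 ℕ.* (2 ℕ.* (2 ℕ.* D))) ⟩
        closers-weight D 4D≤ s = begin
          φ D s + ∑ (attachAny s ++ (attachAny s >>= attachAny)) (φ D) ≡⟨ cong (φ D s +_) (∑-++ (attachAny s) _) ⟩
          φ D s + (∑ (attachAny s) (φ D) + ∑ (attachAny s >>= attachAny) (φ D))
            ≤⟨ +-mono-≤ (base-mono s D≤16D) (+-mono-≤ (once D D≤8192 (4D≤16D)) twice) ⟩
          φ D″ s + (φ D″ s + φ D″ s) ≡⟨ solve 1 (λ a → a :+ (a :+ a) := con (ℕtoℚ 3) :* a) refl (φ D″ s) ⟩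
          ℕtoℚ 3 * φ D″ s ∎
          where
          open ≤-Reasoning
          D′ = 2 ℕ.* (2 ℕ.* D)
          D″ = 2 ℕ.* (2 ℕ.* D′)
          x≤2x : ∀ x → x ℕ.≤ 2 ℕ.* x
          x≤2x x = ℕP.m≤m+n x _
          4D≤16D : D′ ℕ.≤ D″
          4D≤16D = ℕP.≤-trans (x≤2x D′) (x≤2x (2 ℕ.* D′))
          D≤4D : D ℕ.≤ D′
          D≤4D = ℕP.≤-trans (x≤2x D) (x≤2x (2 ℕ.* D))
          D≤16D : D ℕ.≤ D″
          D≤16D = ℕP.≤-trans D≤4D 4D≤16D
          D′≤8192 : D′ ℕ.≤ 8192
          D′≤8192 = subst (ℕ._≤ 8192) (ℕP.*-assoc 2 2 D) 4D≤
          D≤8192 : D ℕ.≤ 8192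
          D≤8192 = ℕP.≤-trans D≤4D D′≤8192
          once : ∀ F → F ℕ.≤ 8192 → 2 ℕ.* (2 ℕ.* F) ℕ.≤ D″ → ∑ (attachAny s) (φ F) ≤ φ D″ s
          once F F≤ 4F≤ = ≤-trans (attachAny-weight F F≤ s) (≤-trans (≤-reflexive (*-identityˡ _)) (base-mono s 4F≤))
          twice : ∑ (attachAny s >>= attachAny) (φ D) ≤ φ D″ s
          twice = ≤-trans (∑->>=-* (attachAny s) 1ℚ (attachAny-weight D D≤8192))
            (≤-trans (≤-reflexive (*-identityˡ _)) (once D′ D′≤8192 ℕP.≤-refl))

        -- The base grows by 128 = 2 · 16 · 4: one choice of the start, up to four for the
        -- attachments, two for the surplus edge. The factor 6 is 3 kinds of closers times 2 for the
        -- path lengths.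
        quadRound-weight : ∀ D → 64 ℕ.* D ℕ.≤ 8192 → quadRound ⟨ D , p * ℕtoℚ 6 , 2 ℕ.* (64 ℕ.* D) ⟩
        quadRound-weight D 64D≤ = visited-weight {chain} {D} {64 ℕ.* D} (0≤* 0≤p (0≤ℕ 6)) λ x s → begin
          ∑ (chain x s) (φ D) ≤⟨ ∑->>=-* (its x s >>= (closers ∘ proj₂)) p (close-weight D) ⟩
          p * ∑ (its x s >>= (closers ∘ proj₂)) (φ D′)
            ≤⟨ *-monoˡ 0≤p (∑->>=-* (its x s) (ℕtoℚ 3) (λ c → closers-weight D′ 4D′≤ (proj₂ c))) ⟩
          p * (ℕtoℚ 3 * ∑ (its x s) (φ (2 ℕ.* (2 ℕ.* (2 ℕ.* (2 ℕ.* D′)))) ∘ proj₂))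
            ≡⟨ cong (λ F → p * (ℕtoℚ 3 * ∑ (its x s) (φ F ∘ proj₂))) 16D′≡ ⟩
          p * (ℕtoℚ 3 * ∑ (its x s) (φ (64 ℕ.* D) ∘ proj₂))
            ≤⟨ *-monoˡ 0≤p (*-monoˡ (0≤ℕ 3) (iterate-weight (0≤φ (64 ℕ.* D) ∘ proj₂) (quadStep-weight 64D≤) n (x , s))) ⟩
          p * (ℕtoℚ 3 * (ℕtoℚ 2 * φ (64 ℕ.* D) s))
            ≡⟨ solve 2 (λ p q → p :* (con (ℕtoℚ 3) :* (con (ℕtoℚ 2) :* q)) := p :* con (ℕtoℚ 6) :* q) refl p (φ (64 ℕ.* D) s) ⟩
          p * ℕtoℚ 6 * φ (64 ℕ.* D) s ∎
          where
          open ≤-Reasoning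
          D′ = 2 ℕ.* (2 ℕ.* D)
          its : Fin n → State → List (Fin n × State)
          its x s = iterate quadStep n (x , s)
          chain : Fin n → State → List State
          chain x s = its x s >>= (closers ∘ proj₂) >>= close
          16D′≡ : 2 ℕ.* (2 ℕ.* (2 ℕ.* (2 ℕ.* D′))) ≡ 64 ℕ.* D
          16D′≡ = NatSolver.solve 1 (λ d → twice (twice (twice (twice (twice (twice d))))) NatSolver.:= NatSolver.con 64 NatSolver.:* d) refl D
            where
            open import Data.Nat.Solver using () renaming (module +-*-Solver to NatSolver)
            twice : ∀ {k} → NatSolver.Polynomial k → NatSolver.Polynomial k
            twice d = NatSolver.con 2 NatSolver.:* d
          4D′≤ : 4 ℕ.* D′ ℕ.≤ 8192
          4D′≤ = ℕP.≤-trans (ℕP.≤-trans (ℕP.≤-reflexive (ℕP.*-assoc 2 2 D′))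
            (ℕP.≤-trans (ℕP.m≤m+n _ _) (ℕP.≤-trans (ℕP.m≤m+n _ _) (ℕP.≤-reflexive 16D′≡)))) 64D≤

        -- One starting vertex and two surplus edges give n p² = ν. The base grows from 1 to 128 to
        -- 16384, so the constant is 6² · 16384.
        quadScripts-weight : ∑ quadScripts (φ 1) ≤ ν * ℕtoℚ 589824
        quadScripts-weight = begin
          ∑ quadScripts (φ 1) ≤⟨ ∑->>=-* (quadStart >>= quadRound) (p * ℕtoℚ 6) (quadRound-weight 1 (ℕP.≤ᵇ⇒≤ 64 8192 _)) ⟩
          p * ℕtoℚ 6 * ∑ (quadStart >>= quadRound) (φ 128)
            ≤⟨ *-monoˡ (0≤* 0≤p (0≤ℕ 6)) (∑->>=-* quadStart (p * ℕtoℚ 6) (quadRound-weight 128 (ℕP.≤ᵇ⇒≤ 8192 8192 _))) ⟩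
          p * ℕtoℚ 6 * (p * ℕtoℚ 6 * ∑ quadStart (φ 16384))
            ≡⟨ cong (λ t → p * ℕtoℚ 6 * (p * ℕtoℚ 6 * t)) (trans (∑-map (allFin n) _) (trans (∑-const (allFin n) _)
                 (cong (λ l → ℕtoℚ l * (ℕtoℚ 16384 * 1ℚ * 1ℚ)) (length-tabulate {n = n} (λ i → i))))) ⟩
          p * ℕtoℚ 6 * (p * ℕtoℚ 6 * (ℕtoℚ n * (ℕtoℚ 16384 * 1ℚ * 1ℚ)))
            ≡⟨ solve 2 (λ p n → p :* con (ℕtoℚ 6) :* (p :* con (ℕtoℚ 6) :* (n :* (con (ℕtoℚ 16384) :* con 1ℚ :* con 1ℚ)))
                 := n :* (p :* p) :* con (ℕtoℚ 589824)) refl p (ℕtoℚ n) ⟩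
          ν * ℕtoℚ 589824 ∎
          where open ≤-Reasoning

-- Explorations of an actual graph with edge list L.

module Explore where
  open import Defs using (sumℕ)
  open Slots
  open Scripts
  open import Data.Nat as ℕ using (ℕ; suc; _+_; _*_; _≤_; z≤n; s≤s)

  private
    variable
      n : ℕ

  open import Data.Nat.Solver using (module +-*-Solver)

  infix 4 _∈?_
  _∈?_ : ∀ {m} (x : Fin m) (xs : List (Fin m)) → Dec (x ∈ xs)
  _∈?_ = DecMem._∈?_ FinP._≟_

  Σℕ : ∀ {a} {A : Set a} → List A → (A → ℕ) → ℕ
  Σℕ xs f = sumℕ (map f xs)

  Σℕ-≥ : ∀ {a} {A : Set a} (xs : List A) {f : A → ℕ} c → (∀ x → x ∈ xs → c ≤ f x) → length xs * c ≤ Σℕ xs f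
  Σℕ-≥ [] c h = z≤n
  Σℕ-≥ (x ∷ xs) c h = ℕP.+-mono-≤ (h x (here refl)) (Σℕ-≥ xs c (λ y y∈ → h y (there y∈)))

  -- Padding by repetition to three names avoids separate cases for degrees one and two; `x₀`
  -- excludes the empty list.
  short : ∀ {a} {A : Set a} {xs : List A} {x₀} → x₀ ∈ xs → length xs ≤ 3 →
    ∃[ a ] ∃[ b ] ∃[ c ] (∀ {x} → x ∈ xs → x ≡ a ⊎ x ≡ b ⊎ x ≡ c)
  short {xs = a ∷ []} _ _ = a , a , a , λ { (here e) → inj₁ e }
  short {xs = a ∷ b ∷ []} _ _ = a , b , b , λ { (here e) → inj₁ e ; (there (here e)) → inj₂ (inj₁ e) }
  short {xs = a ∷ b ∷ c ∷ []} _ _ =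
    a , b , c , λ { (here e) → inj₁ e ; (there (here e)) → inj₂ (inj₁ e) ; (there (there (here e))) → inj₂ (inj₂ e) }
  short {xs = _ ∷ _ ∷ _ ∷ _ ∷ _} _ (s≤s (s≤s (s≤s ())))

  unique-≤n : ∀ {vs : List (Fin n)} → Unique vs → length vs ≤ n
  unique-≤n {n} {vs} u = subst (length vs ≤_) (length-tabulate {n = n} (λ i → i)) (unique-length u (λ {x} _ → ∈-allFin x))

  module Exploring {n M : ℕ} (𝒮 : Slotting n M) where
    open Slotting 𝒮 public
    open Script 𝒮 public

    end₁ end₂ : Fin M → Fin n
    end₁ k = proj₁ (joined k)
    end₂ k = proj₁ (proj₂ (joined k))

    joins : ∀ k → Joins k (end₁ k) (end₂ k)
    joins k = proj₂ (proj₂ (joined k))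

    At : Fin M → Fin n → Set
    At k x = Σ (Fin n) λ y → Joins k x y

    At? : ∀ (k : Fin M) x → Dec (At k x)
    At? k x = FinP.any? (λ y → Joins? k x y)

    incident : Fin n → List (Fin M) → List (Fin M)
    incident x = filter (λ k → At? k x)

    handshake : ∀ (vs : List (Fin n)) → Unique vs → ∀ es → Σℕ vs (λ x → length (incident x es)) ≤ length es * 2
    handshake vs u [] = ℕP.≤-reflexive (zeros vs)
      where
      zeros : ∀ {a} {A : Set a} (xs : List A) → Σℕ xs (λ _ → 0) ≡ 0
      zeros [] = refl
      zeros (_ ∷ xs) = zeros xs
    handshake vs u (k ∷ es) = ℕP.≤-trans (ℕP.≤-reflexive (split vs)) (ℕP.+-mono-≤ two (handshake vs u es))
      where
      swap+ : ∀ a b c → a + (b + c) ≡ b + (a + c)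
      swap+ = solve 3 (λ a b c → a :+ (b :+ c) := b :+ (a :+ c)) refl
        where open +-*-Solver
      split : ∀ xs → Σℕ xs (λ x → length (incident x (k ∷ es))) ≡ length (filter (At? k) xs) + Σℕ xs (λ x → length (incident x es))
      split [] = refl
      split (x ∷ xs) with At? k x
      ... | no _ = trans (cong (length (incident x es) +_) (split xs))
              (swap+ (length (incident x es)) (length (filter (At? k) xs)) (Σℕ xs (λ y → length (incident y es))))
      ... | yes _ = cong suc (trans (cong (length (incident x es) +_) (split xs))
              (swap+ (length (incident x es)) (length (filter (At? k) xs)) (Σℕ xs (λ y → length (incident y es)))))
      two : length (filter (At? k) vs) ≤ 2
      two with joined k
      ... | e₁ , e₂ , j = unique-length {ys = e₁ ∷ e₂ ∷ []} (Uniq.filter⁺ (At? k) u)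
          (λ {x} x∈ → at (proj₂ (∈-filter⁻ {P = At k} (At? k) {xs = vs} x∈)))
        where
        at : ∀ {x} → At k x → x ∈ e₁ ∷ e₂ ∷ []
        at (y , j′) with Joins-ends j j′
        ... | inj₁ (e , _) = here e
        ... | inj₂ (e , _) = there (here e)

    module Within (L : List (Fin M)) where

      Link : Fin n → Fin n → Set
      Link x y = ∃[ k ] (k ∈ L × Joins k x y)

      Link? : ∀ x y → Dec (Link x y)
      Link? x y = map′ (λ a → find a) (λ (k , k∈ , j) → lose k∈ j) (Any.any? (λ k → Joins? k x y) L)

      Link-sym : ∀ {x y} → Link x y → Link y x
      Link-sym (k , k∈ , j) = k , k∈ , Joins-sym j

      Link-≢ : ∀ {x y} → Link x y → x ≢ y
      Link-≢ (_ , _ , j) = Joins-≢ j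

      record Wf (s : State) : Set where
        constructor wf
        field
          unique-vs : Unique (proj₁ s)
          unique-es : Unique (proj₂ s)
          alive : ∀ {k} → k ∈ proj₂ s → k ∈ L
          inside : ∀ {k} {x y : Fin n} → k ∈ proj₂ s → Joins k x y → x ∈ proj₁ s
      open Wf public

      Induced : State → Set
      Induced (vs , es) = ∀ {k} {x y : Fin n} → k ∈ L → Joins k x y → x ∈ vs → y ∈ vs → k ∈ es

      Extra : State → Set
      Extra (vs , es) = ∃[ k ] Σ (Fin n) λ x → Σ (Fin n) λ y → (k ∈ L × Joins k x y × x ∈ vs × y ∈ vs × k ∉ es)

      extra? : ∀ s → Extra s ⊎ Induced s
      extra? (vs , es) with Any.any? (λ k → (end₁ k ∈? vs) ×-dec ((end₂ k ∈? vs) ×-dec ¬? (k ∈? es))) L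
      ... | yes a = inj₁ (let k , k∈ , x∈ , y∈ , k∉ = find a in k , end₁ k , end₂ k , k∈ , joins k , x∈ , y∈ , k∉)
      ... | no ¬a = inj₂ ind
        where
        ind : Induced (vs , es)
        ind {k} k∈ j x∈ y∈ with k ∈? es
        ... | yes k∈es = k∈es
        ind {k} k∈ j x∈ y∈ | no k∉ with Joins-ends j (joins k)
        ... | inj₁ (e , f) = ⊥-elim (¬a (lose k∈ (subst (_∈ vs) (sym e) x∈ , subst (_∈ vs) (sym f) y∈ , k∉)))
        ... | inj₂ (e , f) = ⊥-elim (¬a (lose k∈ (subst (_∈ vs) (sym e) y∈ , subst (_∈ vs) (sym f) x∈ , k∉)))

      ∉-cons : ∀ {a} {A : Set a} {x y : A} {xs} → x ≢ y → x ∉ xs → x ∉ (y ∷ xs)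
      ∉-cons x≢ x∉ (here e) = x≢ e
      ∉-cons x≢ x∉ (there h) = x∉ h

      unique-∷ : ∀ {a} {A : Set a} {x : A} {xs} → x ∉ xs → Unique xs → Unique (x ∷ xs)
      unique-∷ {xs = xs} x∉ u = AllP.¬Any⇒All¬ xs x∉ ∷ u

      wf-new : ∀ {z s} → z ∉ proj₁ s → Wf s → Wf (new z s)
      wf-new z∉ w = wf (unique-∷ z∉ (unique-vs w)) (unique-es w) (alive w) (λ k∈ j → there (inside w k∈ j))

      wf-join : ∀ {k} {x y : Fin n} {vs es} → k ∈ L → Joins k x y → x ∈ vs → y ∈ vs → k ∉ es → Wf (vs , es) → Wf (vs , k ∷ es)
      wf-join {k} {x} {y} {vs} {es} k∈ j x∈ y∈ k∉ w = wf (unique-vs w) (unique-∷ k∉ (unique-es w))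
        (λ { (here refl) → k∈ ; (there h) → alive w h }) ins
        where
        ins : ∀ {l} {u v : Fin n} → l ∈ k ∷ es → Joins l u v → u ∈ vs
        ins (here refl) j′ with Joins-ends j j′
        ... | inj₁ (refl , refl) = x∈
        ... | inj₂ (refl , refl) = y∈
        ins (there h) j′ = inside w h j′

      fresh : ∀ {k} {z y : Fin n} {s} → Wf s → z ∉ proj₁ s → Joins k z y → k ∉ proj₂ s
      fresh w z∉ j k∈ = z∉ (inside w k∈ j)

      Joins-≢ʳ : ∀ {k l : Fin M} {z x y : Fin n} → Joins k z x → Joins l z y → x ≢ y → k ≢ l
      Joins-≢ʳ j j′ x≢y refl with Joins-ends j j′
      ... | inj₁ (_ , e) = x≢y (sym e)
      ... | inj₂ (refl , refl) = x≢y refl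

      -- Otherwise all degrees within `es` are at least 4, and the degree sum is at least 4|V|,
      -- although it is at most 2|E| < 4|V|.
      low-degree : ∀ {vs es} → Wf (vs , es) → length es + 1 ≤ 2 * length vs → ∃[ x ] (x ∈ vs × length (incident x es) ≤ 3)
      low-degree {vs} {es} w e≤ with Any.any? (λ x → length (incident x es) ℕP.≤? 3) vs
      ... | yes a = find a
      ... | no ¬a = ⊥-elim (ℕP.<-irrefl refl (ℕP.≤-<-trans le (ℕP.≤-trans lt ge)))
        where
        open +-*-Solver
        ge : length vs * 4 ≤ Σℕ vs (λ x → length (incident x es))
        ge = Σℕ-≥ vs 4 (λ x x∈ → ℕP.≰⇒> (λ h → ¬a (lose x∈ h)))
        le : Σℕ vs (λ x → length (incident x es)) ≤ length es * 2
        le = handshake vs (unique-vs w) es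
        lt : suc (length es * 2) ≤ length vs * 4
        lt = ℕP.≤-trans (ℕP.m≤n+m _ 1) (ℕP.≤-trans
          (ℕP.≤-reflexive (solve 1 (λ e → con 2 :+ e :* con 2 := con 2 :* (e :+ con 1)) refl (length es)))
          (ℕP.≤-trans (ℕP.*-monoʳ-≤ 2 e≤) (ℕP.≤-reflexive (solve 1 (λ v → con 2 :* (con 2 :* v) := v :* con 4) refl (length vs)))))

      close-∈ : ∀ {k} {x y : Fin n} {vs es} → Joins k x y → x ∈ vs → y ∈ vs → (vs , k ∷ es) ∈ close (vs , es)
      close-∈ {x = x} {vs = vs} {es} j x∈ y∈ =
        ∈->>= {xs = vs} {f = λ u → vs >>= λ w → join u w (vs , es)} x∈ (∈->>= {xs = vs} {f = λ w → join x w (vs , es)} y∈ (∈-join j))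

      attach-∈ : ∀ {k l} {x y z : Fin n} {vs es} → Joins k x z → Joins l y z → (z ∷ vs , l ∷ k ∷ es) ∈ attach x y z (vs , es)
      attach-∈ {y = y} {z} j j′ = ∈->>= {f = join y z} (∈-join j) (∈-join j′)

      wf-attach : ∀ {k l} {x y z : Fin n} {vs es} → Wf (vs , es) → z ∉ vs → x ≢ y → x ∈ vs → y ∈ vs → k ∈ L → l ∈ L →
        Joins k x z → Joins l y z → Wf (z ∷ vs , l ∷ k ∷ es)
      wf-attach w z∉ x≢y x∈ y∈ k∈ l∈ j j′ =
        wf-join l∈ j′ (there y∈) (here refl) (∉-cons (Joins-≢ʳ (Joins-sym j′) (Joins-sym j) (≢-sym x≢y)) (fresh w z∉ (Joins-sym j′)))
          (wf-join k∈ j (there x∈) (here refl) (fresh w z∉ (Joins-sym j)) (wf-new z∉ w))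

-- Colouring the sparse random graph without monochromatic triangles.

module TriColour where
  open Slots
  open Scripts
  open Explore
  open import Data.Nat as ℕ using (ℕ; zero; suc; _+_; _*_; _≤_; _<_; z≤n; s≤s)
  open import Data.Nat.Solver using (module +-*-Solver)

  module Triangles {n M : ℕ} (𝒮 : Slotting n M) where
    open Exploring 𝒮

    module Exploration (L : List (Fin M)) where
      open Within L public

      -- Every edge lies in at least two triangles, in the form that `chain` uses: the triangle from
      -- which the edge was reached can be avoided.
      Rich : Set
      Rich = ∀ x y w → Link x y → ∃[ z ] (Link x z × Link y z × z ≢ w)

      -- c counts the edges in excess of the 2|V| − 3 edges of a triangle-by-triangle construction
      record Explored (c : ℕ) (s : State) : Set where
        constructor explored
        field
          well : Wf s
          count : length (proj₂ s) + 3 ≡ 2 * length (proj₁ s) + c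
          -- Without isolated vertices, the vertex of low degree found at the end has an edge, so
          -- that deleting its edges shortens the list in `colour`.
          touched : ∀ {x} → x ∈ proj₁ s → ∃[ k ] (k ∈ proj₂ s × At k x)
          root : ∃[ x ] (x ∈ proj₁ s)
      open Explored public

      Closed : State → Set
      Closed (vs , es) = ∀ {x y z} → x ∈ vs → y ∈ vs → Link x y → Link x z → Link y z → z ∈ vs

      explored-close : ∀ {c s} → Explored c s → Extra s → ∃[ s′ ] (s′ ∈ close s × Explored (suc c) s′)
      explored-close {c} {vs , es} e (k , x , y , k∈ , j , x∈ , y∈ , k∉) =
        (vs , k ∷ es) , close-∈ j x∈ y∈ ,
        explored (wf-join k∈ j x∈ y∈ k∉ (well e)) (trans (cong suc (count e)) (sym (ℕP.+-suc (2 * length vs) c)))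
          (λ u∈ → let l , l∈ , at = touched e u∈ in l , there l∈ , at) (root e)

      explored-attach : ∀ {c k l} {x y z : Fin n} {vs es} → Explored c (vs , es) → z ∉ vs → x ∈ vs → y ∈ vs → x ≢ y →
        k ∈ L → l ∈ L → Joins k x z → Joins l y z → Explored c (z ∷ vs , l ∷ k ∷ es)
      explored-attach {c} {k} {l} {x} {y} {z} {vs} {es} e z∉ x∈ y∈ x≢y k∈ l∈ j j′ =
        explored (wf-attach (well e) z∉ x≢y x∈ y∈ k∈ l∈ j j′)
          (trans (cong (λ t → suc (suc t)) (count e)) (solve 2 (λ v c → con 2 :+ (con 2 :* v :+ c) := con 2 :* (con 1 :+ v) :+ c) refl (length vs) c))
          (λ { (here refl) → l , here refl , _ , Joins-sym j′
             ; (there u∈) → let m , m∈ , at = touched e u∈ in m , there (there m∈) , at })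
          (z , here refl)
        where open +-*-Solver

      NextTriangle : Fin n → Fin n → State → Set
      NextTriangle x y (vs , es) = ∃[ z ] (z ∉ vs × Link x z × Link y z)

      -- Every step visits a new vertex, so the fuel `t` cannot run out, and the strip of triangles
      -- must at some point contain an edge of `L` between visited vertices that it has not
      -- recorded. That edge is the surplus.
      chain : Rich → ∀ {c} t {x y vs es} → n < t + length vs → Explored c (vs , es) →
        x ∈ vs → y ∈ vs → x ≢ y → (Induced (vs , es) → NextTriangle x y (vs , es)) →
        ∃[ conf ] (conf ∈ iterate triStep t ((x , y) , vs , es) × ∃[ s′ ] (s′ ∈ close (proj₂ conf) × Explored (suc c) s′))
      chain rich {c} zero n< e = λ _ _ _ _ → ⊥-elim (ℕP.<⇒≱ n< (unique-≤n (unique-vs (well e))))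
      chain rich {c} (suc t) {x} {y} {vs} {es} n< e x∈ y∈ x≢y next with extra? (vs , es)
      ... | inj₁ ex = ((x , y) , vs , es) , here refl , explored-close e ex
      ... | inj₂ ind with next ind
      ...   | z , z∉ , (k , k∈ , j) , (l , l∈ , j′) =
        let conf , conf∈ , fin = chain rich t {y} {z} n<′ e′ (there y∈) (here refl) (λ { refl → z∉ y∈ }) next′
        in conf , iterate-step step∈ conf∈ , fin
        where
        vs′ = z ∷ vs
        es′ = l ∷ k ∷ es
        e′ = explored-attach e z∉ x∈ y∈ x≢y k∈ l∈ j j′
        n<′ : n < t + length vs′
        n<′ = subst (n <_) (sym (ℕP.+-suc t (length vs))) n<
        step∈ : ((y , z) , vs′ , es′) ∈ triStep ((x , y) , vs , es)
        step∈ = ∈->>= {f = λ z → map ((y , z) ,_) (attach x y z (vs , es))} (∈-allFin z) (∈-map⁺ ((y , z) ,_) (attach-∈ j j′))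
        -- The recorded edges at `z` lead only to `x` and `y`. A common neighbour of `y` and `z`
        -- other than `x` is therefore unvisited, as an induced state records all edges between
        -- visited vertices.
        next′ : Induced (vs′ , es′) → NextTriangle y z (vs′ , es′)
        next′ ind′ with rich y z x (l , l∈ , j′)
        ... | w , yw , (m , m∈ , jm) , w≢x = w , w∉ , yw , (m , m∈ , jm)
          where
          w∉ : w ∉ vs′
          w∉ (here refl) = Joins-≢ jm refl
          w∉ (there w∈) with ind′ m∈ jm (here refl) (there w∈)
          ... | here refl = Link-≢ yw (Joins-otherʳ j′ jm)
            where
            Joins-otherʳ : ∀ {m} {y z w : Fin n} → Joins m y z → Joins m z w → y ≡ w
            Joins-otherʳ a b with Joins-ends a b
            ... | inj₁ (refl , refl) = ⊥-elim (Joins-≢ a refl)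
            ... | inj₂ (_ , e) = sym e
          ... | there (here refl) with Joins-ends j jm
          ...   | inj₁ (refl , refl) = Joins-≢ jm refl
          ...   | inj₂ (_ , w≡x) = w≢x w≡x
          w∉ (there w∈) | there (there m∈es) = z∉ (inside (well e) m∈es jm)

      open-triangle? : ∀ vs → (∃[ x ] ∃[ y ] ∃[ z ] (x ∈ vs × y ∈ vs × Link x y × Link x z × Link y z × z ∉ vs)) ⊎
        (∀ {x y z} → x ∈ vs → y ∈ vs → Link x y → Link x z → Link y z → z ∈ vs)
      open-triangle? vs with FinP.any? (λ x → FinP.any? (λ y → FinP.any? (λ z →
        (x ∈? vs) ×-dec (y ∈? vs) ×-dec Link? x y ×-dec Link? x z ×-dec Link? y z ×-dec ¬? (z ∈? vs))))
      ... | yes h = inj₁ h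
      ... | no ¬h = inj₂ λ {x} {y} {z} x∈ y∈ xy xz yz → in-vs x y z x∈ y∈ xy xz yz
        where
        in-vs : ∀ x y z → x ∈ vs → y ∈ vs → Link x y → Link x z → Link y z → z ∈ vs
        in-vs x y z x∈ y∈ xy xz yz with z ∈? vs
        ... | yes z∈ = z∈
        ... | no z∉ = ⊥-elim (¬h (x , y , z , x∈ , y∈ , xy , xz , yz , z∉))

      ∈-triRound : ∀ {vs es x y conf s′} → x ∈ vs → y ∈ vs → conf ∈ iterate triStep n ((x , y) , vs , es) →
        s′ ∈ close (proj₂ conf) → s′ ∈ triRound (vs , es)
      ∈-triRound {vs} {es} {x} x∈ y∈ conf∈ s′∈ =
        ∈->>= {xs = vs} {f = λ x → vs >>= λ y → iterate triStep n ((x , y) , vs , es) >>= (close ∘ proj₂)} x∈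
        (∈->>= {xs = vs} {f = λ y → iterate triStep n ((x , y) , vs , es) >>= (close ∘ proj₂)} y∈
        (∈->>= {f = close ∘ proj₂} conf∈ s′∈))

      round : Rich → ∀ {c s} → Explored c s → (∃[ s′ ] (s′ ∈ triRound s × Explored (suc c) s′)) ⊎ (Induced s × Closed s)
      round rich {c} {vs , es} e with extra? (vs , es)
      ... | inj₁ ex = let s′ , s′∈ , e′ = explored-close e ex ; x , x∈ = root e in
        inj₁ (s′ , ∈-triRound x∈ x∈ (iterate-self {f = triStep} n) s′∈ , e′)
      ... | inj₂ ind with open-triangle? vs
      ...   | inj₂ cl = inj₂ (ind , cl)
      ...   | inj₁ (x , y , z , x∈ , y∈ , xy , xz , yz , z∉) =
        let conf , conf∈ , s′ , s′∈ , e′ = chain rich n n< e x∈ y∈ (Link-≢ xy) (λ _ → z , z∉ , xz , yz) in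
        inj₁ (s′ , ∈-triRound x∈ y∈ conf∈ s′∈ , e′)
        where
        n< : n < n + length vs
        n< = ℕP.m<m+n n (ℕP.<-≤-trans (s≤s z≤n) (unique-length ([] ∷ []) λ { (here refl) → x∈ }))

      -- An exploration that stops before its third surplus edge has fewer than 2|V| edges.
      sparsePart : Rich → (∀ {s} → s ∈ triScripts → Unique (proj₂ s) → ¬ (∀ {k} → k ∈ proj₂ s → k ∈ L)) →
        ∀ {k} → k ∈ L → ∃[ s ] (Wf s × Induced s × Closed s ×
          ∃[ x ] (x ∈ proj₁ s × length (incident x (proj₂ s)) ≤ 3 × ∃[ k ] (k ∈ proj₂ s × At k x)))
      sparsePart rich noScript {k} k∈ = search
        where
        a = end₁ k
        b = end₂ k
        j : Joins k a b
        j = joins k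
        s₀ : State
        s₀ = b ∷ a ∷ [] , k ∷ []
        s₀∈ : s₀ ∈ triStart
        s₀∈ = ∈->>= {xs = allFin n} {f = λ x → allFin n >>= λ y → join x y (y ∷ x ∷ [] , [])} (∈-allFin a)
          (∈->>= {xs = allFin n} {f = λ y → join a y (y ∷ a ∷ [] , [])} (∈-allFin b) (∈-join j))
        e₀ : Explored 0 s₀
        e₀ = explored (wf (unique-∷ (λ { (here e) → Joins-≢ j (sym e) }) ([] ∷ [])) ([] ∷ []) (λ { (here refl) → k∈ }) ins) refl
          (λ { (here refl) → k , here refl , a , Joins-sym j ; (there (here refl)) → k , here refl , b , j }) (b , here refl)
          where
          ins : ∀ {l} {x y : Fin n} → l ∈ k ∷ [] → Joins l x y → x ∈ b ∷ a ∷ []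
          ins (here refl) jl with Joins-ends j jl
          ... | inj₁ (refl , _) = there (here refl)
          ... | inj₂ (refl , _) = here refl
        Target = ∃[ s ] (Wf s × Induced s × Closed s ×
          ∃[ x ] (x ∈ proj₁ s × length (incident x (proj₂ s)) ≤ 3 × ∃[ k ] (k ∈ proj₂ s × At k x)))
        finish : ∀ {c s} → c ≤ 2 → Explored c s → Induced s × Closed s → Target
        finish {c} {s@(vs , es)} c≤ e (ind , cl) =
          let x , x∈ , d = low-degree (well e) few in s , well e , ind , cl , x , x∈ , d , touched e x∈
          where
          few : length es + 1 ≤ 2 * length vs
          few = ℕP.+-cancelʳ-≤ 2 _ _ (subst (_≤ 2 * length vs + 2) (trans (sym (count e)) (sym (ℕP.+-assoc (length es) 1 2))) (ℕP.+-monoʳ-≤ (2 * length vs) c≤))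
        search : Target
        search with round rich e₀
        ... | inj₂ stop = finish z≤n e₀ stop
        ... | inj₁ (s₁ , s₁∈ , e₁) with round rich e₁
        ...   | inj₂ stop = finish (s≤s z≤n) e₁ stop
        ...   | inj₁ (s₂ , s₂∈ , e₂) with round rich e₂
        ...     | inj₂ stop = finish ℕP.≤-refl e₂ stop
        ...     | inj₁ (s₃ , s₃∈ , e₃) = ⊥-elim (noScript
                    (∈->>= {f = triRound} (∈->>= {f = triRound} (∈->>= {f = triRound} s₀∈ s₁∈) s₂∈) s₃∈)
                    (unique-es (well e₃)) (alive (well e₃)))

    Coloured : List (Fin M) → (Fin M → Bool) → Bool → Fin n → Fin n → Set
    Coloured L c col x y = ∃[ k ] (k ∈ L × Joins k x y × c k ≡ col)

    Coloured-sym : ∀ {L c col x y} → Coloured L c col x y → Coloured L c col y x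
    Coloured-sym (k , k∈ , j , e) = k , k∈ , Joins-sym j , e

    TriangleFree : List (Fin M) → (Fin M → Bool) → Set
    TriangleFree L c = ∀ x y z col → Coloured L c col x y → Coloured L c col x z → Coloured L c col y z → ⊥

    override : ∀ {P : Fin M → Set} → Decidable P → (f c : Fin M → Bool) → Fin M → Bool
    override P? f c k with P? k
    ... | yes _ = f k
    ... | no _ = c k

    module _ {P : Fin M → Set} (P? : Decidable P) (f c : Fin M → Bool) where

      override-yes : ∀ {k} → P k → override P? f c k ≡ f k
      override-yes {k} p with P? k
      ... | yes _ = refl
      ... | no ¬p = ⊥-elim (¬p p)

      override-no : ∀ {k} → ¬ P k → override P? f c k ≡ c k
      override-no {k} ¬p with P? k
      ... | yes p = ⊥-elim (¬p p)
      ... | no _ = refl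

      -- Only triangles with an edge in `P` need a new argument; they are rotated so that this edge
      -- comes first.
      extend : ∀ {L} → TriangleFree (filter (¬? ∘ P?) L) c →
        (∀ {k x y z col} → P k → k ∈ L → Joins k x y → f k ≡ col →
          Coloured L (override P? f c) col x z → Coloured L (override P? f c) col y z → ⊥) →
        TriangleFree L (override P? f c)
      extend {L} free new x y z col (k , k∈ , j , e) (l , l∈ , jl , el) (m , m∈ , jm , em) with P? k in pk
      ... | yes p = new p k∈ j e (l , l∈ , jl , el) (m , m∈ , jm , em)
      ... | no ¬pk with P? l in pl
      ...   | yes p = new p l∈ jl el′ (k , k∈ , j , ek′) (m , m∈ , Joins-sym jm , em)
        where
        el′ : f l ≡ col
        el′ = el
        ek′ : override P? f c k ≡ col
        ek′ = trans (override-no ¬pk) e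
      ...   | no ¬pl with P? m in pm
      ...     | yes p = new p m∈ jm em (k , k∈ , Joins-sym j , trans (override-no ¬pk) e) (l , l∈ , Joins-sym jl , trans (override-no ¬pl) el)
      ...     | no ¬pm = free x y z col (k , ∈-filter⁺ (¬? ∘ P?) k∈ ¬pk , j , e) (l , ∈-filter⁺ (¬? ∘ P?) l∈ ¬pl , jl , el)
                  (m , ∈-filter⁺ (¬? ∘ P?) m∈ ¬pm , jm , em)

    -- Each of the three conditions excludes two of the eight assignments, so at least two remain.
    -- The bits are colours of three edges at a vertex, and the forbidden common colour of two of
    -- them is that of the edge closing the triangle.
    threeColours : ∀ c₁₂ c₁₃ c₂₃ → Σ Bool λ b₁ → Σ Bool λ b₂ → Σ Bool λ b₃ →
      ¬ (b₁ ≡ c₁₂ × b₂ ≡ c₁₂) × ¬ (b₁ ≡ c₁₃ × b₃ ≡ c₁₃) × ¬ (b₂ ≡ c₂₃ × b₃ ≡ c₂₃)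
    threeColours true true true = false , false , false , (λ ()) , (λ ()) , (λ ())
    threeColours false false false = true , true , true , (λ ()) , (λ ()) , (λ ())
    threeColours true true false = false , true , true , (λ ()) , (λ ()) , (λ ())
    threeColours false false true = true , false , false , (λ ()) , (λ ()) , (λ ())
    threeColours true false true = true , false , true , (λ ()) , (λ ()) , (λ ())
    threeColours false true false = false , true , false , (λ ()) , (λ ()) , (λ ())
    threeColours true false false = false , false , true , (λ ()) , (λ ()) , (λ ())
    threeColours false true true = true , true , false , (λ ()) , (λ ()) , (λ ())

    -- Because of the padding in `short` the slots `a`, `b`, `c` may coincide; `f` therefore tests
    -- them in order.
    assign : ∀ (a b c : Fin M) (γ : Fin M → Fin M → Bool) → (∀ k l → γ k l ≡ γ l k) → Σ (Fin M → Bool) λ f →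
      ∀ {k l} → k ≢ l → k ≡ a ⊎ k ≡ b ⊎ k ≡ c → l ≡ a ⊎ l ≡ b ⊎ l ≡ c → ¬ (f k ≡ γ k l × f l ≡ γ k l)
    assign a b c γ γ-sym with threeColours (γ a b) (γ a c) (γ b c)
    ... | b₁ , b₂ , b₃ , h₁₂ , h₁₃ , h₂₃ = f , λ {k} {l} → ok k l
      where
      f : Fin M → Bool
      f k with k FinP.≟ a
      ... | yes _ = b₁
      ... | no _ with k FinP.≟ b
      ...   | yes _ = b₂
      ...   | no _ = b₃
      ok : ∀ k l → k ≢ l → k ≡ a ⊎ k ≡ b ⊎ k ≡ c → l ≡ a ⊎ l ≡ b ⊎ l ≡ c → ¬ (f k ≡ γ k l × f l ≡ γ k l)
      ok k l k≢l hk hl with k FinP.≟ a | l FinP.≟ a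
      ... | yes refl | yes refl = ⊥-elim (k≢l refl)
      ok k l k≢l hk hl | yes refl | no l≢a with l FinP.≟ b
      ... | yes refl = h₁₂
      ok k l k≢l hk (inj₁ e) | yes refl | no l≢a | no l≢b = ⊥-elim (l≢a e)
      ok k l k≢l hk (inj₂ (inj₁ e)) | yes refl | no l≢a | no l≢b = ⊥-elim (l≢b e)
      ok k l k≢l hk (inj₂ (inj₂ refl)) | yes refl | no l≢a | no l≢b = h₁₃
      ok k l k≢l hk hl | no k≢a | yes refl with k FinP.≟ b
      ... | yes refl = λ (p , q) → h₁₂ (trans q (γ-sym k l) , trans p (γ-sym k l))
      ok k l k≢l (inj₁ e) hl | no k≢a | yes refl | no k≢b = ⊥-elim (k≢a e)
      ok k l k≢l (inj₂ (inj₁ e)) hl | no k≢a | yes refl | no k≢b = ⊥-elim (k≢b e)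
      ok k l k≢l (inj₂ (inj₂ refl)) hl | no k≢a | yes refl | no k≢b = λ (p , q) → h₁₃ (trans q (γ-sym k l) , trans p (γ-sym k l))
      ok k l k≢l hk hl | no k≢a | no l≢a with k FinP.≟ b | l FinP.≟ b
      ok k l k≢l hk hl | no k≢a | no l≢a | yes refl | yes refl = ⊥-elim (k≢l refl)
      ok k l k≢l hk (inj₁ e) | no k≢a | no l≢a | yes refl | no l≢b = ⊥-elim (l≢a e)
      ok k l k≢l hk (inj₂ (inj₁ e)) | no k≢a | no l≢a | yes refl | no l≢b = ⊥-elim (l≢b e)
      ok k l k≢l hk (inj₂ (inj₂ refl)) | no k≢a | no l≢a | yes refl | no l≢b = h₂₃
      ok k l k≢l (inj₁ e) hl | no k≢a | no l≢a | no k≢b | _ = ⊥-elim (k≢a e)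
      ok k l k≢l (inj₂ (inj₁ e)) hl | no k≢a | no l≢a | no k≢b | _ = ⊥-elim (k≢b e)
      ok k l k≢l hk (inj₁ e) | no k≢a | no l≢a | no k≢b | no l≢b = ⊥-elim (l≢a e)
      ok k l k≢l hk (inj₂ (inj₁ e)) | no k≢a | no l≢a | no k≢b | no l≢b = ⊥-elim (l≢b e)
      ok k l k≢l (inj₂ (inj₂ refl)) hl | no k≢a | no l≢a | no k≢b | yes refl = λ (p , q) → h₂₃ (trans q (γ-sym k l) , trans p (γ-sym k l))
      ok k l k≢l (inj₂ (inj₂ refl)) (inj₂ (inj₂ refl)) | no k≢a | no l≢a | no k≢b | no l≢b = ⊥-elim (k≢l refl)

    pairColour : (Fin M → Bool) → Fin n → Fin n → Bool
    pairColour c v w with FinP.any? (λ k → Joins? k v w)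
    ... | yes (k , _) = c k
    -- A default for v = w, the only case without a slot.
    ... | no _ = true

    pairColour-joins : ∀ c {k v w} → Joins k v w → pairColour c v w ≡ c k
    pairColour-joins c {k} {v} {w} j with FinP.any? (λ k → Joins? k v w)
    ... | yes (l , jl) = cong c (Joins-unique jl j)
    ... | no ¬h = ⊥-elim (¬h (k , j))

    pairColour-sym : ∀ c v w → pairColour c v w ≡ pairColour c w v
    pairColour-sym c v w with FinP.any? (λ k → Joins? k v w)
    ... | yes (l , jl) = sym (pairColour-joins c (Joins-sym jl))
    ... | no ¬h with FinP.any? (λ k → Joins? k w v)
    ...   | yes (l , jl) = ⊥-elim (¬h (l , Joins-sym jl))
    ...   | no _ = refl

    other : Fin n → Fin M → Fin n
    other x k with end₁ k FinP.≟ x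
    ... | yes _ = end₂ k
    ... | no _ = end₁ k

    other-joins : ∀ {x v k} → Joins k x v → other x k ≡ v
    other-joins {x} {v} {k} j with end₁ k FinP.≟ x | Joins-ends (joins k) j
    ... | yes _ | inj₁ (_ , e) = sym e
    ... | yes p | inj₂ (e , _) = ⊥-elim (Joins-≢ (joins k) (trans p e))
    ... | no ¬p | inj₁ (e , _) = ⊥-elim (¬p (sym e))
    ... | no ¬p | inj₂ (_ , e) = sym e

    module Colouring (L₀ : List (Fin M))
      (noScript : ∀ {s} → s ∈ triScripts → Unique (proj₂ s) → ¬ (∀ {k} → k ∈ proj₂ s → k ∈ L₀)) where

      Poor : List (Fin M) → Set
      Poor L = ∃[ x ] ∃[ y ] ∃[ w ] (Exploration.Link L x y ×
        (∀ z → Exploration.Link L x z × Exploration.Link L y z → z ≡ w))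

      poor? : ∀ L → Poor L ⊎ Exploration.Rich L
      poor? L with FinP.any? (λ x → FinP.any? (λ y → FinP.any? (λ w → Link? x y ×-dec
          FinP.all? (λ z → (Link? x z ×-dec Link? y z) →-dec z FinP.≟ w))))
        where open Exploration L
      ... | yes h = inj₁ h
      ... | no ¬h = inj₂ rich
        where
        open Exploration L
        rich : Rich
        rich x y w xy with FinP.any? (λ z → Link? x z ×-dec Link? y z ×-dec ¬? (z FinP.≟ w))
        ... | yes r = r
        ... | no ¬r = ⊥-elim (¬h (x , y , w , xy , λ z (xz , yz) → same z xz yz))
          where
          same : ∀ z → Link x z → Link y z → z ≡ w
          same z xz yz with z FinP.≟ w
          ... | yes e = e
          ... | no ¬e = ⊥-elim (¬r (z , xz , yz , ¬e))

      -- Induction on the number of edges. An edge whose triangles all use one vertex `w` is deleted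
      -- and later coloured against its neighbour edge `x₀ w`. If there is none, `sparsePart` gives
      -- an induced closed part with a vertex `x₀` of degree at most three in it. These edges are
      -- deleted: every triangle through one of them lies in the part, so it consists of two deleted
      -- edges and one coloured edge, and `assign` applies.
      colour : ∀ t L → length L < t → (∀ {k} → k ∈ L → k ∈ L₀) → ∃[ c ] TriangleFree L c
      colour (suc t) [] _ _ = (λ _ → true) , λ { _ _ _ _ (_ , () , _) _ _ }
      colour (suc t) L@(k₀ ∷ _) (s≤s len) sub with poor? L
      ... | inj₁ (x₀ , y₀ , w , (e , e∈ , je) , only) = override P? f c , extend P? f c free removed
        where
        P : Fin M → Set
        P k = k ≡ e
        P? : Decidable P
        P? k = k FinP.≟ e
        rec : ∃[ c ] TriangleFree (filter (¬? ∘ P?) L) c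
        rec = colour t (filter (¬? ∘ P?) L) (ℕP.<-≤-trans (filter-notAll (¬? ∘ P?) L (lose e∈ (λ ¬p → ¬p refl))) len)
          (λ k∈ → sub (proj₁ (∈-filter⁻ (¬? ∘ P?) {xs = L} k∈)))
        c = proj₁ rec
        free = proj₂ rec
        f : Fin M → Bool
        f _ = not (pairColour c x₀ w)
        clash : ∀ {col z} → f e ≡ col → Coloured L (override P? f c) col x₀ z → Exploration.Link L y₀ z → ⊥
        clash {col} fe (l , l∈ , jl , el) yz with only _ ((l , l∈ , jl) , yz)
        ... | refl = BoolP.not-¬ refl (trans eq (sym fe))
          where
          l≢e : ¬ P l
          l≢e refl with Joins-ends jl je
          ... | inj₁ (_ , refl) = Joins-≢ (proj₂ (proj₂ yz)) refl
          ... | inj₂ (refl , _) = Joins-≢ jl refl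
          eq : pairColour c x₀ w ≡ col
          eq = trans (pairColour-joins c jl) (trans (sym (override-no P? f c l≢e)) el)
        removed : ∀ {k x y z col} → P k → k ∈ L → Joins k x y → f k ≡ col →
          Coloured L (override P? f c) col x z → Coloured L (override P? f c) col y z → ⊥
        removed refl k∈ j fe xz yz with Joins-ends je j
        ... | inj₁ (refl , refl) = clash fe xz (let l , l∈ , jl , _ = yz in l , l∈ , jl)
        ... | inj₂ (refl , refl) = clash fe yz (let l , l∈ , jl , _ = xz in l , l∈ , jl)
      ... | inj₂ rich with Exploration.sparsePart L rich (λ s∈ u s⊆ → noScript s∈ u (sub ∘ s⊆)) {k₀} (here refl)
      ...   | (vs , es) , w , ind , cl , x₀ , x₀∈ , d≤3 , (e , e∈ , ae) = override P? f c , extend P? f c free removed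
        where
        open Exploration L hiding (round; chain)
        P : Fin M → Set
        P k = k ∈ incident x₀ es
        P? : Decidable P
        P? k = k ∈? incident x₀ es
        Pe : P e
        Pe = ∈-filter⁺ (λ k → At? k x₀) e∈ ae
        P⁻ : ∀ {k} → P k → k ∈ es × At k x₀
        P⁻ = ∈-filter⁻ (λ k → At? k x₀) {xs = es}
        rec : ∃[ c ] TriangleFree (filter (¬? ∘ P?) L) c
        rec = colour t (filter (¬? ∘ P?) L) (ℕP.<-≤-trans (filter-notAll (¬? ∘ P?) L (lose (alive w e∈) (λ ¬p → ¬p Pe))) len)
          (λ k∈ → sub (proj₁ (∈-filter⁻ (¬? ∘ P?) {xs = L} k∈)))
        c = proj₁ rec
        free = proj₂ rec
        three = short Pe d≤3
        a₁ = proj₁ three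
        a₂ = proj₁ (proj₂ three)
        a₃ = proj₁ (proj₂ (proj₂ three))
        γ : Fin M → Fin M → Bool
        γ k l = pairColour c (other x₀ k) (other x₀ l)
        chosen = assign a₁ a₂ a₃ γ (λ k l → pairColour-sym c _ _)
        f = proj₁ chosen
        among : ∀ {k} → P k → k ≡ a₁ ⊎ k ≡ a₂ ⊎ k ≡ a₃
        among = proj₂ (proj₂ (proj₂ three))
        fromVertex : ∀ {k y z col} → P k → Joins k x₀ y → f k ≡ col →
          Coloured L (override P? f c) col x₀ z → Coloured L (override P? f c) col y z → ⊥
        fromVertex {k} {y} {z} {col} pk j fk (l , l∈ , jl , el) (m , m∈ , jm , em) =
          proj₂ chosen k≢l (among pk) (among pl) (trans fk (sym γ≡) , trans (trans (sym (override-yes P? f c pl)) el) (sym γ≡))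
          where
          k∈es = proj₁ (P⁻ pk)
          y∈ : y ∈ vs
          y∈ = inside w k∈es (Joins-sym j)
          z∈ : z ∈ vs
          z∈ = cl x₀∈ y∈ (k , alive w k∈es , j) (l , l∈ , jl) (m , m∈ , jm)
          pl : P l
          pl = ∈-filter⁺ (λ k → At? k x₀) (ind l∈ jl x₀∈ z∈) (z , jl)
          k≢l : k ≢ l
          k≢l = Joins-≢ʳ j jl (Joins-≢ jm)
          ¬pm : ¬ P m
          ¬pm pm with Joins-ends jm (proj₂ (proj₂ (P⁻ pm)))
          ... | inj₁ (refl , _) = Joins-≢ j refl
          ... | inj₂ (refl , _) = Joins-≢ jl refl
          γ≡ : γ k l ≡ col
          γ≡ = trans (cong₂ (pairColour c) (other-joins j) (other-joins jl)) (trans (pairColour-joins c jm)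
                 (trans (sym (override-no P? f c ¬pm)) em))
        removed : ∀ {k x y z col} → P k → k ∈ L → Joins k x y → f k ≡ col →
          Coloured L (override P? f c) col x z → Coloured L (override P? f c) col y z → ⊥
        removed pk k∈ j fk xz yz with Joins-ends j (proj₂ (proj₂ (P⁻ pk)))
        ... | inj₁ (refl , _) = fromVertex pk j fk xz yz
        ... | inj₂ (refl , _) = fromVertex pk (Joins-sym j) fk yz xz

-- Splitting the sparse random graph into two halves without a monochromatic K4.

module QuadColour where
  open Slots
  open Scripts
  open Explore
  open TriColour
  open import Data.Nat as ℕ using (ℕ; zero; suc; _+_; _*_; _≤_; _<_; z≤n; s≤s)
  open import Data.Nat.Solver using (module +-*-Solver)

  module Quads {n M : ℕ} (𝒮 : Slotting n M) (L : List (Fin M)) where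
    open Exploring 𝒮
    open Within L
    open Triangles 𝒮 using (Coloured; Coloured-sym; other; other-joins)

    module Exploration (X : List (Fin n)) where

      record Clique (x u v w : Fin n) : Set where
        constructor clique
        field
          u∈ : u ∈ X
          v∈ : v ∈ X
          w∈ : w ∈ X
          xu : Link x u
          xv : Link x v
          xw : Link x w
          uv : Link u v
          uw : Link u w
          vw : Link v w

      clique? : ∀ x u v w → Dec (Clique x u v w)
      clique? x u v w = map′ (λ (a , b , c , d , e , f , g , h , i) → clique a b c d e f g h i)
        (λ (clique a b c d e f g h i) → a , b , c , d , e , f , g , h , i)
        ((u ∈? X) ×-dec (v ∈? X) ×-dec (w ∈? X) ×-dec Link? x u ×-dec Link? x v ×-dec Link? x w ×-dec
         Link? u v ×-dec Link? u w ×-dec Link? v w)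

      clique-swap : ∀ {x u v w} → Clique x u v w → Clique x u w v
      clique-swap (clique a b c d e f g h i) = clique a c b d f e h g (Link-sym i)

      -- No vertex of `X` lies in at most one K4 of `X`. The three avoided vertices are the rest of
      -- the K4 just explored in `chain`, and all neighbours of a vertex of low degree in `notRich`.
      Rich : Set
      Rich = ∀ x → x ∈ X → ∀ a b c → ∃[ u ] ∃[ v ] ∃[ w ] (Clique x u v w × u ≢ a × u ≢ b × u ≢ c)

      -- c counts the edges in excess of the 2|V| − 2 edges of a tree of cliques
      record Explored (c : ℕ) (s : State) : Set where
        constructor explored
        field
          well : Wf s
          count : length (proj₂ s) + 2 ≡ 2 * length (proj₁ s) + c
          within : ∀ {x} → x ∈ proj₁ s → x ∈ X
          root : ∃[ x ] (x ∈ proj₁ s)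
      open Explored public

      Closed : State → Set
      Closed (vs , es) = ∀ {x u v w} → x ∈ vs → Clique x u v w → u ∈ vs

      Closable : ℕ → State → Set
      Closable c s = ∃[ s′ ] (s′ ∈ close s × Explored (suc c) s′)

      explored-join : ∀ {c k x y vs es} → Explored c (vs , es) → k ∈ L → Joins k x y → x ∈ vs → y ∈ vs → k ∉ es → Closable c (vs , es)
      explored-join {c} {k} {x} {y} {vs} {es} e k∈ j x∈ y∈ k∉ =
        (vs , k ∷ es) , close-∈ j x∈ y∈ ,
        explored (wf-join k∈ j x∈ y∈ k∉ (well e)) (trans (cong suc (count e)) (sym (ℕP.+-suc (2 * length vs) c))) (within e) (root e)

      explored-close : ∀ {c s} → Explored c s → Extra s → Closable c s
      explored-close e (k , x , y , k∈ , j , x∈ , y∈ , k∉) = explored-join e k∈ j x∈ y∈ k∉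

      explored-attach : ∀ {c k l x y z vs es} → Explored c (vs , es) → z ∈ X → z ∉ vs → x ∈ vs → y ∈ vs → x ≢ y →
        k ∈ L → l ∈ L → Joins k x z → Joins l y z → Explored c (z ∷ vs , l ∷ k ∷ es)
      explored-attach {c} {z = z} {vs} e z∈X z∉ x∈ y∈ x≢y k∈ l∈ j j′ =
        explored (wf-attach (well e) z∉ x≢y x∈ y∈ k∈ l∈ j j′)
          (trans (cong (λ t → suc (suc t)) (count e)) (solve 2 (λ v c → con 2 :+ (con 2 :* v :+ c) := con 2 :* (con 1 :+ v) :+ c) refl (length vs) c))
          (λ { (here refl) → z∈X ; (there u∈) → within e u∈ })
          (z , here refl)
        where open +-*-Solver

      attachAny-∈ : ∀ {k l x y z vs es} → x ∈ vs → y ∈ vs → Joins k x z → Joins l y z → (z ∷ vs , l ∷ k ∷ es) ∈ attachAny (vs , es)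
      attachAny-∈ {x = x} {y} {z} {vs} {es} x∈ y∈ j j′ =
        ∈->>= {xs = vs} {f = λ x → vs >>= λ y → allFin n >>= λ z → attach x y z (vs , es)} x∈
        (∈->>= {xs = vs} {f = λ y → allFin n >>= λ z → attach x y z (vs , es)} y∈
        (∈->>= {xs = allFin n} {f = λ z → attach x y z (vs , es)} (∈-allFin z) (attach-∈ j j′)))

      Finish : ℕ → State → Set
      Finish c s = ∃[ s₁ ] (s₁ ∈ closers s × Closable c s₁)

      -- A clique meeting the visited vertices in two or three vertices closes the exploration.
      meeting : ∀ {c s x u v w} → Explored c s → x ∈ proj₁ s → Clique x u v w → u ∉ proj₁ s → v ∈ proj₁ s → Finish c s
      meeting {c} {vs , es} {x} {u} {v} {w} e x∈ (clique u∈X v∈X w∈X (a , a∈ , ja) (b , b∈ , jb) (d , d∈ , jd) (f , f∈ , jf) (g , g∈ , jg) (h , h∈ , jh)) u∉ v∈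
        with w ∈? vs
      ... | yes w∈ = (u ∷ vs , f ∷ a ∷ es) , there (∈-++⁺ˡ (attachAny-∈ x∈ v∈ ja (Joins-sym jf))) ,
            explored-join e₁ g∈ jg (here refl) (there w∈)
              (∉-cons (Joins-≢ʳ jg jf (Joins-≢ (Joins-sym jh)))
              (∉-cons (Joins-≢ʳ jg (Joins-sym ja) (Joins-≢ (Joins-sym jd))) (fresh (well e) u∉ jg)))
        where
        e₁ = explored-attach e u∈X u∉ x∈ v∈ (Joins-≢ jb) a∈ f∈ ja (Joins-sym jf)
      ... | no w∉ = (w ∷ u ∷ vs , h ∷ d ∷ f ∷ a ∷ es) ,
            there (∈-++⁺ʳ (attachAny (vs , es)) (∈->>= {xs = attachAny (vs , es)} {f = attachAny}
              (attachAny-∈ x∈ v∈ ja (Joins-sym jf)) (attachAny-∈ (there x∈) (there v∈) jd jh))) ,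
            explored-join e₂ g∈ jg (there (here refl)) (here refl)
              (∉-cons (Joins-≢ʳ (Joins-sym jg) (Joins-sym jh) (Joins-≢ jf))
              (∉-cons (Joins-≢ʳ (Joins-sym jg) (Joins-sym jd) (Joins-≢ (Joins-sym ja))) (fresh (well e₁) w∉′ (Joins-sym jg))))
        where
        e₁ = explored-attach e u∈X u∉ x∈ v∈ (Joins-≢ jb) a∈ f∈ ja (Joins-sym jf)
        w∉′ : w ∉ u ∷ vs
        w∉′ = ∉-cons (Joins-≢ (Joins-sym jg)) w∉
        e₂ = explored-attach e₁ w∈X w∉′ (there x∈) (there v∈) (Joins-≢ jb) d∈ h∈ jd jh

      Next : Fin n → State → Set
      Next x (vs , es) = ∃[ u ] ∃[ v ] ∃[ w ] (Clique x u v w × u ∉ vs)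

      -- A K4 that leaves the visited set either meets it only in `x` and is added whole, six edges
      -- for three vertices keeping the surplus, or meets it in more vertices and `meeting` closes
      -- the exploration.
      chain : Rich → ∀ {c} t {x vs es} → n < t + length vs → Explored c (vs , es) → x ∈ vs → (Induced (vs , es) → Next x (vs , es)) →
        ∃[ conf ] (conf ∈ iterate quadStep t (x , vs , es) × Finish c (proj₂ conf))
      chain rich zero n< e _ _ = ⊥-elim (ℕP.<⇒≱ n< (unique-≤n (unique-vs (well e))))
      chain rich {c} (suc t) {x} {vs} {es} n< e x∈ next with extra? (vs , es)
      ... | inj₁ ex = (x , vs , es) , here refl , (vs , es) , here refl , explored-close e ex
      ... | inj₂ ind with next ind
      ...   | u , v , w , K , u∉ with v ∈? vs | w ∈? vs
      ...     | yes v∈ | _ = (x , vs , es) , here refl , meeting e x∈ K u∉ v∈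
      ...     | no _ | yes w∈ = (x , vs , es) , here refl , meeting e x∈ (clique-swap K) u∉ w∈
      chain rich {c} (suc t) {x} {vs} {es} n< e x∈ next | inj₂ ind
            | u , v , w , clique u∈X v∈X w∈X (a , a∈ , ja) (b , b∈ , jb) (d , d∈ , jd) (f , f∈ , jf) (g , g∈ , jg) (h , h∈ , jh) , u∉ | no v∉ | no w∉ =
        let conf , conf∈ , fin = chain rich t n<′ e′ (there (there (here refl))) next′ in conf , iterate-step step∈ conf∈ , fin
        where
        vs′ = w ∷ v ∷ u ∷ vs
        es′ = h ∷ g ∷ d ∷ f ∷ b ∷ a ∷ es
        n<′ : n < t + length vs′
        n<′ = ℕP.<-≤-trans n< (ℕP.≤-trans (ℕP.≤-reflexive (sym (ℕP.+-suc t (length vs)))) (ℕP.+-monoʳ-≤ t (ℕP.m≤n+m _ 2)))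
        v∉′ : v ∉ u ∷ vs
        v∉′ = ∉-cons (Joins-≢ (Joins-sym jf)) v∉
        w∉′ : w ∉ v ∷ u ∷ vs
        w∉′ = ∉-cons (Joins-≢ (Joins-sym jh)) (∉-cons (Joins-≢ (Joins-sym jg)) w∉)
        w₁ : Wf (u ∷ vs , a ∷ es)
        w₁ = wf-join a∈ ja (there x∈) (here refl) (fresh (well e) u∉ (Joins-sym ja)) (wf-new u∉ (well e))
        w₂ : Wf (v ∷ u ∷ vs , f ∷ b ∷ a ∷ es)
        w₂ = wf-join f∈ jf (there (here refl)) (here refl)
               (∉-cons (Joins-≢ʳ (Joins-sym jf) (Joins-sym jb) (Joins-≢ (Joins-sym ja))) (fresh w₁ v∉′ (Joins-sym jf)))
             (wf-join b∈ jb (there (there x∈)) (here refl) (fresh w₁ v∉′ (Joins-sym jb)) (wf-new v∉′ w₁))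
        w₃ : Wf (vs′ , es′)
        w₃ = wf-join h∈ jh (there (here refl)) (here refl)
               (∉-cons (Joins-≢ʳ (Joins-sym jh) (Joins-sym jg) (Joins-≢ (Joins-sym jf)))
               (∉-cons (Joins-≢ʳ (Joins-sym jh) (Joins-sym jd) (Joins-≢ (Joins-sym jb))) (fresh w₂ w∉′ (Joins-sym jh))))
             (wf-join g∈ jg (there (there (here refl))) (here refl)
               (∉-cons (Joins-≢ʳ (Joins-sym jg) (Joins-sym jd) (Joins-≢ (Joins-sym ja))) (fresh w₂ w∉′ (Joins-sym jg)))
             (wf-join d∈ jd (there (there (there x∈))) (here refl) (fresh w₂ w∉′ (Joins-sym jd)) (wf-new w∉′ w₂)))
        e′ : Explored c (vs′ , es′)
        e′ = explored w₃
          (trans (cong (6 +_) (count e)) (solve 2 (λ v c → con 6 :+ (con 2 :* v :+ c) := con 2 :* (con 3 :+ v) :+ c) refl (length vs) c))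
          (λ { (here refl) → w∈X ; (there (here refl)) → v∈X ; (there (there (here refl))) → u∈X ; (there (there (there y∈))) → within e y∈ })
          (w , here refl)
          where open +-*-Solver
        step∈ : (u , vs′ , es′) ∈ quadStep (x , vs , es)
        step∈ =
          ∈->>= {xs = allFin n} {f = λ a → allFin n >>= λ b → allFin n >>= λ c → map (a ,_) (quad x a b c (vs , es))} (∈-allFin u)
          (∈->>= {xs = allFin n} {f = λ b → allFin n >>= λ c → map (u ,_) (quad x u b c (vs , es))} (∈-allFin v)
          (∈->>= {xs = allFin n} {f = λ c → map (u ,_) (quad x u v c (vs , es))} (∈-allFin w)
          (∈-map⁺ (u ,_)
            (∈->>= {f = join v w} (∈->>= {f = join u w} (∈->>= {f = λ s → join x w (new w s)} (∈->>= {f = join u v}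
              (∈->>= {f = λ s → join x v (new v s)} (∈-join ja) (∈-join jb)) (∈-join jf)) (∈-join jd)) (∈-join jg)) (∈-join jh)))))
        -- The recorded edges at `u` lead only to `x`, `v`, `w`. `Rich` gives a K4 at `u` with a
        -- further neighbour, which is unvisited because the state is induced.
        next′ : Induced (vs′ , es′) → Next u (vs′ , es′)
        next′ ind′ with rich u u∈X x v w
        ... | u′ , v′ , w′ , K′ , u′≢x , u′≢v , u′≢w = u′ , v′ , w′ , K′ , u′∉
          where
          m = proj₁ (Clique.xu K′)
          m∈ = proj₁ (proj₂ (Clique.xu K′))
          jm : Joins m u u′
          jm = proj₂ (proj₂ (Clique.xu K′))
          meets : ∀ {l y z} → m ≡ l → Joins l y z → (u ≢ y ⊎ u′ ≢ z) → (u ≢ z ⊎ u′ ≢ y) → ⊥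
          meets refl j p q with Joins-ends j jm
          meets refl j (inj₁ h) q | inj₁ (e₁ , _) = h e₁
          meets refl j (inj₂ h) q | inj₁ (_ , e₂) = h e₂
          meets refl j p (inj₁ h) | inj₂ (e₁ , _) = h e₁
          meets refl j p (inj₂ h) | inj₂ (_ , e₂) = h e₂
          u≢x : u ≢ x
          u≢x = Joins-≢ (Joins-sym ja)
          old : u′ ∈ vs → m ∈ es′ → ⊥
          old _ (here p) = meets p jh (inj₁ (Joins-≢ jf)) (inj₁ (Joins-≢ jg))
          old _ (there (here p)) = meets p jg (inj₂ u′≢w) (inj₁ (Joins-≢ jg))
          old _ (there (there (here p))) = meets p jd (inj₁ u≢x) (inj₁ (Joins-≢ jg))
          old _ (there (there (there (here p)))) = meets p jf (inj₂ u′≢v) (inj₁ (Joins-≢ jf))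
          old _ (there (there (there (there (here p))))) = meets p jb (inj₁ u≢x) (inj₁ (Joins-≢ jf))
          old _ (there (there (there (there (there (here p)))))) = meets p ja (inj₁ u≢x) (inj₂ u′≢x)
          old _ (there (there (there (there (there (there p)))))) = u∉ (inside (well e) p jm)
          u′∉ : u′ ∉ vs′
          u′∉ (here p) = u′≢w p
          u′∉ (there (here p)) = u′≢v p
          u′∉ (there (there (here p))) = Joins-≢ jm (sym p)
          u′∉ (there (there (there u′∈))) = old u′∈ (ind′ m∈ jm (there (there (here refl))) (there (there (there u′∈))))

      open-clique? : ∀ vs → (∃[ x ] (x ∈ vs × ∃[ u ] ∃[ v ] ∃[ w ] (Clique x u v w × u ∉ vs))) ⊎
        (∀ {x u v w} → x ∈ vs → Clique x u v w → u ∈ vs)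
      open-clique? vs with FinP.any? (λ x → (x ∈? vs) ×-dec FinP.any? (λ u → FinP.any? (λ v → FinP.any? (λ w → clique? x u v w ×-dec ¬? (u ∈? vs)))))
      ... | yes h = inj₁ h
      ... | no ¬h = inj₂ λ {x} {u} {v} {w} x∈ K → in-vs x u v w x∈ K
        where
        in-vs : ∀ x u v w → x ∈ vs → Clique x u v w → u ∈ vs
        in-vs x u v w x∈ K with u ∈? vs
        ... | yes u∈ = u∈
        ... | no u∉ = ⊥-elim (¬h (x , x∈ , u , v , w , K , u∉))

      ∈-quadRound : ∀ {vs es x conf s₁ s′} → x ∈ vs → conf ∈ iterate quadStep n (x , vs , es) →
        s₁ ∈ closers (proj₂ conf) → s′ ∈ close s₁ → s′ ∈ quadRound (vs , es)
      ∈-quadRound {vs} {es} x∈ conf∈ s₁∈ s′∈ =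
        ∈->>= {xs = vs} {f = λ x → iterate quadStep n (x , vs , es) >>= (closers ∘ proj₂) >>= close} x∈
        (∈->>= {f = close} (∈->>= {f = closers ∘ proj₂} conf∈ s₁∈) s′∈)

      round : Rich → ∀ {c s} → Explored c s → (∃[ s′ ] (s′ ∈ quadRound s × Explored (suc c) s′)) ⊎ (Induced s × Closed s)
      round rich {c} {vs , es} e with extra? (vs , es)
      ... | inj₁ ex = let s′ , s′∈ , e′ = explored-close e ex ; x , x∈ = root e in
        inj₁ (s′ , ∈-quadRound x∈ (iterate-self {f = quadStep} n) (here refl) s′∈ , e′)
      ... | inj₂ ind with open-clique? vs
      ...   | inj₂ cl = inj₂ (ind , cl)
      ...   | inj₁ (x , x∈ , u , v , w , K , u∉) =
        let conf , conf∈ , s₁ , s₁∈ , s′ , s′∈ , e′ = chain rich n n< e x∈ (λ _ → u , v , w , K , u∉) in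
        inj₁ (s′ , ∈-quadRound x∈ conf∈ s₁∈ s′∈ , e′)
        where
        n< : n < n + length vs
        n< = ℕP.m<m+n n (ℕP.<-≤-trans (s≤s z≤n) (unique-length ([] ∷ []) λ { (here refl) → x∈ }))

      -- If the exploration stopped early, some visited vertex would have at most three recorded
      -- edges. As the state is induced and closed, all its K4's use only these edges at it, whereas
      -- `Rich` provides one with a further neighbour.
      notRich : (∀ {s} → s ∈ quadScripts → Unique (proj₂ s) → ¬ (∀ {k} → k ∈ proj₂ s → k ∈ L)) →
        ∀ {x} → x ∈ X → ¬ Rich
      notRich noScript {x₀} x₀∈X rich = search
        where
        s₀ : State
        s₀ = x₀ ∷ [] , []
        s₀∈ : s₀ ∈ quadStart
        s₀∈ = ∈-map⁺ (λ x → x ∷ [] , []) (∈-allFin x₀)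
        e₀ : Explored 0 s₀
        e₀ = explored (wf ([] ∷ []) [] (λ ()) (λ ())) refl (λ { (here refl) → x₀∈X }) (x₀ , here refl)
        finish : ∀ {c s} → c ≤ 1 → Explored c s → Induced s × Closed s → ⊥
        finish {c} {s@(vs , es)} c≤ e (ind , cl) with low-degree (well e) few
          where
          few : length es + 1 ≤ 2 * length vs
          few = ℕP.+-cancelʳ-≤ 1 _ _ (subst (_≤ 2 * length vs + 1) (trans (sym (count e)) (sym (ℕP.+-assoc (length es) 1 1))) (ℕP.+-monoʳ-≤ (2 * length vs) c≤))
        ... | x , x∈ , d≤3 = contra
          where
          slotTo : ∀ {u v w} → Clique x u v w → ∃[ k ] (k ∈ incident x es × Joins k x u)
          slotTo K = let k , k∈ , j = Clique.xu K in k , ∈-filter⁺ (λ k → At? k x) (ind k∈ j x∈ (cl x∈ K)) (_ , j) , j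
          contra : ⊥
          contra with rich x (within e x∈) x x x
          -- Any K4 at `x`: it only provides the incident edge that `short` needs.
          ... | _ , _ , _ , K₀ , _ with short (proj₁ (proj₂ (slotTo K₀))) d≤3
          ...   | a , b , c , among with rich x (within e x∈) (other x a) (other x b) (other x c)
          ...     | u , _ , _ , K , u≢a , u≢b , u≢c with slotTo K
          ...       | k , k∈ , j with among k∈
          ...         | inj₁ refl = u≢a (sym (other-joins j))
          ...         | inj₂ (inj₁ refl) = u≢b (sym (other-joins j))
          ...         | inj₂ (inj₂ refl) = u≢c (sym (other-joins j))
        search : ⊥
        search with round rich e₀
        ... | inj₂ stop = finish z≤n e₀ stop
        ... | inj₁ (s₁ , s₁∈ , e₁) with round rich e₁
        ...   | inj₂ stop = finish ℕP.≤-refl e₁ stop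
        ...   | inj₁ (s₂ , s₂∈ , e₂) = noScript (∈->>= {f = quadRound} (∈->>= {f = quadRound} s₀∈ s₁∈) s₂∈)
                  (unique-es (well e₂)) (alive (well e₂))

    majority : Bool → Bool → Bool → Bool
    majority true true _ = true
    majority false false _ = false
    majority true false c = c
    majority false true c = c

    majority₁₂ : ∀ t c → majority t t c ≡ t
    majority₁₂ true c = refl
    majority₁₂ false c = refl

    majority₁₃ : ∀ t b → majority t b t ≡ t
    majority₁₃ true true = refl
    majority₁₃ true false = refl
    majority₁₃ false true = refl
    majority₁₃ false false = refl

    majority₂₃ : ∀ t a → majority a t t ≡ t
    majority₂₃ true true = refl
    majority₂₃ true false = refl
    majority₂₃ false true = refl
    majority₂₃ false false = refl

    majority-two : ∀ (σ : Fin n → Bool) {a b c p q t} → p ≢ q → p ≡ a ⊎ p ≡ b ⊎ p ≡ c → q ≡ a ⊎ q ≡ b ⊎ q ≡ c →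
      σ p ≡ t → σ q ≡ t → majority (σ a) (σ b) (σ c) ≡ t
    majority-two σ p≢q (inj₁ refl) (inj₁ refl) _ _ = ⊥-elim (p≢q refl)
    majority-two σ {c = c} p≢q (inj₁ refl) (inj₂ (inj₁ refl)) e f rewrite e | f = majority₁₂ _ (σ c)
    majority-two σ {b = b} p≢q (inj₁ refl) (inj₂ (inj₂ refl)) e f rewrite e | f = majority₁₃ _ (σ b)
    majority-two σ {c = c} p≢q (inj₂ (inj₁ refl)) (inj₁ refl) e f rewrite e | f = majority₁₂ _ (σ c)
    majority-two σ p≢q (inj₂ (inj₁ refl)) (inj₂ (inj₁ refl)) _ _ = ⊥-elim (p≢q refl)
    majority-two σ {a = a} p≢q (inj₂ (inj₁ refl)) (inj₂ (inj₂ refl)) e f rewrite e | f = majority₂₃ _ (σ a)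
    majority-two σ {b = b} p≢q (inj₂ (inj₂ refl)) (inj₁ refl) e f rewrite e | f = majority₁₃ _ (σ b)
    majority-two σ {a = a} p≢q (inj₂ (inj₂ refl)) (inj₂ (inj₁ refl)) e f rewrite e | f = majority₂₃ _ (σ a)
    majority-two σ p≢q (inj₂ (inj₂ refl)) (inj₂ (inj₂ refl)) _ _ = ⊥-elim (p≢q refl)

    record Mono (X : List (Fin n)) (c : Fin M → Bool) (col : Bool) (x u v w : Fin n) : Set where
      constructor mono
      field
        x∈ : x ∈ X
        u∈ : u ∈ X
        v∈ : v ∈ X
        w∈ : w ∈ X
        xu : Coloured L c col x u
        xv : Coloured L c col x v
        xw : Coloured L c col x w
        uv : Coloured L c col u v
        uw : Coloured L c col u w
        vw : Coloured L c col v w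

    -- Edges between the halves may have either colour. `inner` is what later excludes a
    -- monochromatic triangle on one left and two right vertices.
    record Split (X : List (Fin n)) (σ : Fin n → Bool) (c : Fin M → Bool) : Set where
      constructor split
      field
        inner : ∀ {k x y} → x ∈ X → y ∈ X → k ∈ L → Joins k x y → σ x ≡ σ y → c k ≡ σ x
        free : ∀ {col x u v w} → ¬ Mono X c col x u v w

    -- Three names cover the rest of a single K4: such an `x` lies in at most one K4 of `X`.
    Peelable : List (Fin n) → Set
    Peelable X = ∃[ x ] (x ∈ X × ∃[ a ] ∃[ b ] ∃[ c ] (∀ u v w → Exploration.Clique X x u v w → u ≡ a ⊎ u ≡ b ⊎ u ≡ c))

    peelable? : ∀ X → Peelable X ⊎ Exploration.Rich X
    peelable? X with FinP.any? (λ x → (x ∈? X) ×-dec FinP.any? (λ a → FinP.any? (λ b → FinP.any? (λ c →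
        FinP.all? (λ u → FinP.all? (λ v → FinP.all? (λ w → Exploration.clique? X x u v w →-dec
          ((u FinP.≟ a) ⊎-dec (u FinP.≟ b) ⊎-dec (u FinP.≟ c)))))))))
    ... | yes h = inj₁ h
    ... | no ¬h = inj₂ rich
      where
      open Exploration X
      rich : Rich
      rich x x∈ a b c with FinP.any? (λ u → FinP.any? (λ v → FinP.any? (λ w →
        clique? x u v w ×-dec ¬? (u FinP.≟ a) ×-dec ¬? (u FinP.≟ b) ×-dec ¬? (u FinP.≟ c))))
      ... | yes r = r
      ... | no ¬r = ⊥-elim (¬h (x , x∈ , a , b , c , all))
        where
        all : ∀ u v w → Clique x u v w → u ≡ a ⊎ u ≡ b ⊎ u ≡ c
        all u v w K with u FinP.≟ a | u FinP.≟ b | u FinP.≟ c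
        ... | yes e | _ | _ = inj₁ e
        ... | no _ | yes e | _ = inj₂ (inj₁ e)
        ... | no _ | no _ | yes e = inj₂ (inj₂ e)
        ... | no p | no q | no r = ⊥-elim (¬r (u , v , w , K , p , q , r))

    -- Vertices are peeled off one by one: `notRich` provides an `x₀` in at most one K4 of `X`. It
    -- is put on the side opposite to the majority of the other three vertices, and all its edges
    -- take the colour of that side.
    partition : (∀ {s} → s ∈ quadScripts → Unique (proj₂ s) → ¬ (∀ {k} → k ∈ proj₂ s → k ∈ L)) →
      ∀ t X → length X < t → Σ (Fin n → Bool) λ σ → Σ (Fin M → Bool) λ c → Split X σ c
    partition noScript (suc t) [] _ = (λ _ → true) , (λ _ → true) , split (λ ()) (λ { (mono () _ _ _ _ _ _ _ _ _) })
    partition noScript (suc t) X@(y₀ ∷ _) (s≤s len) with peelable? X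
    ... | inj₂ rich = ⊥-elim (Exploration.notRich X noScript {y₀} (here refl) rich)
    ... | inj₁ (x₀ , x₀∈ , a , b , c , only) = σ , χ , split inner′ free′
      where
      ≢x₀? = λ y → ¬? (y FinP.≟ x₀)
      X′ = filter ≢x₀? X
      rec = partition noScript t X′ (ℕP.<-≤-trans (filter-notAll ≢x₀? X (lose x₀∈ (λ h → h refl))) len)
      σ′ = proj₁ rec
      χ′ = proj₁ (proj₂ rec)
      open Split (proj₂ (proj₂ rec))
      τ = not (majority (σ′ a) (σ′ b) (σ′ c))
      σ : Fin n → Bool
      σ y with y FinP.≟ x₀
      ... | yes _ = τ
      ... | no _ = σ′ y
      χ : Fin M → Bool
      χ k with At? k x₀
      ... | yes _ = τ
      ... | no _ = χ′ k
      σ-x₀ : σ x₀ ≡ τ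
      σ-x₀ with x₀ FinP.≟ x₀
      ... | yes _ = refl
      ... | no h = ⊥-elim (h refl)
      σ-other : ∀ {y} → y ≢ x₀ → σ y ≡ σ′ y
      σ-other {y} h with y FinP.≟ x₀
      ... | yes e = ⊥-elim (h e)
      ... | no _ = refl
      χ-other : ∀ {k y z} → Joins k y z → y ≢ x₀ → z ≢ x₀ → χ k ≡ χ′ k
      χ-other {k} j y≢ z≢ with At? k x₀
      ... | no _ = refl
      ... | yes (_ , j′) with Joins-ends j j′
      ...   | inj₁ (e , _) = ⊥-elim (y≢ (sym e))
      ...   | inj₂ (e , _) = ⊥-elim (z≢ (sym e))
      χ-x₀ : ∀ {k y} → Joins k x₀ y → χ k ≡ τ
      χ-x₀ {k} j with At? k x₀
      ... | yes _ = refl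
      ... | no h = ⊥-elim (h (_ , j))
      member : ∀ {y} → y ∈ X → y ≢ x₀ → y ∈ X′
      member y∈ h = ∈-filter⁺ ≢x₀? y∈ h
      inner′ : ∀ {k x y} → x ∈ X → y ∈ X → k ∈ L → Joins k x y → σ x ≡ σ y → χ k ≡ σ x
      inner′ {k} {x} {y} x∈ y∈ k∈ j e = go (x FinP.≟ x₀) (y FinP.≟ x₀)
        where
        go : Dec (x ≡ x₀) → Dec (y ≡ x₀) → χ k ≡ σ x
        go (yes refl) _ = trans (χ-x₀ j) (sym σ-x₀)
        go (no _) (yes refl) = trans (χ-x₀ (Joins-sym j)) (trans (sym σ-x₀) (sym e))
        go (no x≢) (no y≢) = trans (χ-other j x≢ y≢) (trans
          (inner (member x∈ x≢) (member y∈ y≢) k∈ j (trans (sym (σ-other x≢)) (trans e (σ-other y≢)))) (sym (σ-other x≢)))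
      old : ∀ {col y z} → y ≢ x₀ → z ≢ x₀ → Coloured L χ col y z → Coloured L χ′ col y z
      old y≢ z≢ (k , k∈ , j , e) = k , k∈ , j , trans (sym (χ-other j y≢ z≢)) e
      link : ∀ {col y z} → Coloured L χ col y z → Link y z
      link (k , k∈ , j , _) = k , k∈ , j
      -- Two of u, v, w lie on the same side; the edge between them has the majority colour, not τ.
      at-x₀ : ∀ {col u v w} → ¬ Mono X χ col x₀ u v w
      at-x₀ {col} {u} {v} {w} (mono x∈ u∈ v∈ w∈ xu xv xw uv uw vw) = pigeon (σ′ u) (σ′ v) (σ′ w) refl refl refl
        where
        col≡τ : col ≡ τ
        col≡τ = let _ , _ , j , e = xu in trans (sym e) (χ-x₀ j)
        amongU : u ≡ a ⊎ u ≡ b ⊎ u ≡ c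
        amongU = only u v w (Exploration.clique u∈ v∈ w∈ (link xu) (link xv) (link xw) (link uv) (link uw) (link vw))
        amongV : v ≡ a ⊎ v ≡ b ⊎ v ≡ c
        amongV = only v u w (Exploration.clique v∈ u∈ w∈ (link xv) (link xu) (link xw) (link (Coloured-sym uv)) (link vw) (link uw))
        amongW : w ≡ a ⊎ w ≡ b ⊎ w ≡ c
        amongW = only w u v (Exploration.clique w∈ u∈ v∈ (link xw) (link xu) (link xv) (link (Coloured-sym uw)) (link (Coloured-sym vw)) (link uv))
        ≢x₀ : ∀ {y} → Coloured L χ col x₀ y → y ≢ x₀
        ≢x₀ (_ , _ , j , _) e = Joins-≢ j (sym e)
        clash : ∀ {p q} → p ∈ X → q ∈ X → Coloured L χ col x₀ p → Coloured L χ col x₀ q → Coloured L χ col p q →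
          p ≡ a ⊎ p ≡ b ⊎ p ≡ c → q ≡ a ⊎ q ≡ b ⊎ q ≡ c → σ′ p ≡ σ′ q → ⊥
        clash {p} {q} p∈ q∈ xp xq pq ap aq e with old (≢x₀ xp) (≢x₀ xq) pq
        ... | k , k∈ , j , ek = BoolP.not-¬ refl (trans (majority-two σ′ (Joins-≢ j) ap aq σp≡ (trans (sym e) σp≡)) refl)
          where
          σp≡ : σ′ p ≡ τ
          σp≡ = trans (sym (inner (member p∈ (≢x₀ xp)) (member q∈ (≢x₀ xq)) k∈ j e)) (trans ek col≡τ)
        pigeon : ∀ s t r → σ′ u ≡ s → σ′ v ≡ t → σ′ w ≡ r → ⊥
        pigeon true true _ e f g = clash u∈ v∈ xu xv uv amongU amongV (trans e (sym f))
        pigeon false false _ e f g = clash u∈ v∈ xu xv uv amongU amongV (trans e (sym f))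
        pigeon true false true e f g = clash u∈ w∈ xu xw uw amongU amongW (trans e (sym g))
        pigeon false true false e f g = clash u∈ w∈ xu xw uw amongU amongW (trans e (sym g))
        pigeon true false false e f g = clash v∈ w∈ xv xw vw amongV amongW (trans f (sym g))
        pigeon false true true e f g = clash v∈ w∈ xv xw vw amongV amongW (trans f (sym g))
      free′ : ∀ {col x u v w} → ¬ Mono X χ col x u v w
      free′ {col} {x} {u} {v} {w} K@(mono x∈ u∈ v∈ w∈ xu xv xw uv uw vw) =
        go (x FinP.≟ x₀) (u FinP.≟ x₀) (v FinP.≟ x₀) (w FinP.≟ x₀)
        where
        go : Dec (x ≡ x₀) → Dec (u ≡ x₀) → Dec (v ≡ x₀) → Dec (w ≡ x₀) → ⊥
        go (yes refl) _ _ _ = at-x₀ K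
        go (no _) (yes refl) _ _ = at-x₀ (mono u∈ x∈ v∈ w∈ (Coloured-sym xu) uv uw xv xw vw)
        go (no _) (no _) (yes refl) _ = at-x₀ (mono v∈ x∈ u∈ w∈ (Coloured-sym xv) (Coloured-sym uv) vw xu xw uw)
        go (no _) (no _) (no _) (yes refl) = at-x₀ (mono w∈ x∈ u∈ v∈ (Coloured-sym xw) (Coloured-sym uw) (Coloured-sym vw) xu xv uv)
        go (no x≢) (no u≢) (no v≢) (no w≢) = free (mono (member x∈ x≢) (member u∈ u≢) (member v∈ v≢) (member w∈ w≢)
          (old x≢ u≢ xu) (old x≢ v≢ xv) (old x≢ w≢ xw) (old u≢ v≢ uv) (old u≢ w≢ uw) (old v≢ w≢ vw))

-- The complete bipartite graph and its number of edges.

module Bipartite where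
  open Slots
  open import Data.Nat as ℕ using (ℕ; zero; suc; _+_; _*_; _≤_; _<_; ⌊_/2⌋; ⌈_/2⌉)
  open import Data.Nat.Solver using (module +-*-Solver)
  open import Data.Vec as Vec using ()
  open import Data.Vec.Properties using (lookup∘tabulate)

  left : ∀ {n} → Fin n → Bool
  left {n} i = toℕ i ℕ.<ᵇ ⌊ n /2⌋

  -- `ends` is increasing and `left` is an initial segment, so a crossing pair always has its left
  -- vertex first.
  bipartite : ∀ n → Graph n
  bipartite n = Vec.tabulate (λ k → left (proj₁ (ends {n} k)) ∧ not (left (proj₂ (ends {n} k))))

  bipartite-lookup : ∀ {n} k → Vec.lookup (bipartite n) k ≡ left (proj₁ (ends {n} k)) ∧ not (left (proj₂ (ends {n} k)))
  bipartite-lookup {n} = lookup∘tabulate (λ k → left (proj₁ (ends {n} k)) ∧ not (left (proj₂ (ends {n} k))))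

  ⌈n/2⌉≡ : ∀ n → ⌈ n /2⌉ ≡ ⌊ n /2⌋ ⊎ ⌈ n /2⌉ ≡ suc ⌊ n /2⌋
  ⌈n/2⌉≡ zero = inj₁ refl
  ⌈n/2⌉≡ (suc zero) = inj₂ refl
  ⌈n/2⌉≡ (suc (suc n)) with ⌈n/2⌉≡ n
  ... | inj₁ e = inj₁ (cong suc e)
  ... | inj₂ e = inj₂ (cong suc e)

  -- The 1 is for odd n, where the product of the halves is (n² - 1) / 4.
  halves-product : ∀ n → n * n ≤ 4 * (⌊ n /2⌋ * ⌈ n /2⌉) + 1
  halves-product n = subst (λ m → m * m ≤ 4 * (⌊ n /2⌋ * ⌈ n /2⌉) + 1) (ℕP.⌊n/2⌋+⌈n/2⌉≡n n) (go ⌊ n /2⌋ ⌈ n /2⌉ (⌈n/2⌉≡ n))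
    where
    open +-*-Solver
    go : ∀ f g → g ≡ f ⊎ g ≡ suc f → (f + g) * (f + g) ≤ 4 * (f * g) + 1
    go f _ (inj₁ refl) = ℕP.≤-trans (ℕP.≤-reflexive (solve 1 (λ f → (f :+ f) :* (f :+ f) := con 4 :* (f :* f)) refl f)) (ℕP.m≤m+n _ 1)
    go f _ (inj₂ refl) = ℕP.≤-reflexive (solve 1 (λ f → (f :+ (con 1 :+ f)) :* (f :+ (con 1 :+ f)) := con 4 :* (f :* (con 1 :+ f)) :+ con 1) refl f)

  length-cartesianProduct : ∀ {a b} {A : Set a} {B : Set b} (xs : List A) (ys : List B) →
    length (cartesianProduct xs ys) ≡ length xs * length ys
  length-cartesianProduct [] ys = refl
  length-cartesianProduct (x ∷ xs) ys = trans (length-++ (map (x ,_) ys)) (cong₂ _+_ (length-map (x ,_) ys) (length-cartesianProduct xs ys))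

  bipartite-edges : ∀ n → ⌊ n /2⌋ * ⌈ n /2⌉ ≤ numEdges n (bipartite n)
  bipartite-edges n = subst₂ _≤_ size (trans (length-map (ends {n}) (edgeSlots {n} (bipartite n))) (sym (numEdges≡ {n} (bipartite n))))
    (unique-length (Uniq.cartesianProduct⁺ unique-A unique-B) covered)
    where
    h = ⌊ n /2⌋
    g = ⌈ n /2⌉
    h+g≡n = ℕP.⌊n/2⌋+⌈n/2⌉≡n n
    <ˡ : (i : Fin h) → toℕ i < n
    <ˡ i = ℕP.<-≤-trans (FinP.toℕ<n i) (ℕP.≤-trans (ℕP.m≤m+n h g) (ℕP.≤-reflexive h+g≡n))
    <ʳ : (j : Fin g) → h + toℕ j < n
    <ʳ j = ℕP.<-≤-trans (ℕP.+-monoʳ-< h (FinP.toℕ<n j)) (ℕP.≤-reflexive h+g≡n)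
    α : Fin h → Fin n
    α i = fromℕ< (<ˡ i)
    β : Fin g → Fin n
    β j = fromℕ< (<ʳ j)
    As = tabulate α
    Bs = tabulate β
    unique-A : Unique As
    unique-A = Uniq.tabulate⁺ (λ {i} {j} e → FinP.toℕ-injective (FinP.fromℕ<-injective _ _ (<ˡ i) (<ˡ j) e))
    unique-B : Unique Bs
    unique-B = Uniq.tabulate⁺ (λ {i} {j} e → FinP.toℕ-injective (ℕP.+-cancelˡ-≡ h _ _ (FinP.fromℕ<-injective _ _ (<ʳ i) (<ʳ j) e)))
    size : length (cartesianProduct As Bs) ≡ h * g
    size = trans (length-cartesianProduct As Bs) (cong₂ _*_ (length-tabulate α) (length-tabulate β))
    left-α : ∀ i → left (α i) ≡ true
    left-α i = BoolP.T-≡ .Function.Equivalence.to (ℕP.<⇒<ᵇ (subst (_< h) (sym (FinP.toℕ-fromℕ< (<ˡ i))) (FinP.toℕ<n i)))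
      where import Function
    left-β : ∀ j → left (β j) ≡ false
    left-β j = BoolP.¬-not (λ e → ℕP.<⇒≱ (ℕP.<ᵇ⇒< _ _ (BoolP.T-≡ .Function.Equivalence.from e))
      (subst (h ≤_) (sym (FinP.toℕ-fromℕ< (<ʳ j))) (ℕP.m≤m+n h (toℕ j))))
      where import Function
    covered : ∀ {e} → e ∈ cartesianProduct As Bs → e ∈ map (ends {n}) (edgeSlots {n} (bipartite n))
    covered e∈ with ∈-cartesianProduct⁻ As Bs e∈
    ... | x∈ , y∈ with ∈-tabulate⁻ x∈ | ∈-tabulate⁻ y∈
    ...   | i , refl | j , refl with ends-surjective {n} {α i} {β j} α<β
      where
      α<β : α i Fin.< β j
      α<β = subst₂ _<_ (sym (FinP.toℕ-fromℕ< (<ˡ i))) (sym (FinP.toℕ-fromℕ< (<ʳ j))) (ℕP.<-≤-trans (FinP.toℕ<n i) (ℕP.m≤m+n h (toℕ j)))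
    ...     | k , ek = subst (_∈ map (ends {n}) (edgeSlots {n} (bipartite n))) ek
              (∈-map⁺ (ends {n}) (∈-filter⁺ (λ k → Vec.lookup (bipartite n) k BoolP.≟ true) (∈-allFin k) present))
      where
      present : Vec.lookup (bipartite n) k ≡ true
      present = trans (bipartite-lookup {n} k) (trans (cong (λ e → left (proj₁ e) ∧ not (left (proj₂ e))) ek)
        (cong₂ (λ a b → a ∧ not b) (left-α i) (left-β j)))

-- Part (ii): the colouring of the union and its probability.

module PartTwo where
  open Rat
  open Sums
  open Prob
  open Slots
  open Scripts
  open Explore
  open TriColour
  open QuadColour
  open Bipartite
  open import Data.Nat as ℕ using (ℕ; zero; suc; ⌊_/2⌋; ⌈_/2⌉)
  open import Data.Integer using (+_)
  open import Data.Vec as Vec using (Vec)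
  open import Data.Vec.Properties using (lookup-zipWith)
  import Data.Sum
  open import Data.Rational
  open import Data.Rational.Properties
  open import Data.Rational.Solver using (module +-*-Solver)
  open +-*-Solver using (solve; _:+_; _:=_; _:*_; :-_; _:-_; con)

  module Bad {n M : ℕ} (𝒮 : Slotting n M) where
    open Exploring 𝒮
    open Triangles 𝒮 using (TriangleFree; module Colouring)
    open Quads 𝒮 using (Split; partition)

    unique? = DecUnique.unique? (FinP._≟_ {M})

    scripts : List State
    scripts = triScripts ++ quadScripts

    -- The enumeration also produces edge lists with repetitions, whose probability is not
    -- `p ^ℚ length I`. Explorations of an actual graph record distinct edges, so only
    -- duplicate-free lists have to be avoided.
    badSets : List (List (Fin M))
    badSets = filter unique? (map proj₂ scripts)

    badSets-unique : ∀ I → I ∈ badSets → Unique I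
    badSets-unique I I∈ = proj₂ (∈-filter⁻ unique? {xs = map proj₂ scripts} I∈)

    present : Vec Bool M → List (Fin M)
    present ω = filter (λ k → Vec.lookup ω k BoolP.≟ true) (allFin M)

    structure : ∀ ω → none badSets ω ≡ true →
      (∃[ c ] TriangleFree (present ω) c) × Σ (Fin n → Bool) λ σ → Σ (Fin M → Bool) λ c → Split (present ω) (allFin n) σ c
    structure ω good =
      Colouring.colour L (λ s∈ → absent (∈-++⁺ˡ s∈)) (suc (length L)) L (ℕP.n<1+n _) (λ k∈ → k∈) ,
      partition L (λ s∈ → absent (∈-++⁺ʳ triScripts s∈)) (suc (length (allFin n))) (allFin n) (ℕP.n<1+n _)
      where
      L = present ω
      absent : ∀ {s} → s ∈ scripts → Unique (proj₂ s) → ¬ (∀ {k} → k ∈ proj₂ s → k ∈ L)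
      absent {s} s∈ u sub with trans (sym (none⁻ {Is = badSets} good (proj₂ s) (∈-filter⁺ unique? (∈-map⁺ proj₂ s∈) u)))
        (allT⁺ {I = proj₂ s} (λ k k∈ → proj₂ (∈-filter⁻ (λ k → Vec.lookup ω k BoolP.≟ true) {xs = allFin M} (sub k∈))))
      ... | ()

    badSets-weight : ∀ {p} (0≤p : 0ℚ ≤ p) → let ν = ℕtoℚ n * (p * p) in ν * ℕtoℚ 8192 ≤ ½ →
      ∑ badSets (λ I → p ^ℚ length I) ≤ ν * ν * ℕtoℚ 134217728 + ν * ℕtoℚ 589824
    badSets-weight {p} 0≤p ν≤ = begin
      ∑ badSets (λ I → p ^ℚ length I) ≤⟨ ∑-filter unique? (map proj₂ scripts) (λ I → ^-nonneg (length I) 0≤p) ⟩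
      ∑ (map proj₂ scripts) (λ I → p ^ℚ length I) ≡⟨ ∑-map scripts proj₂ ⟩
      ∑ scripts (λ s → p ^ℚ length (proj₂ s)) ≡⟨ ∑-cong scripts (λ s → sym (trans (cong (_* p ^ℚ length (proj₂ s)) (one (length (proj₁ s)))) (*-identityˡ _))) ⟩
      ∑ scripts (φ 1) ≡⟨ ∑-++ triScripts quadScripts ⟩
      ∑ triScripts (φ 1) + ∑ quadScripts (φ 1) ≤⟨ +-mono-≤ triScripts-weight quadScripts-weight ⟩
      _ ∎
      where
      open ≤-Reasoning
      open Weight 0≤p
      open Sparse ν≤
      one : ∀ k → ℕtoℚ 1 ^ℚ k ≡ 1ℚ
      one zero = refl
      one (suc k) = trans (*-identityˡ _) (one k)

  module TwoSided {n M : ℕ} (𝒮 : Slotting n M) (ω : Vec Bool M) (good : none (Bad.badSets 𝒮) ω ≡ true)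
    (left : Fin n → Bool) (left-down : ∀ {x y} → x Fin.< y → left y ≡ true → left x ≡ true)
    (_∼_ : Fin n → Fin n → Set)
    (random : ∀ {x y} → x ∼ y → left x ∧ not (left y) ≡ false → ∃[ k ] (k ∈ Bad.present 𝒮 ω × Slotting.Joins 𝒮 k x y)) where
    open Triangles 𝒮 using (TriangleFree; Coloured; pairColour; pairColour-joins)
    structured = Bad.structure 𝒮 ω good
    L = Bad.present 𝒮 ω
    cₗ = proj₁ (proj₁ structured)
    triangleFree = proj₂ (proj₁ structured)
    σ = proj₁ (proj₂ structured)
    cᵣ = proj₁ (proj₂ (proj₂ structured))
    open Quads.Split (proj₂ (proj₂ (proj₂ structured)))

    χ′ : Bool → Bool → Fin n → Fin n → Bool
    χ′ true true x y = pairColour cₗ x y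
    χ′ true false x y = not (σ y)
    χ′ false true x y = not (σ x)
    χ′ false false x y = pairColour cᵣ x y

    χ : Fin n → Fin n → Bool
    χ x y = χ′ (left x) (left y) x y

    leftEdge : ∀ {x y col} → left x ≡ true → left y ≡ true → x ∼ y → χ x y ≡ col → Coloured L cₗ col x y
    leftEdge {x} {y} lx ly e eq with random e (cong₂ (λ a b → a ∧ not b) lx ly)
    ... | k , k∈ , j = k , k∈ , j , trans (sym (pairColour-joins cₗ j)) (trans (sym (cong₂ (λ a b → χ′ a b x y) lx ly)) eq)

    rightEdge : ∀ {x y col} → left x ≡ false → left y ≡ false → x ∼ y → χ x y ≡ col → Coloured L cᵣ col x y
    rightEdge {x} {y} lx ly e eq with random e (cong₂ (λ a b → a ∧ not b) lx ly)
    ... | k , k∈ , j = k , k∈ , j , trans (sym (pairColour-joins cᵣ j)) (trans (sym (cong₂ (λ a b → χ′ a b x y) lx ly)) eq)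

    cross : ∀ {x y col} → left x ≡ true → left y ≡ false → χ x y ≡ col → σ y ≡ not col
    cross {x} {y} lx ly eq = trans (sym (BoolP.not-involutive (σ y)))
      (cong not (trans (sym (cong₂ (λ a b → χ′ a b x y) lx ly)) eq))

    -- Equal colours of the cross edges at `x` put `y` and `z` into the same half, whose inner edges
    -- have the opposite colour.
    cherry : ∀ {x y z col} → left x ≡ true → left y ≡ false → left z ≡ false →
      χ x y ≡ col → χ x z ≡ col → y ∼ z → χ y z ≡ col → ⊥
    cherry {x} {y} {z} lx ly lz exy exz e eq with rightEdge ly lz e eq
    ... | k , k∈ , j , ek = BoolP.not-¬ refl (trans (sym ek)
          (trans (inner (∈-allFin y) (∈-allFin z) k∈ j (trans (cross {x} lx ly exy) (sym (cross {x} lx lz exz)))) (cross {x} lx ly exy)))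

    -- In increasing order the left vertices come first. At least three of them give a triangle on
    -- the left, one or two give a `cherry`, and none gives a K4 on the right.
    noMonoK4 : ∀ {a b c d col} → a Fin.< b → b Fin.< c → c Fin.< d →
      a ∼ b × a ∼ c × a ∼ d × b ∼ c × b ∼ d × c ∼ d →
      ¬ (χ a b ≡ col × χ a c ≡ col × χ a d ≡ col × χ b c ≡ col × χ b d ≡ col × χ c d ≡ col)
    noMonoK4 {a} {b} {c} {d} {col} a<b b<c c<d (ab , ac , ad , bc , bd , cd) (eab , eac , ead , ebc , ebd , ecd) =
      cases (left a) (left b) (left c) (left d) refl refl refl refl
      where
      cases : ∀ p q r s → left a ≡ p → left b ≡ q → left c ≡ r → left d ≡ s → ⊥
      cases true true true _ la lb lc ld =
        triangleFree a b c col (leftEdge la lb ab eab) (leftEdge la lc ac eac) (leftEdge lb lc bc ebc)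
      cases true _ false false la lb lc ld = cherry la lc ld eac ead cd ecd
      cases false false false false la lb lc ld = free {col} {a} {b} {c} {d}
        (Quads.mono (∈-allFin a) (∈-allFin b) (∈-allFin c) (∈-allFin d) (rightEdge la lb ab eab) (rightEdge la lc ac eac)
          (rightEdge la ld ad ead) (rightEdge lb lc bc ebc) (rightEdge lb ld bd ebd) (rightEdge lc ld cd ecd))
      cases _ false true _ la lb lc ld with trans (sym lb) (left-down b<c lc)
      ... | ()
      cases false true _ _ la lb lc ld with trans (sym la) (left-down a<b lb)
      ... | ()
      cases _ _ false true la lb lc ld with trans (sym lc) (left-down c<d ld)
      ... | ()

  left-down : ∀ {n} {x y : Fin n} → x Fin.< y → left y ≡ true → left x ≡ true
  left-down {n} {x} {y} x<y ly = BoolP.T-≡ .Function.Equivalence.to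
    (ℕP.<⇒<ᵇ (ℕP.<-trans x<y (ℕP.<ᵇ⇒< (toℕ y) ⌊ n /2⌋ (BoolP.T-≡ .Function.Equivalence.from ly))))
    where import Function

  randomEdge : ∀ {n} {ω : Graph n} {x y} → Edge (union n (bipartite n) ω) x y → left x ∧ not (left y) ≡ false →
    ∃[ k ] (k ∈ Bad.present (pairSlotting {n}) ω × Ends {n} k x y)
  randomEdge {n} {ω} {x} {y} (k , e , t) same =
    k , ∈-filter⁺ (λ k → Vec.lookup ω k BoolP.≟ true) (∈-allFin k) present , fwd e
    where
    absent : Vec.lookup (bipartite n) k ≡ false
    absent = trans (bipartite-lookup {n} k) (trans (cong (λ e → left (proj₁ e) ∧ not (left (proj₂ e))) e) same)
    present : Vec.lookup ω k ≡ true
    present = trans (cong (_∨ Vec.lookup ω k) (sym absent)) (trans (sym (lookup-zipWith _∨_ k (bipartite n) ω)) t)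

  notArrows : ∀ n ω → none (Bad.badSets (pairSlotting {n})) ω ≡ true → ¬ ArrowsK4 n (union n (bipartite n) ω)
  notArrows n ω good arrows =
    let a , b , c , d , col , a<b , b<c , c<d , edges , colours = arrows χ in noMonoK4 a<b b<c c<d edges colours
    where open TwoSided (pairSlotting {n}) ω good left (left-down {n}) (Edge (union n (bipartite n) ω)) randomEdge

  partTwo-edges : ∀ {γ} → γ < + 1 / 4 → ∃[ n₀ ] (∀ n → n₀ ℕ.≤ n → γ * (ℕtoℚ n ^ℚ 2) ≤ ℕtoℚ (numEdges n (bipartite n)))
  -- `m` is chosen with m (¼ - γ) ≥ 1, so that (¼ - γ) n² outweighs the ¼ lost for odd n; the
  -- successor ensures n ≥ 1.
  partTwo-edges {γ} γ<¼ = suc m , enough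
    where
    open ≤-Reasoning
    ¼ = + 1 / 4
    gap : 0ℚ < ¼ - γ
    gap = subst (_< ¼ - γ) (+-inverseʳ γ) (+-monoˡ-< (- γ) γ<¼)
    m = proj₁ (archimedean gap)
    1≤ = proj₂ (archimedean gap)
    enough : ∀ n → suc m ℕ.≤ n → γ * (ℕtoℚ n ^ℚ 2) ≤ ℕtoℚ (numEdges n (bipartite n))
    enough n m<n = ≤-trans bound (ℕtoℚ-mono (bipartite-edges n))
      where
      ν = ℕtoℚ n
      P = ⌊ n /2⌋ ℕ.* ⌈ n /2⌉
      γ≤¼ : γ ≤ ¼
      γ≤¼ = <⇒≤ γ<¼
      1≤ν : 1ℚ ≤ ν
      1≤ν = ℕtoℚ-mono {1} {n} (ℕP.≤-trans (ℕ.s≤s ℕ.z≤n) m<n)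
      one≤ : 1ℚ ≤ (¼ - γ) * (ν * ν)
      one≤ = begin
        1ℚ ≤⟨ 1≤ ⟩
        ℕtoℚ m * (¼ - γ) ≤⟨ *-monoʳ (0≤sub γ≤¼) (ℕtoℚ-mono (ℕP.≤-trans (ℕP.n≤1+n m) m<n)) ⟩
        ν * (¼ - γ) ≡⟨ trans (*-comm ν (¼ - γ)) (cong ((¼ - γ) *_) (sym (*-identityʳ ν))) ⟩
        (¼ - γ) * (ν * 1ℚ) ≤⟨ *-monoˡ (0≤sub γ≤¼) (*-monoˡ (0≤ℕ n) 1≤ν) ⟩
        (¼ - γ) * (ν * ν) ∎
      square≤ : ν * ν ≤ ℕtoℚ 4 * ℕtoℚ P + 1ℚ
      square≤ = begin
        ν * ν ≡⟨ sym (ℕtoℚ-* n n) ⟩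
        ℕtoℚ (n ℕ.* n) ≤⟨ ℕtoℚ-mono (halves-product n) ⟩
        ℕtoℚ (4 ℕ.* P ℕ.+ 1) ≡⟨ trans (ℕtoℚ-+ (4 ℕ.* P) 1) (cong (_+ 1ℚ) (ℕtoℚ-* 4 P)) ⟩
        ℕtoℚ 4 * ℕtoℚ P + 1ℚ ∎
      bound : γ * (ν ^ℚ 2) ≤ ℕtoℚ P
      bound = begin
        γ * (ν * (ν * 1ℚ)) ≡⟨ solve 2 (λ γ ν → γ :* (ν :* (ν :* con 1ℚ)) := con ¼ :* (ν :* ν) :- (con ¼ :- γ) :* (ν :* ν)) refl γ ν ⟩
        ¼ * (ν * ν) - (¼ - γ) * (ν * ν) ≤⟨ sub-mono (*-monoˡ {¼} (nonNegative⁻¹ ¼) square≤) one≤ ⟩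
        ¼ * (ℕtoℚ 4 * ℕtoℚ P + 1ℚ) - 1ℚ ≡⟨ solve 1 (λ x → con ¼ :* (con (ℕtoℚ 4) :* x :+ con 1ℚ) :- con 1ℚ := x :- con (1ℚ - ¼)) refl (ℕtoℚ P) ⟩
        ℕtoℚ P - (1ℚ - ¼) ≤⟨ sub≤self {ℕtoℚ P} {1ℚ - ¼} (nonNegative⁻¹ (1ℚ - ¼)) ⟩
        ℕtoℚ P ∎

  partTwo-random : (p : ℕ → ℚ) → IsProb p →
    ((η : ℚ) → 0ℚ < η → ∃[ n₀ ] ((n : ℕ) → n₀ ℕ.≤ n → (p n ^ℚ 2) * ℕtoℚ n ≤ η)) →
    (δ : ℚ) → 0ℚ < δ →
    ∃[ n₀ ] ((n : ℕ) → n₀ ℕ.≤ n → PrAtLeast n (p n) (λ H → ¬ ArrowsK4 n (union n (bipartite n) H)) (1ℚ - δ))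
  partTwo-random p prob small δ 0<δ =
    proj₁ (small η 0<η) , λ n n≥ → prAtLeast {n} {p n} {1ℚ - δ} (none {N n} (badSets n)) (notArrows n) (likely n (proj₂ (small η 0<η) n n≥))
    where
    0<δ/C : 0ℚ < δ * (+ 1 / 134807552)
    0<δ/C = positive⁻¹ _ {{pos*pos⇒pos δ {{positive 0<δ}} (+ 1 / 134807552)}}
    -- The first bound gives 8192 ν ≤ ½. In the second, 134807552 is the sum of the constants of the
    -- triangle and K4 scripts, where ν² is bounded by ν.
    η = (+ 1 / 16384) ⊓ (δ * (+ 1 / 134807552))
    0<η : 0ℚ < η
    0<η = Data.Sum.[ (λ e → subst (0ℚ <_) (sym e) (positive⁻¹ (+ 1 / 16384))) , (λ e → subst (0ℚ <_) (sym e) 0<δ/C) ]′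
      (⊓-sel (+ 1 / 16384) (δ * (+ 1 / 134807552)))
    open ≤-Reasoning
    badSets : ∀ n → List (List (Fin (N n)))
    badSets n = Bad.badSets (pairSlotting {n})
    likely : ∀ n → (p n ^ℚ 2) * ℕtoℚ n ≤ (+ 1 / 16384) ⊓ (δ * (+ 1 / 134807552)) →
      1ℚ - δ ≤ E (p n) (ind ∘ none (badSets n))
    likely n h = ≤-trans (sub-mono {1ℚ} ≤-refl total)
      (none-union (proj₁ (prob n)) (proj₂ (prob n)) (badSets n) (Bad.badSets-unique (pairSlotting {n})))
      where
      ν = ℕtoℚ n * (p n * p n)
      δ/C = δ * (+ 1 / 134807552)
      0≤ν : 0ℚ ≤ ν
      0≤ν = 0≤* (0≤ℕ n) (0≤* (proj₁ (prob n)) (proj₁ (prob n)))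
      h′ : ν ≤ (+ 1 / 16384) ⊓ (δ * (+ 1 / 134807552))
      h′ = ≤-trans (≤-reflexive (solve 2 (λ n p → n :* (p :* p) := (p :* (p :* con 1ℚ)) :* n) refl (ℕtoℚ n) (p n))) h
      ν≤ : ν ≤ + 1 / 16384
      ν≤ = ≤-trans h′ (p⊓q≤p (+ 1 / 16384) δ/C)
      ν≤1 : ν ≤ 1ℚ
      ν≤1 = ≤-trans ν≤ (≤ᵇ⇒≤ _)
      total : ∑ (badSets n) (λ I → p n ^ℚ length I) ≤ δ
      total = begin
        ∑ (badSets n) (λ I → p n ^ℚ length I) ≤⟨ Bad.badSets-weight (pairSlotting {n}) (proj₁ (prob n)) (*-monoʳ (0≤ℕ 8192) ν≤) ⟩
        ν * ν * ℕtoℚ 134217728 + ν * ℕtoℚ 589824 ≤⟨ +-monoˡ-≤ _ (*-monoʳ (0≤ℕ 134217728) (*-mono 0≤1 0≤ν ν≤1 ≤-refl)) ⟩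
        1ℚ * ν * ℕtoℚ 134217728 + ν * ℕtoℚ 589824
          ≡⟨ solve 1 (λ v → con 1ℚ :* v :* con (ℕtoℚ 134217728) :+ v :* con (ℕtoℚ 589824) := v :* con (ℕtoℚ 134807552)) refl ν ⟩
        ν * ℕtoℚ 134807552 ≤⟨ *-monoʳ {ℕtoℚ 134807552} {ν} {δ/C} (0≤ℕ 134807552) (≤-trans h′ (p⊓q≤q (+ 1 / 16384) δ/C)) ⟩
        δ * (+ 1 / 134807552) * ℕtoℚ 134807552 ≡⟨ solve 1 (λ d → d :* con (+ 1 / 134807552) :* con (ℕtoℚ 134807552) := d) refl δ ⟩
        δ ∎

-- Dependent random choice.

module DRC where
  open import Defs using (bit)
  open Explore using (Σℕ)
  open import Data.Nat as ℕ using (ℕ; zero; suc; _+_; _*_; _^_; _≤_; _<_; z≤n; s≤s; NonZero)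
  open import Data.Nat.Solver using (module +-*-Solver)

  -- Vertex sets are sublists of `allFin n`, a list of 2^n entries over which a union bound can run.
  subs : ∀ {a} {A : Set a} → List A → List (List A)
  subs [] = [] ∷ []
  subs (x ∷ xs) = map (x ∷_) (subs xs) ++ subs xs

  subs-self : ∀ {a} {A : Set a} (xs : List A) → xs ∈ subs xs
  subs-self [] = here refl
  subs-self (x ∷ xs) = ∈-++⁺ˡ (∈-map⁺ (x ∷_) (subs-self xs))

  subs-filter : ∀ {a} {A : Set a} (f : A → Bool) {ys} (xs : List A) → ys ∈ subs xs → filterᵇ f ys ∈ subs xs
  subs-filter f [] (here refl) = here refl
  subs-filter f (x ∷ xs) ys∈ with ∈-++⁻ (map (x ∷_) (subs xs)) ys∈
  ... | inj₂ h = ∈-++⁺ʳ (map (x ∷_) (subs xs)) (subs-filter f xs h)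
  ... | inj₁ h with ∈-map⁻ (x ∷_) h
  ...   | zs , zs∈ , refl with f x
  ...     | true = ∈-++⁺ˡ (∈-map⁺ (x ∷_) (subs-filter f xs zs∈))
  ...     | false = ∈-++⁺ʳ (map (x ∷_) (subs xs)) (subs-filter f xs zs∈)

  ∈-filterᵇ⁻ : ∀ {a} {A : Set a} (f : A → Bool) {x} xs → x ∈ filterᵇ f xs → x ∈ xs × f x ≡ true
  ∈-filterᵇ⁻ f (y ∷ ys) x∈ with f y in e
  ∈-filterᵇ⁻ f (y ∷ ys) (here refl) | true = here refl , e
  ∈-filterᵇ⁻ f (y ∷ ys) (there x∈) | true = let h , k = ∈-filterᵇ⁻ f ys x∈ in there h , k
  ∈-filterᵇ⁻ f (y ∷ ys) x∈ | false = let h , k = ∈-filterᵇ⁻ f ys x∈ in there h , k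

  module _ {a} {A : Set a} where

    Σℕ-cong : ∀ (xs : List A) {f g : A → ℕ} → (∀ x → f x ≡ g x) → Σℕ xs f ≡ Σℕ xs g
    Σℕ-cong [] h = refl
    Σℕ-cong (x ∷ xs) h = cong₂ _+_ (h x) (Σℕ-cong xs h)

    Σℕ-mono : ∀ (xs : List A) {f g : A → ℕ} → (∀ x → x ∈ xs → f x ≤ g x) → Σℕ xs f ≤ Σℕ xs g
    Σℕ-mono [] h = z≤n
    Σℕ-mono (x ∷ xs) h = ℕP.+-mono-≤ (h x (here refl)) (Σℕ-mono xs (λ y y∈ → h y (there y∈)))

    Σℕ-+ : ∀ (xs : List A) {f g : A → ℕ} → Σℕ xs (λ x → f x + g x) ≡ Σℕ xs f + Σℕ xs g
    Σℕ-+ [] = refl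
    Σℕ-+ (x ∷ xs) {f} {g} = trans (cong (f x + g x +_) (Σℕ-+ xs))
      (solve 4 (λ a b c d → (a :+ b) :+ (c :+ d) := (a :+ c) :+ (b :+ d)) refl (f x) (g x) (Σℕ xs f) (Σℕ xs g))
      where open +-*-Solver

    Σℕ-*ˡ : ∀ (xs : List A) c {f : A → ℕ} → Σℕ xs (λ x → c * f x) ≡ c * Σℕ xs f
    Σℕ-*ˡ [] c = sym (ℕP.*-zeroʳ c)
    Σℕ-*ˡ (x ∷ xs) c {f} = trans (cong (c * f x +_) (Σℕ-*ˡ xs c)) (sym (ℕP.*-distribˡ-+ c (f x) _))

    Σℕ-const : ∀ (xs : List A) c → Σℕ xs (λ _ → c) ≡ length xs * c
    Σℕ-const [] c = refl
    Σℕ-const (x ∷ xs) c = cong (c +_) (Σℕ-const xs c)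

    Σℕ-swap : ∀ {b} {B : Set b} (xs : List A) (ys : List B) {f : A → B → ℕ} →
      Σℕ xs (λ x → Σℕ ys (f x)) ≡ Σℕ ys (λ y → Σℕ xs (λ x → f x y))
    Σℕ-swap [] ys = sym (trans (Σℕ-zero ys) refl)
      where
      Σℕ-zero : ∀ {b} {B : Set b} (ys : List B) → Σℕ ys (λ _ → 0) ≡ 0
      Σℕ-zero [] = refl
      Σℕ-zero (_ ∷ ys) = Σℕ-zero ys
    Σℕ-swap (x ∷ xs) ys {f} = trans (cong (Σℕ ys (f x) +_) (Σℕ-swap xs ys)) (sym (Σℕ-+′ ys))
      where
      Σℕ-+′ : ∀ ys → Σℕ ys (λ y → f x y + Σℕ xs (λ x → f x y)) ≡ Σℕ ys (f x) + Σℕ ys (λ y → Σℕ xs (λ x → f x y))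
      Σℕ-+′ [] = refl
      Σℕ-+′ (y ∷ ys) = trans (cong (f x y + Σℕ xs (λ x → f x y) +_) (Σℕ-+′ ys))
        (solve 4 (λ a b c d → (a :+ b) :+ (c :+ d) := (a :+ c) :+ (b :+ d)) refl (f x y) (Σℕ xs (λ x → f x y)) (Σℕ ys (f x)) _)
        where open +-*-Solver

    Σℕ-filterᵇ : ∀ (f : A → Bool) (xs : List A) {h : A → ℕ} → Σℕ (filterᵇ f xs) h ≡ Σℕ xs (λ x → bit (f x) * h x)
    Σℕ-filterᵇ f [] = refl
    Σℕ-filterᵇ f (x ∷ xs) {h} with f x
    ... | true = cong₂ _+_ (sym (ℕP.*-identityˡ (h x))) (Σℕ-filterᵇ f xs)
    ... | false = Σℕ-filterᵇ f xs

    length-filterᵇ : ∀ (f : A → Bool) (xs : List A) → length (filterᵇ f xs) ≡ Σℕ xs (bit ∘ f)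
    length-filterᵇ f [] = refl
    length-filterᵇ f (x ∷ xs) with f x
    ... | true = cong suc (length-filterᵇ f xs)
    ... | false = length-filterᵇ f xs

    Σℕ-pigeonhole : ∀ (xs : List A) {f g : A → ℕ} → 0 < length xs → Σℕ xs f ≤ Σℕ xs g → ∃[ x ] f x ≤ g x
    Σℕ-pigeonhole (x ∷ xs) {f} {g} _ h with f x ℕP.≤? g x
    ... | yes le = x , le
    Σℕ-pigeonhole (x ∷ []) {f} {g} _ h | no ¬le = ⊥-elim (¬le (subst₂ _≤_ (ℕP.+-identityʳ (f x)) (ℕP.+-identityʳ (g x)) h))
    Σℕ-pigeonhole (x ∷ xs@(_ ∷ _)) {f} {g} _ h | no ¬le = Σℕ-pigeonhole xs (s≤s z≤n)
      (ℕP.+-cancelˡ-≤ (g x) _ _ (ℕP.≤-trans (ℕP.+-monoˡ-≤ (Σℕ xs f) (ℕP.<⇒≤ (ℕP.≰⇒> ¬le))) h))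

  -- Dependent random choice, one neighbourhood at a time: averaging over x, some S ∩ N(x) keeps the inequality
  -- between weighted bad pairs and size although the weight of a bad pair has grown by the factor r.
  module Choice {n : ℕ} (g b : Fin n → Fin n → Bool) where

    degree : Fin n → ℕ
    degree u = Σℕ (allFin n) (λ x → bit (g x u))

    codegree : Fin n → Fin n → ℕ
    codegree u v = Σℕ (allFin n) (λ x → bit (g x u) * bit (g x v))

    bads : List (Fin n) → ℕ
    bads S = Σℕ S (λ u → Σℕ S (λ v → bit (b u v)))

    total-size : ∀ S → Σℕ (allFin n) (λ x → length (filterᵇ (g x) S)) ≡ Σℕ S degree
    total-size S = trans (Σℕ-cong (allFin n) (λ x → length-filterᵇ (g x) S)) (Σℕ-swap (allFin n) S)

    total-bads : ∀ {c} → (∀ u v → b u v ≡ true → codegree u v ≤ c) → ∀ S →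
      Σℕ (allFin n) (λ x → bads (filterᵇ (g x) S)) ≤ c * bads S
    total-bads {c} h S = begin
      Σℕ V (λ x → bads (filterᵇ (g x) S)) ≡⟨ Σℕ-cong V expand ⟩
      Σℕ V (λ x → Σℕ S (λ u → Σℕ S (λ v → bit (g x u) * (bit (g x v) * bit (b u v))))) ≡⟨ Σℕ-swap V S ⟩
      Σℕ S (λ u → Σℕ V (λ x → Σℕ S (λ v → bit (g x u) * (bit (g x v) * bit (b u v))))) ≡⟨ Σℕ-cong S (λ u → Σℕ-swap V S) ⟩
      Σℕ S (λ u → Σℕ S (λ v → Σℕ V (λ x → bit (g x u) * (bit (g x v) * bit (b u v))))) ≤⟨ Σℕ-mono S (λ u _ → Σℕ-mono S (λ v _ → bound u v)) ⟩
      Σℕ S (λ u → Σℕ S (λ v → c * bit (b u v))) ≡⟨ Σℕ-cong S (λ u → Σℕ-*ˡ S c) ⟩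
      Σℕ S (λ u → c * Σℕ S (λ v → bit (b u v))) ≡⟨ Σℕ-*ˡ S c ⟩
      c * bads S ∎
      where
      open ℕP.≤-Reasoning
      V = allFin n
      expand : ∀ x → bads (filterᵇ (g x) S) ≡ Σℕ S (λ u → Σℕ S (λ v → bit (g x u) * (bit (g x v) * bit (b u v))))
      expand x = trans (Σℕ-filterᵇ (g x) S) (Σℕ-cong S (λ u → trans (cong (bit (g x u) *_) (Σℕ-filterᵇ (g x) S)) (sym (Σℕ-*ˡ S (bit (g x u))))))
      bound : ∀ u v → Σℕ V (λ x → bit (g x u) * (bit (g x v) * bit (b u v))) ≤ c * bit (b u v)
      bound u v with b u v in e
      ... | true = subst₂ _≤_ (Σℕ-cong V (λ x → cong (bit (g x u) *_) (sym (ℕP.*-identityʳ (bit (g x v)))))) (sym (ℕP.*-identityʳ c)) (h u v e)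
      ... | false = ℕP.≤-trans (ℕP.≤-reflexive (trans (Σℕ-cong V (λ x → trans (cong (bit (g x u) *_) (ℕP.*-zeroʳ (bit (g x v)))) (ℕP.*-zeroʳ (bit (g x u))))) (Σℕ-const V 0)))
            (ℕP.≤-trans (ℕP.≤-reflexive (ℕP.*-zeroʳ (length V))) z≤n)

    module _ {B c r : ℕ} (0<n : 0 < n) {{_ : NonZero B}} (cBr≤n : c * B * r ≤ n)
      (few : ∀ u v → b u v ≡ true → codegree u v ≤ c) where

      -- A bad pair survives in at most `c` of the n sets, a vertex of `S` in at least n / B of
      -- them. By c B r ≤ n, the average size drops by a factor of at most B and the average number
      -- of bad pairs by at least B r.
      step : ∀ α β Z S → (∀ u → u ∈ S → n ≤ B * degree u) → β * bads S + α * (Z * B) ≤ α * length S →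
        ∃[ x ] r * β * bads (filterᵇ (g x) S) + α * Z ≤ α * length (filterᵇ (g x) S)
      step α β Z S dense inv = Σℕ-pigeonhole V (subst (0 <_) (sym |V|) 0<n) (ℕP.*-cancelˡ-≤ B averaged)
        where
        open ℕP.≤-Reasoning
        open +-*-Solver
        V = allFin n
        |V| : length V ≡ n
        |V| = length-tabulate {n = n} (λ i → i)
        Σbad = Σℕ V (λ x → bads (filterᵇ (g x) S))
        averaged : B * Σℕ V (λ x → r * β * bads (filterᵇ (g x) S) + α * Z) ≤ B * Σℕ V (λ x → α * length (filterᵇ (g x) S))
        averaged = begin
          B * Σℕ V (λ x → r * β * bads (filterᵇ (g x) S) + α * Z)
            ≡⟨ cong (B *_) (trans (Σℕ-+ V) (cong₂ _+_ (Σℕ-*ˡ V (r * β)) (trans (Σℕ-const V (α * Z)) (cong (_* (α * Z)) |V|)))) ⟩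
          B * (r * β * Σbad + n * (α * Z)) ≤⟨ ℕP.*-monoʳ-≤ B (ℕP.+-monoˡ-≤ _ (ℕP.*-monoʳ-≤ (r * β) (total-bads few S))) ⟩
          B * (r * β * (c * bads S) + n * (α * Z))
            ≡⟨ solve 8 (λ B r β c x n α Z → B :* (r :* β :* (c :* x) :+ n :* (α :* Z)) := c :* B :* r :* (β :* x) :+ n :* (α :* (Z :* B))) refl B r β c (bads S) n α Z ⟩
          c * B * r * (β * bads S) + n * (α * (Z * B)) ≤⟨ ℕP.+-monoˡ-≤ _ (ℕP.*-monoˡ-≤ (β * bads S) cBr≤n) ⟩
          n * (β * bads S) + n * (α * (Z * B)) ≡⟨ sym (ℕP.*-distribˡ-+ n (β * bads S) _) ⟩
          n * (β * bads S + α * (Z * B)) ≤⟨ ℕP.*-monoʳ-≤ n inv ⟩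
          n * (α * length S) ≡⟨ solve 3 (λ n α s → n :* (α :* s) := α :* (s :* n)) refl n α (length S) ⟩
          α * (length S * n) ≡⟨ cong (α *_) (sym (Σℕ-const S n)) ⟩
          α * Σℕ S (λ _ → n) ≤⟨ ℕP.*-monoʳ-≤ α (Σℕ-mono S dense) ⟩
          α * Σℕ S (λ u → B * degree u) ≡⟨ cong (α *_) (Σℕ-*ˡ S B) ⟩
          α * (B * Σℕ S degree) ≡⟨ solve 3 (λ a b c → a :* (b :* c) := b :* (a :* c)) refl α B (Σℕ S degree) ⟩
          B * (α * Σℕ S degree) ≡⟨ cong (λ t → B * (α * t)) (sym (total-size S)) ⟩
          B * (α * Σℕ V (λ x → length (filterᵇ (g x) S))) ≡⟨ cong (B *_) (sym (Σℕ-*ˡ V α)) ⟩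
          B * Σℕ V (λ x → α * length (filterᵇ (g x) S)) ∎

      steps : ∀ k α β Z S → S ∈ subs (allFin n) → (∀ u → u ∈ S → n ≤ B * degree u) → β * bads S + α * (Z * B ^ k) ≤ α * length S →
        ∃[ S′ ] (S′ ∈ subs (allFin n) × r ^ k * β * bads S′ + α * Z ≤ α * length S′)
      steps zero α β Z S S∈ dense inv = S , S∈ , subst₂ (λ x y → x * bads S + α * y ≤ α * length S) (sym (ℕP.*-identityˡ β)) (ℕP.*-identityʳ Z) inv
      steps (suc k) α β Z S S∈ dense inv =
        let x , inv′ = step α β (Z * B ^ k) S dense (subst (λ z → β * bads S + α * z ≤ α * length S) (reassoc Z B (B ^ k)) inv)
            S′ , S′∈ , fin = steps k α (r * β) Z (filterᵇ (g x) S) (subs-filter (g x) (allFin n) S∈)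
              (λ u u∈ → dense u (proj₁ (∈-filterᵇ⁻ (g x) S u∈))) inv′
        in S′ , S′∈ , subst (λ z → z * bads S′ + α * Z ≤ α * length S′) (regroup (r ^ k) r β) fin
        where
        open +-*-Solver
        reassoc : ∀ z b c → z * (b * c) ≡ z * c * b
        reassoc = solve 3 (λ z b c → z :* (b :* c) := z :* c :* b) refl
        regroup : ∀ a r β → a * (r * β) ≡ r * a * β
        regroup = solve 3 (λ a r β → a :* (r :* β) := r :* a :* β) refl

    bads≤ : ∀ S → bads S ≤ length S * length S
    bads≤ S = subst (bads S ≤_) (trans (Σℕ-const S _) (cong (length S *_) (trans (Σℕ-const S 1) (ℕP.*-identityʳ _))))
      (Σℕ-mono S (λ u _ → Σℕ-mono S (λ v _ → bit≤1 (b u v))))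
      where
      bit≤1 : ∀ b → bit b ≤ 1
      bit≤1 true = s≤s z≤n
      bit≤1 false = z≤n

    bads>0 : ∀ {S u v} → u ∈ S → v ∈ S → b u v ≡ true → 0 < bads S
    bads>0 {S} {u} {v} u∈ v∈ e = ℕP.≤-trans (ℕP.≤-trans (ℕP.≤-reflexive (cong bit (sym e))) (member v∈ (λ v → bit (b u v)))) (member u∈ (λ u → Σℕ S (λ v → bit (b u v))))
      where
      member : ∀ {x} {xs : List (Fin n)} → x ∈ xs → ∀ f → f x ≤ Σℕ xs f
      member (here refl) f = ℕP.m≤m+n _ _
      member {xs = y ∷ _} (there h) f = ℕP.≤-trans (member h f) (ℕP.m≤n+m _ (f y))

  subs-length : ∀ {a} {A : Set a} {ys} (xs : List A) → ys ∈ subs xs → length ys ≤ length xs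
  subs-length [] (here refl) = z≤n
  subs-length (x ∷ xs) ys∈ with ∈-++⁻ (map (x ∷_) (subs xs)) ys∈
  ... | inj₂ h = ℕP.m≤n⇒m≤1+n (subs-length xs h)
  ... | inj₁ h with ∈-map⁻ (x ∷_) h
  ...   | zs , zs∈ , refl = s≤s (subs-length xs zs∈)

  module Dense {n : ℕ} (g b : Fin n → Fin n → Bool) where
    open Choice g b

    module _ {B c r k Z : ℕ} (0<n : 0 < n) {{B≢0 : NonZero B}} (cBr≤n : c * B * r ≤ n)
      (few : ∀ u v → b u v ≡ true → codegree u v ≤ c)
      (manyEdges : 2 * (n * n) ≤ B * Σℕ (allFin n) degree)
      (large : 2 * B * (n * n) < r ^ k) (Z-small : 2 * B * (Z * B ^ k) ≤ n) where

      V U : List (Fin n)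
      V = allFin n
      high : Fin n → Bool
      high u = n ℕ.≤ᵇ B * degree u
      U = filterᵇ high V

      |V| : length V ≡ n
      |V| = length-tabulate {n = n} (λ i → i)

      U-dense : ∀ u → u ∈ U → n ≤ B * degree u
      U-dense u u∈ = ℕP.≤ᵇ⇒≤ n (B * degree u) (subst T (sym (proj₂ (∈-filterᵇ⁻ high V u∈))) _)

      degree≤n : ∀ u → degree u ≤ n
      degree≤n u = subst (degree u ≤_) (trans (Σℕ-const V 1) (trans (ℕP.*-identityʳ _) |V|)) (Σℕ-mono V (λ x _ → bit≤1 (g x u)))
        where
        bit≤1 : ∀ b → bit b ≤ 1
        bit≤1 true = s≤s z≤n
        bit≤1 false = z≤n

      -- Vertices outside `U` contribute at most n each to the left-hand sum of B times the degrees,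
      -- which is at least 2 n²; so at least n² comes from `U`, where each vertex contributes at
      -- most B n.
      U-large : n ≤ B * length U
      U-large = ℕP.*-cancelˡ-≤ n {{ℕ.>-nonZero 0<n}} (ℕP.+-cancelʳ-≤ (n * n) _ _ (begin
        n * n + n * n ≡⟨ solve 1 (λ n → n :* n :+ n :* n := con 2 :* (n :* n)) refl n ⟩
        2 * (n * n) ≤⟨ manyEdges ⟩
        B * Σℕ V degree ≡⟨ sym (Σℕ-*ˡ V B) ⟩
        Σℕ V (λ u → B * degree u) ≤⟨ Σℕ-mono V (λ u _ → pointwise u) ⟩
        Σℕ V (λ u → B * n * bit (high u) + n) ≡⟨ trans (Σℕ-+ V) (cong₂ _+_ (trans (Σℕ-*ˡ V (B * n)) (cong (B * n *_) (sym (length-filterᵇ high V)))) (trans (Σℕ-const V n) (cong (_* n) |V|))) ⟩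
        B * n * length U + n * n ≡⟨ cong (_+ n * n) (solve 3 (λ B n u → B :* n :* u := n :* (B :* u)) refl B n (length U)) ⟩
        n * (B * length U) + n * n ∎))
        where
        open ℕP.≤-Reasoning
        open +-*-Solver
        pointwise : ∀ u → B * degree u ≤ B * n * bit (high u) + n
        pointwise u with n ℕ.≤ᵇ B * degree u in e
        ... | true = ℕP.≤-trans (ℕP.*-monoʳ-≤ B (degree≤n u)) (ℕP.≤-trans (ℕP.≤-reflexive (sym (ℕP.*-identityʳ (B * n)))) (ℕP.m≤m+n _ n))
        ... | false = ℕP.≤-trans (ℕP.<⇒≤ (ℕP.≰⇒> (λ le → subst T e (ℕP.≤⇒≤ᵇ le)))) (ℕP.m≤n+m n _)

      dependentChoice : ∃[ S ] (S ∈ subs V × Z ≤ length S × bads S ≡ 0)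
      -- The start is α = 2 B n and β = 1: `bads U` and the reserve for `Z` survivors are at most n²
      -- each, and |U| ≥ n / B makes the right side at least 2 n².
      dependentChoice with steps {B} {c} {r} 0<n cBr≤n few k (2 * B * n) 1 Z U (subs-filter high V (subs-self V)) U-dense initial
        where
        open ℕP.≤-Reasoning
        open +-*-Solver
        initial : 1 * bads U + 2 * B * n * (Z * B ^ k) ≤ 2 * B * n * length U
        initial = begin
          1 * bads U + 2 * B * n * (Z * B ^ k)
            ≡⟨ cong₂ _+_ (ℕP.*-identityˡ (bads U)) (solve 4 (λ B n Z P → con 2 :* B :* n :* (Z :* P) := n :* (con 2 :* B :* (Z :* P))) refl B n Z (B ^ k)) ⟩
          bads U + n * (2 * B * (Z * B ^ k)) ≤⟨ ℕP.+-mono-≤ (ℕP.≤-trans (bads≤ U) (ℕP.*-mono-≤ |U|≤n |U|≤n)) (ℕP.*-monoʳ-≤ n Z-small) ⟩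
          n * n + n * n ≡⟨ solve 1 (λ n → n :* n :+ n :* n := con 2 :* n :* n) refl n ⟩
          2 * n * n ≤⟨ ℕP.*-monoʳ-≤ (2 * n) U-large ⟩
          2 * n * (B * length U) ≡⟨ solve 3 (λ n B u → con 2 :* n :* (B :* u) := con 2 :* B :* n :* u) refl n B (length U) ⟩
          2 * B * n * length U ∎
          where
          |U|≤n : length U ≤ n
          |U|≤n = subst (length U ≤_) |V| (subs-length V (subs-filter high V (subs-self V)))
      ... | S , S∈ , fin = S , S∈ , ℕP.*-cancelˡ-≤ (2 * B * n) {{nz}} (ℕP.≤-trans (ℕP.m≤n+m _ _) fin) , vanish (bads S) fin
        where
        nz : NonZero (2 * B * n)
        nz = ℕP.m*n≢0 (2 * B) n {{ℕP.m*n≢0 2 B}} {{ℕ.>-nonZero 0<n}}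
        |S|≤n : length S ≤ n
        |S|≤n = subst (length S ≤_) |V| (subs-length V S∈)
        vanish : ∀ e → r ^ k * 1 * e + 2 * B * n * Z ≤ 2 * B * n * length S → e ≡ 0
        vanish zero _ = refl
        -- After k rounds a single bad pair weighs r^k, which exceeds α n = 2 B n².
        vanish (suc e) h = ⊥-elim (ℕP.<⇒≱ large (begin
          r ^ k ≡⟨ sym (ℕP.*-identityʳ (r ^ k)) ⟩
          r ^ k * 1 ≤⟨ ℕP.m≤m*n (r ^ k * 1) (suc e) ⟩
          r ^ k * 1 * suc e ≤⟨ ℕP.m≤m+n _ _ ⟩
          r ^ k * 1 * suc e + 2 * B * n * Z ≤⟨ h ⟩
          2 * B * n * length S ≤⟨ ℕP.*-monoʳ-≤ (2 * B * n) |S|≤n ⟩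
          2 * B * n * n ≡⟨ ℕP.*-assoc (2 * B) n n ⟩
          2 * B * (n * n) ∎))
          where open ℕP.≤-Reasoning

  -- The deterministic Ramsey argument for one colouring.

  module Ramsey {n : ℕ} (g : Bool → Fin n → Fin n → Bool) (R χ : Fin n → Fin n → Bool) (W : Bool → Fin n → Fin n → Set)
    (W-sym : ∀ {col x y} → W col x y → W col y x)
    (W-dense : ∀ {col x y} → g col x y ≡ true → W col x y)
    (W-random : ∀ {x y} → R x y ≡ true → W (χ x y) x y)
    (noMono : ∀ {col a b c d} → W col a b → W col a c → W col a d → W col b c → W col b d → W col c d → ⊥)
    {m : ℕ}
    (cliques : ∀ S → S ∈ subs (allFin n) → m ≤ length S → ∃[ a ] ∃[ b ] ∃[ c ] ∃[ d ] ((a ∈ S × b ∈ S × c ∈ S × d ∈ S) ×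
      (R a b ≡ true × R a c ≡ true × R a d ≡ true × R b c ≡ true × R b d ≡ true × R c d ≡ true)))
    where

    -- A random K4 in `S` with no edge of colour `col` would be monochromatic in the other colour.
    randomEdge : ∀ col S → S ∈ subs (allFin n) → m ≤ length S → ∃[ a ] ∃[ b ] (a ∈ S × b ∈ S × R a b ≡ true × χ a b ≡ col)
    randomEdge col S S∈ m≤ with cliques S S∈ m≤
    ... | a , b , c , d , (a∈ , b∈ , c∈ , d∈) , (ab , ac , ad , bc , bd , cd) =
      try (χ a b) (χ a c) (χ a d) (χ b c) (χ b d) (χ c d) refl refl refl refl refl refl
      where
      Result = ∃[ a ] ∃[ b ] (a ∈ S × b ∈ S × R a b ≡ true × χ a b ≡ col)
      W′ : ∀ {x y} → R x y ≡ true → χ x y ≢ col → W (not col) x y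
      W′ {x} {y} r h = subst (λ t → W t x y) (BoolP.¬-not h) (W-random r)
      try : ∀ p q s t u v → χ a b ≡ p → χ a c ≡ q → χ a d ≡ s → χ b c ≡ t → χ b d ≡ u → χ c d ≡ v → Result
      try p q s t u v ep eq es et eu ev
        with p BoolP.≟ col | q BoolP.≟ col | s BoolP.≟ col | t BoolP.≟ col | u BoolP.≟ col | v BoolP.≟ col
      ... | yes e | _ | _ | _ | _ | _ = a , b , a∈ , b∈ , ab , trans ep e
      ... | no _ | yes e | _ | _ | _ | _ = a , c , a∈ , c∈ , ac , trans eq e
      ... | no _ | no _ | yes e | _ | _ | _ = a , d , a∈ , d∈ , ad , trans es e
      ... | no _ | no _ | no _ | yes e | _ | _ = b , c , b∈ , c∈ , bc , trans et e
      ... | no _ | no _ | no _ | no _ | yes e | _ = b , d , b∈ , d∈ , bd , trans eu e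
      ... | no _ | no _ | no _ | no _ | no _ | yes e = c , d , c∈ , d∈ , cd , trans ev e
      ... | no ¬p | no ¬q | no ¬s | no ¬t | no ¬u | no ¬v = ⊥-elim (noMono
              (W′ ab (λ e → ¬p (trans (sym ep) e))) (W′ ac (λ e → ¬q (trans (sym eq) e))) (W′ ad (λ e → ¬s (trans (sym es) e)))
              (W′ bc (λ e → ¬t (trans (sym et) e))) (W′ bd (λ e → ¬u (trans (sym eu) e))) (W′ cd (λ e → ¬v (trans (sym ev) e))))

    bad : Bool → Fin n → Fin n → Bool
    bad col u v = R u v ∧ does (χ u v BoolP.≟ col)

    bad⁻ : ∀ col {u v} → bad col u v ≡ true → R u v ≡ true × χ u v ≡ col
    bad⁻ col {u} {v} e with R u v | χ u v BoolP.≟ col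
    ... | true | yes q = refl , q

    bad⁺ : ∀ col {u v} → R u v ≡ true → χ u v ≡ col → bad col u v ≡ true
    bad⁺ col {u} {v} r q with R u v | χ u v BoolP.≟ col
    ... | true | yes _ = refl
    ... | true | no h = ⊥-elim (h q)

    -- A larger common neighbourhood contains a random edge of colour `col` by `randomEdge`;
    -- together with `u v` it spans a K4 of that colour.
    few : ∀ col u v → bad col u v ≡ true → Choice.codegree (g col) (bad col) u v ≤ m
    few col u v e = ℕP.≮⇒≥ λ m< →
      let a , c , a∈ , c∈ , ac , ec = randomEdge col S (subs-filter common (allFin n) (subs-self (allFin n)))
            (ℕP.≤-trans (ℕP.<⇒≤ m<) (ℕP.≤-reflexive (sym size)))
          ga = both a a∈
          gc = both c c∈
      in noMono {col} {u} {v} {a} {c} (coloured (proj₁ (bad⁻ col e)) (proj₂ (bad⁻ col e)))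
           (to (proj₁ ga)) (to (proj₁ gc)) (to (proj₂ ga)) (to (proj₂ gc)) (coloured ac ec)
      where
      common : Fin n → Bool
      common x = g col x u ∧ g col x v
      S = filterᵇ common (allFin n)
      bit-∧ : ∀ p q → bit (p ∧ q) ≡ bit p * bit q
      bit-∧ true q = sym (ℕP.*-identityˡ (bit q))
      bit-∧ false q = refl
      size : length S ≡ Choice.codegree (g col) (bad col) u v
      size = trans (length-filterᵇ common (allFin n)) (Σℕ-cong (allFin n) (λ x → bit-∧ (g col x u) (g col x v)))
      coloured : ∀ {x y} → R x y ≡ true → χ x y ≡ col → W col x y
      coloured {x} {y} r q = subst (λ t → W t x y) q (W-random r)
      to : ∀ {x y} → g col y x ≡ true → W col x y
      to h = W-sym (W-dense h)
      ∧-true : ∀ {p q} → p ∧ q ≡ true → p ≡ true × q ≡ true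
      ∧-true {true} {true} _ = refl , refl
      both : ∀ x → x ∈ S → g col x u ≡ true × g col x v ≡ true
      both x x∈ = ∧-true (proj₂ (∈-filterᵇ⁻ common (allFin n) x∈))

    edgeCount : Bool → ℕ
    edgeCount col = Σℕ (allFin n) (Choice.degree (g col) (bad col))

    -- One colour carries half of the degree sum. Dependent random choice in it leaves at least `m`
    -- vertices without a bad pair, but `randomEdge` finds one among them.
    impossible : ∀ {B r k} → 0 < n → {{_ : NonZero B}} → m * B * r ≤ n → 2 * B * (n * n) < r ^ k → 2 * B * (m * B ^ k) ≤ n →
      4 * (n * n) ≤ B * (edgeCount true + edgeCount false) → ⊥
    impossible {B} {r} {k} 0<n mBr≤n large m-small many = split (2 * (n * n) ℕP.≤? B * edgeCount true) (2 * (n * n) ℕP.≤? B * edgeCount false)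
      where
      open +-*-Solver
      finish : ∀ col → 2 * (n * n) ≤ B * edgeCount col → ⊥
      finish col h =
        let S , S∈ , m≤ , none = chosen
            a , c , a∈ , c∈ , ac , ec = randomEdge col S S∈ m≤
        in ℕP.<-irrefl (sym none) (Choice.bads>0 (g col) (bad col) a∈ c∈ (bad⁺ col ac ec))
        where
        chosen : ∃[ S ] (S ∈ subs (allFin n) × m ≤ length S × Choice.bads (g col) (bad col) S ≡ 0)
        chosen = Dense.dependentChoice (g col) (bad col) {B} {m} {r} {k} {m} 0<n mBr≤n (few col) h large m-small
      split : Dec (2 * (n * n) ≤ B * edgeCount true) → Dec (2 * (n * n) ≤ B * edgeCount false) → ⊥
      split (yes h) _ = finish true h
      split (no _) (yes h) = finish false h
      split (no p) (no q) = ℕP.<⇒≱ (ℕP.+-mono-< (ℕP.≰⇒> p) (ℕP.≰⇒> q))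
        (ℕP.≤-trans (ℕP.≤-reflexive (solve 1 (λ x → con 2 :* x :+ con 2 :* x := con 4 :* x) refl (n * n)))
          (ℕP.≤-trans many (ℕP.≤-reflexive (ℕP.*-distribˡ-+ B (edgeCount true) (edgeCount false)))))

-- Copies of K4 in the random graph, transversal to four blocks.

module Cliques where
  open Rat
  open Sums
  open Prob
  open Janson
  open Slots
  open Scripts using (_>>=_; ∈->>=)
  open import Data.Fin.Patterns
  open import Data.Vec as Vec using (Vec; []; _∷_; lookup)
  open import Data.Rational
  open import Data.Rational.Properties
  open import Data.Rational.Solver using (module +-*-Solver)
  open +-*-Solver using (solve; _:+_; _:=_; _:*_; :-_; _:-_; con)

  module Quadruples {n M : ℕ} (𝒮 : Slotting n M) where
    open Slotting 𝒮

    Quad : Set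
    Quad = Vec (Fin n) 4

    edgePairs : List (Fin 4 × Fin 4)
    edgePairs = (0F , 1F) ∷ (0F , 2F) ∷ (0F , 3F) ∷ (1F , 2F) ∷ (1F , 3F) ∷ (2F , 3F) ∷ []

    pairSlots : Quad → Fin 4 × Fin 4 → List (Fin M)
    pairSlots x e = slots (lookup x (proj₁ e)) (lookup x (proj₂ e))

    mask : Quad → List (Fin M)
    mask x = edgePairs >>= pairSlots x

    mask-length : ∀ x → length (mask x) ℕ.≤ 6
    mask-length x = go edgePairs
      where
      go : ∀ ps → length (ps >>= pairSlots x) ℕ.≤ length ps
      go [] = z≤n
      go ((i , j) ∷ ps) = ℕP.≤-trans (ℕP.≤-reflexive (length-++ (slots (lookup x i) (lookup x j))))
        (ℕP.+-mono-≤ (length-slots (lookup x i) (lookup x j)) (go ps))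

    ∈-mask⁺ : ∀ {k i j} x → (i , j) ∈ edgePairs → Joins k (lookup x i) (lookup x j) → k ∈ mask x
    ∈-mask⁺ x p j = ∈->>= {xs = edgePairs} {f = pairSlots x} p (∈-slots⁺ j)

    ∈-mask⁻ : ∀ {k} x → k ∈ mask x → ∃[ i ] ∃[ j ] (i ≢ j × Joins k (lookup x i) (lookup x j))
    ∈-mask⁻ x k∈ with find (∈-concatMap⁻ (pairSlots x) {xs = edgePairs} k∈)
    ... | (i , j) , _ , h = i , j , (λ { refl → Joins-≢ (∈-slots⁻ h) refl }) , ∈-slots⁻ h

    -- With cliques transversal to four disjoint blocks, two of them share a vertex only in the same
    -- coordinate. The overlap of their edge sets is thus determined by the coordinates in which
    -- they agree.
    Blocks : Set
    Blocks = Fin 4 → List (Fin n)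

    _∈ᵇ_ : Quad → Blocks → Set
    x ∈ᵇ 𝓑 = ∀ i → lookup x i ∈ 𝓑 i

    Disjointᵇ : Blocks → Set
    Disjointᵇ 𝓑 = ∀ {i j u} → u ∈ 𝓑 i → u ∈ 𝓑 j → i ≡ j

    quads : Blocks → List Quad
    quads 𝓑 = 𝓑 0F >>= λ a → 𝓑 1F >>= λ b → 𝓑 2F >>= λ c → map (λ d → a ∷ b ∷ c ∷ d ∷ []) (𝓑 3F)

    ∈-quads⁻ : ∀ {x} 𝓑 → x ∈ quads 𝓑 → x ∈ᵇ 𝓑
    ∈-quads⁻ 𝓑 x∈ with find (∈-concatMap⁻ _ {xs = 𝓑 0F} x∈)
    ... | a , a∈ , x∈₁ with find (∈-concatMap⁻ _ {xs = 𝓑 1F} x∈₁)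
    ...   | b , b∈ , x∈₂ with find (∈-concatMap⁻ _ {xs = 𝓑 2F} x∈₂)
    ...     | c , c∈ , x∈₃ with ∈-map⁻ (λ d → a ∷ b ∷ c ∷ d ∷ []) x∈₃
    ...       | d , d∈ , refl = λ { 0F → a∈ ; 1F → b∈ ; 2F → c∈ ; 3F → d∈ }

    quads-unique : ∀ 𝓑 → (∀ i → Unique (𝓑 i)) → Unique (quads 𝓑)
    quads-unique 𝓑 u =
      unique-concatMap _ (u 0F) (λ a → unique-concatMap _ (u 1F) (λ b → unique-concatMap _ (u 2F)
        (λ c → Uniq.map⁺ (cong (λ x → lookup x 3F)) (u 3F))
        (λ {c} {c′} ne (h , k) → ne (trans (sym (third a b c h)) (third a b c′ k))))
        (λ {b} {b′} ne (h , k) → ne (trans (sym (second a b h)) (second a b′ k))))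
        (λ {a} {a′} ne (h , k) → ne (trans (sym (first a h)) (first a′ k)))
      where
      third : ∀ a b c {x} → x ∈ map (λ d → a ∷ b ∷ c ∷ d ∷ []) (𝓑 3F) → lookup x 2F ≡ c
      third a b c h with ∈-map⁻ (λ d → a ∷ b ∷ c ∷ d ∷ []) h
      ... | _ , _ , refl = refl
      second : ∀ a b {x} → x ∈ (𝓑 2F >>= λ c → map (λ d → a ∷ b ∷ c ∷ d ∷ []) (𝓑 3F)) → lookup x 1F ≡ b
      second a b h with find (∈-concatMap⁻ _ {xs = 𝓑 2F} h)
      ... | c , _ , h′ with ∈-map⁻ (λ d → a ∷ b ∷ c ∷ d ∷ []) h′
      ...   | _ , _ , refl = refl
      first : ∀ a {x} → x ∈ (𝓑 1F >>= λ b → 𝓑 2F >>= λ c → map (λ d → a ∷ b ∷ c ∷ d ∷ []) (𝓑 3F)) → lookup x 0F ≡ a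
      first a h with find (∈-concatMap⁻ _ {xs = 𝓑 1F} h)
      ... | b , _ , h′ with find (∈-concatMap⁻ _ {xs = 𝓑 2F} h′)
      ...   | c , _ , h″ with ∈-map⁻ (λ d → a ∷ b ∷ c ∷ d ∷ []) h″
      ...     | _ , _ , refl = refl

    length->>= : ∀ {A B : Set} (xs : List A) (f : A → List B) c → (∀ x → length (f x) ≡ c) → length (xs >>= f) ≡ length xs ℕ.* c
    length->>= [] f c h = refl
    length->>= (x ∷ xs) f c h = trans (length-++ (f x)) (cong₂ ℕ._+_ (h x) (length->>= xs f c h))

    quads-length : ∀ 𝓑 {h} → (∀ i → length (𝓑 i) ≡ h) → length (quads 𝓑) ≡ h ℕ.* (h ℕ.* (h ℕ.* h))
    quads-length 𝓑 {h} len =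
      trans (length->>= (𝓑 0F) _ (h ℕ.* (h ℕ.* h)) λ a → trans (length->>= (𝓑 1F) _ (h ℕ.* h) λ b → trans (length->>= (𝓑 2F) _ h λ c →
        trans (length-map _ (𝓑 3F)) (len 3F)) (cong (ℕ._* h) (len 2F))) (cong (ℕ._* (h ℕ.* h)) (len 1F))) (cong (ℕ._* (h ℕ.* (h ℕ.* h))) (len 0F))

    module _ {p : ℚ} (0≤p : 0ℚ ≤ p) where

      -- The conditional probability of one clique given another, by the set of coordinates on which they agree.
      shared : Bool → Bool → Bool → Bool → ℚ
      shared true true true true = 0ℚ
      shared true true true false = p ^ℚ 3
      shared true true false true = p ^ℚ 3
      shared true false true true = p ^ℚ 3
      shared false true true true = p ^ℚ 3
      shared true true false false = p ^ℚ 5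
      shared true false true false = p ^ℚ 5
      shared true false false true = p ^ℚ 5
      shared false true true false = p ^ℚ 5
      shared false true false true = p ^ℚ 5
      shared false false true true = p ^ℚ 5
      shared _ _ _ _ = 0ℚ

      0≤shared : ∀ a b c d → 0ℚ ≤ shared a b c d
      0≤shared true true true true = ≤-refl
      0≤shared true true true false = ^-nonneg 3 0≤p
      0≤shared true true false true = ^-nonneg 3 0≤p
      0≤shared true false true true = ^-nonneg 3 0≤p
      0≤shared false true true true = ^-nonneg 3 0≤p
      0≤shared true true false false = ^-nonneg 5 0≤p
      0≤shared true false true false = ^-nonneg 5 0≤p
      0≤shared true false false true = ^-nonneg 5 0≤p
      0≤shared false true true false = ^-nonneg 5 0≤p
      0≤shared false true false true = ^-nonneg 5 0≤p
      0≤shared false false true true = ^-nonneg 5 0≤p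
      0≤shared true false false false = ≤-refl
      0≤shared false true false false = ≤-refl
      0≤shared false false true false = ≤-refl
      0≤shared false false false true = ≤-refl
      0≤shared false false false false = ≤-refl

      agree : Fin 4 → Quad → Quad → Bool
      agree i y x = does (lookup y i FinP.≟ lookup x i)

      w : Quad → Quad → ℚ
      w y x = shared (agree 0F y x) (agree 1F y x) (agree 2F y x) (agree 3F y x)

      -- At most one entry of a duplicate-free list equals `v`; all others take the value `φ false`.
      ∑-agree : ∀ {xs : List (Fin n)} → Unique xs → ∀ v {f : Fin n → ℚ} (φ : Bool → ℚ) → (∀ b → 0ℚ ≤ φ b) →
        (∀ u → f u ≤ φ (does (u FinP.≟ v))) → ∑ xs f ≤ φ true + ℕtoℚ (length xs) * φ false
      ∑-agree {[]} [] v φ 0≤φ h = subst (0ℚ ≤_) (cong (φ true +_) (sym (*-zeroˡ (φ false)))) (0≤+ (0≤φ true) ≤-refl)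
      ∑-agree {u ∷ xs} (u∉ ∷ U) v {f} φ 0≤φ h with u FinP.≟ v | h u
      ... | no _ | hu = begin
        f u + ∑ xs f ≤⟨ +-mono-≤ hu (∑-agree U v φ 0≤φ h) ⟩
        φ false + (φ true + l * φ false) ≡⟨ solve 3 (λ a b l → b :+ (a :+ l :* b) := a :+ (con 1ℚ :+ l) :* b) refl (φ true) (φ false) l ⟩
        φ true + (1ℚ + l) * φ false ≡⟨ cong (λ t → φ true + t * φ false) (sym (ℕtoℚ-+ 1 (length xs))) ⟩
        φ true + ℕtoℚ (suc (length xs)) * φ false ∎
        where
        open ≤-Reasoning
        l = ℕtoℚ (length xs)
      ... | yes refl | hu = begin
        f u + ∑ xs f ≤⟨ +-mono-≤ hu (∑-≤-length xs (φ false) (λ y y∈ → ≤-trans (h y) (≤-reflexive (cong φ (apart y y∈))))) ⟩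
        φ true + l * φ false ≤⟨ +-monoʳ-≤ (φ true) (*-monoʳ (0≤φ false) (ℕtoℚ-mono (ℕP.n≤1+n (length xs)))) ⟩
        φ true + ℕtoℚ (suc (length xs)) * φ false ∎
        where
        open ≤-Reasoning
        l = ℕtoℚ (length xs)
        apart : ∀ y → y ∈ xs → does (y FinP.≟ u) ≡ false
        apart y y∈ with y FinP.≟ u
        ... | yes refl = ⊥-elim (All.lookup u∉ y∈ refl)
        ... | no _ = refl

      -- There are 6 ways to agree in two coordinates, each with at most h² cliques of five new
      -- edges, and 4 ways to agree in three, each with at most h cliques of three new edges.
      ∑-shared : ∀ 𝓑 {h} → (∀ i → Unique (𝓑 i)) → (∀ i → length (𝓑 i) ≡ h) → ∀ x →
        ∑ (quads 𝓑) (λ y → w y x) ≤ ℕtoℚ 6 * (ℕtoℚ h * ℕtoℚ h * p ^ℚ 5) + ℕtoℚ 4 * (ℕtoℚ h * p ^ℚ 3)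
      ∑-shared 𝓑 {h} u len (x₀ ∷ x₁ ∷ x₂ ∷ x₃ ∷ []) = begin
        ∑ (quads 𝓑) (λ y → w y x) ≡⟨ ∑-concatMap (𝓑 0F) _ ⟩
        ∑ (𝓑 0F) (λ a → ∑ (𝓑 1F >>= λ b → 𝓑 2F >>= λ c → map (λ d → a ∷ b ∷ c ∷ d ∷ []) (𝓑 3F)) (λ y → w y x))
          ≤⟨ layer 0F x₀ φ₀ 0≤φ₀ (λ a → ≤-trans (≤-reflexive (∑-concatMap (𝓑 1F) _)) (layer 1F x₁ (φ₁ (does (a FinP.≟ x₀))) (0≤φ₁ (does (a FinP.≟ x₀))) (λ b →
             ≤-trans (≤-reflexive (∑-concatMap (𝓑 2F) _)) (layer 2F x₂ (φ₂ (does (a FinP.≟ x₀)) (does (b FinP.≟ x₁))) (0≤φ₂ (does (a FinP.≟ x₀)) (does (b FinP.≟ x₁))) (λ c →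
             ≤-trans (≤-reflexive (∑-map (𝓑 3F) _)) (layer 3F x₃ (shared (does (a FinP.≟ x₀)) (does (b FinP.≟ x₁)) (does (c FinP.≟ x₂))) (0≤shared (does (a FinP.≟ x₀)) (does (b FinP.≟ x₁)) (does (c FinP.≟ x₂))) (λ d → ≤-refl))))))) ⟩
        φ₀ true + H * φ₀ false
          ≡⟨ solve 3 (λ H p³ p⁵ →
               (((con 0ℚ :+ H :* p³) :+ H :* (p³ :+ H :* p⁵)) :+ H :* ((p³ :+ H :* p⁵) :+ H :* (p⁵ :+ H :* con 0ℚ)))
               :+ H :* (((p³ :+ H :* p⁵) :+ H :* (p⁵ :+ H :* con 0ℚ)) :+ H :* ((p⁵ :+ H :* con 0ℚ) :+ H :* (con 0ℚ :+ H :* con 0ℚ)))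
               := con (ℕtoℚ 6) :* (H :* H :* p⁵) :+ con (ℕtoℚ 4) :* (H :* p³)) refl H (p ^ℚ 3) (p ^ℚ 5) ⟩
        ℕtoℚ 6 * (H * H * p ^ℚ 5) + ℕtoℚ 4 * (H * p ^ℚ 3) ∎
        where
        open ≤-Reasoning
        x = x₀ ∷ x₁ ∷ x₂ ∷ x₃ ∷ []
        H = ℕtoℚ h
        φ₂ : Bool → Bool → Bool → ℚ
        φ₂ a b c = shared a b c true + H * shared a b c false
        φ₁ : Bool → Bool → ℚ
        φ₁ a b = φ₂ a b true + H * φ₂ a b false
        φ₀ : Bool → ℚ
        φ₀ a = φ₁ a true + H * φ₁ a false
        0≤φ₂ : ∀ a b c → 0ℚ ≤ φ₂ a b c
        0≤φ₂ a b c = 0≤+ (0≤shared a b c true) (0≤* (0≤ℕ h) (0≤shared a b c false))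
        0≤φ₁ : ∀ a b → 0ℚ ≤ φ₁ a b
        0≤φ₁ a b = 0≤+ (0≤φ₂ a b true) (0≤* (0≤ℕ h) (0≤φ₂ a b false))
        0≤φ₀ : ∀ a → 0ℚ ≤ φ₀ a
        0≤φ₀ a = 0≤+ (0≤φ₁ a true) (0≤* (0≤ℕ h) (0≤φ₁ a false))
        layer : ∀ i v {f : Fin n → ℚ} (φ : Bool → ℚ) → (∀ b → 0ℚ ≤ φ b) → (∀ u → f u ≤ φ (does (u FinP.≟ v))) →
          ∑ (𝓑 i) f ≤ φ true + H * φ false
        layer i v {f} φ 0≤φ le = subst (λ l → ∑ (𝓑 i) f ≤ φ true + ℕtoℚ l * φ false) (len i) (∑-agree (u i) v φ 0≤φ le)

      ∈-mask : ∀ {k i j} y → i ≢ j → Joins k (lookup y i) (lookup y j) → k ∈ mask y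
      ∈-mask {i = 0F} {0F} y h _ = ⊥-elim (h refl)
      ∈-mask {i = 0F} {1F} y _ j = ∈-mask⁺ y (here refl) j
      ∈-mask {i = 0F} {2F} y _ j = ∈-mask⁺ y (there (here refl)) j
      ∈-mask {i = 0F} {3F} y _ j = ∈-mask⁺ y (there (there (here refl))) j
      ∈-mask {i = 1F} {0F} y _ j = ∈-mask⁺ y (here refl) (Joins-sym j)
      ∈-mask {i = 1F} {1F} y h _ = ⊥-elim (h refl)
      ∈-mask {i = 1F} {2F} y _ j = ∈-mask⁺ y (there (there (there (here refl)))) j
      ∈-mask {i = 1F} {3F} y _ j = ∈-mask⁺ y (there (there (there (there (here refl))))) j
      ∈-mask {i = 2F} {0F} y _ j = ∈-mask⁺ y (there (here refl)) (Joins-sym j)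
      ∈-mask {i = 2F} {1F} y _ j = ∈-mask⁺ y (there (there (there (here refl)))) (Joins-sym j)
      ∈-mask {i = 2F} {2F} y h _ = ⊥-elim (h refl)
      ∈-mask {i = 2F} {3F} y _ j = ∈-mask⁺ y (there (there (there (there (there (here refl)))))) j
      ∈-mask {i = 3F} {0F} y _ j = ∈-mask⁺ y (there (there (here refl))) (Joins-sym j)
      ∈-mask {i = 3F} {1F} y _ j = ∈-mask⁺ y (there (there (there (there (here refl))))) (Joins-sym j)
      ∈-mask {i = 3F} {2F} y _ j = ∈-mask⁺ y (there (there (there (there (there (here refl)))))) (Joins-sym j)
      ∈-mask {i = 3F} {3F} y h _ = ⊥-elim (h refl)

      module _ {𝓑 : Blocks} (dis : Disjointᵇ 𝓑) (p≤1 : p ≤ 1ℚ) where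
        open Lower 0≤p p≤1 mask w (λ y x → 0≤shared (agree 0F y x) (agree 1F y x) (agree 2F y x) (agree 3F y x))

        distinct : ∀ {y i j} → y ∈ᵇ 𝓑 → i ≢ j → lookup y i ≢ lookup y j
        distinct {y} {i} {j} y∈ i≢j e = i≢j (dis (y∈ i) (subst (_∈ 𝓑 j) (sym e) (y∈ j)))

        -- By disjointness of the blocks, a vertex of `y` that occurs in `x` occurs there in its own
        -- coordinate. A vertex changed at `i` is therefore absent from `x`, and so are all edges at
        -- it.
        unmasked : ∀ {x y i v k} → x ∈ᵇ 𝓑 → y ∈ᵇ 𝓑 → lookup y i ≢ lookup x i → Joins k (lookup y i) v → k ∉ mask x
        unmasked {x} {y} {i} x∈ y∈ ne j k∈ with ∈-mask⁻ x k∈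
        ... | a , b , _ , j′ with Joins-ends j′ j
        ...   | inj₁ (e , _) = ne (trans e (cong (lookup x) (dis (x∈ a) (subst (_∈ 𝓑 i) e (y∈ i)))))
        ...   | inj₂ (e , _) = ne (trans e (cong (lookup x) (dis (x∈ b) (subst (_∈ 𝓑 i) e (y∈ i)))))

        module _ {x y : Quad} (x∈ : x ∈ᵇ 𝓑) (y∈ : y ∈ᵇ 𝓑) where

          slot : ∀ {i j} → i ≢ j → ∃[ k ] Joins k (lookup y i) (lookup y j)
          slot i≢j = joining (distinct {y} y∈ i≢j)

          spoke : ∀ {i j k} → i ≢ j → lookup y i ≢ lookup x i → Joins k (lookup y i) (lookup y j) → k ∈ mask y × k ∉ mask x
          spoke i≢j ne j = ∈-mask y i≢j j , unmasked {x} {y} x∈ y∈ ne j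

          -- `J` consists of the three edges of `y` at the new vertex.
          three : ∀ i j k l → i ≢ j → i ≢ k → i ≢ l → j ≢ k → j ≢ l → k ≢ l → lookup y i ≢ lookup x i → p ^ℚ 3 ≤ w y x → Related x y
          three i j k l i≢j i≢k i≢l j≢k j≢l k≢l ne weight with slot i≢j | slot i≢k | slot i≢l
          ... | s , sj | t , tj | u , uj = inj₂ (s ∷ t ∷ u ∷ [] ,
            ((Joins-apart (Joins-sym sj) tj (d (≢-sym i≢j)) (d j≢k) ∷ Joins-apart (Joins-sym sj) uj (d (≢-sym i≢j)) (d j≢l) ∷ []) ∷
             (Joins-apart (Joins-sym tj) uj (d (≢-sym i≢k)) (d k≢l) ∷ []) ∷ [] ∷ []) ,
            (λ { _ (here refl) → spoke i≢j ne sj ; _ (there (here refl)) → spoke i≢k ne tj ; _ (there (there (here refl))) → spoke i≢l ne uj }) ,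
            weight)
            where
            d : ∀ {a b} → a ≢ b → lookup y a ≢ lookup y b
            d = distinct {y} y∈

          -- `J` consists of all edges of `y` except the one between coordinates `k` and `l`, where
          -- both ends may be shared.
          five : ∀ i j k l → i ≢ j → i ≢ k → i ≢ l → j ≢ k → j ≢ l → k ≢ l → lookup y i ≢ lookup x i → lookup y j ≢ lookup x j →
            p ^ℚ 5 ≤ w y x → Related x y
          five i j k l i≢j i≢k i≢l j≢k j≢l k≢l nei nej weight with slot i≢k | slot i≢l | slot j≢k | slot j≢l | slot i≢j
          ... | s , sj | t , tj | u , uj | v , vj | z , zj = inj₂ (s ∷ t ∷ u ∷ v ∷ z ∷ [] ,
            ((Joins-apart (Joins-sym sj) tj (d (≢-sym i≢k)) (d k≢l) ∷ Joins-apart sj uj (d i≢j) (d i≢k) ∷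
              Joins-apart sj vj (d i≢j) (d i≢l) ∷ Joins-apart (Joins-sym sj) zj (d (≢-sym i≢k)) (d (≢-sym j≢k)) ∷ []) ∷
             (Joins-apart tj uj (d i≢j) (d i≢k) ∷ Joins-apart tj vj (d i≢j) (d i≢l) ∷
              Joins-apart (Joins-sym tj) zj (d (≢-sym i≢l)) (d (≢-sym j≢l)) ∷ []) ∷
             (Joins-apart (Joins-sym uj) vj (d (≢-sym j≢k)) (d k≢l) ∷ Joins-apart (Joins-sym uj) zj (d (≢-sym i≢k)) (d (≢-sym j≢k)) ∷ []) ∷
             (Joins-apart (Joins-sym vj) zj (d (≢-sym i≢l)) (d (≢-sym j≢l)) ∷ []) ∷ [] ∷ []) ,
            (λ { _ (here refl) → spoke i≢k nei sj ; _ (there (here refl)) → spoke i≢l nei tj ; _ (there (there (here refl))) → spoke j≢k nej uj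
               ; _ (there (there (there (here refl)))) → spoke j≢l nej vj ; _ (there (there (there (there (here refl))))) → spoke i≢j nei zj }) ,
            weight)
            where
            d : ∀ {a b} → a ≢ b → lookup y a ≢ lookup y b
            d = distinct {y} y∈

          disjointMasks : (∀ i j → i ≢ j → lookup y i ≢ lookup x i ⊎ lookup y j ≢ lookup x j) → Related x y
          disjointMasks h = inj₁ λ k k∈ k∈x → go k k∈ k∈x
            where
            go : ∀ k → k ∈ mask y → k ∉ mask x
            go k k∈ with ∈-mask⁻ y k∈
            ... | i , j , i≢j , jk with h i j i≢j
            ...   | inj₁ ne = unmasked {x} {y} x∈ y∈ ne jk
            ...   | inj₂ ne = unmasked {x} {y} x∈ y∈ ne (Joins-sym jk)

          related : y ≢ x → Related x y
          related y≢x = shape (agree 0F y x) (agree 1F y x) (agree 2F y x) (agree 3F y x) refl refl refl refl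
            where
            agrees : ∀ i → agree i y x ≡ true → lookup y i ≡ lookup x i
            agrees i e with lookup y i FinP.≟ lookup x i
            ... | yes h = h
            differs : ∀ i → agree i y x ≡ false → lookup y i ≢ lookup x i
            differs i e h with lookup y i FinP.≟ lookup x i
            ... | no ¬h = ¬h h
            same : (∀ i → lookup y i ≡ lookup x i) → y ≡ x
            same h = trans (sym (VecP.tabulate∘lookup y)) (trans (VecP.tabulate-cong h) (VecP.tabulate∘lookup x))
            weigh : ∀ {a b c d} → agree 0F y x ≡ a → agree 1F y x ≡ b → agree 2F y x ≡ c → agree 3F y x ≡ d → shared a b c d ≤ w y x
            weigh refl refl refl refl = ≤-refl
            -- If three coordinates change, any two coordinates include a changed one, so no edge is
            -- shared.
            far : ∀ i j k l → (∀ a → a ≡ i ⊎ a ≡ j ⊎ a ≡ k ⊎ a ≡ l) →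
              lookup y i ≢ lookup x i → lookup y j ≢ lookup x j → lookup y k ≢ lookup x k → Related x y
            far i j k l cover ni nj nk = disjointMasks pick
              where
              pick : ∀ a b → a ≢ b → lookup y a ≢ lookup x a ⊎ lookup y b ≢ lookup x b
              pick a b a≢b with cover a
              ... | inj₁ refl = inj₁ ni
              ... | inj₂ (inj₁ refl) = inj₁ nj
              ... | inj₂ (inj₂ (inj₁ refl)) = inj₁ nk
              ... | inj₂ (inj₂ (inj₂ refl)) with cover b
              ...   | inj₁ refl = inj₂ ni
              ...   | inj₂ (inj₁ refl) = inj₂ nj
              ...   | inj₂ (inj₂ (inj₁ refl)) = inj₂ nk
              ...   | inj₂ (inj₂ (inj₂ refl)) = ⊥-elim (a≢b refl)
            shape : ∀ a b c d → agree 0F y x ≡ a → agree 1F y x ≡ b → agree 2F y x ≡ c → agree 3F y x ≡ d → Related x y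
            shape true true true true e f g h = ⊥-elim (y≢x (same λ { 0F → agrees 0F e ; 1F → agrees 1F f ; 2F → agrees 2F g ; 3F → agrees 3F h }))
            shape true true true false e f g h = three 3F 0F 1F 2F (λ ()) (λ ()) (λ ()) (λ ()) (λ ()) (λ ()) (differs 3F h) (weigh e f g h)
            shape true true false true e f g h = three 2F 0F 1F 3F (λ ()) (λ ()) (λ ()) (λ ()) (λ ()) (λ ()) (differs 2F g) (weigh e f g h)
            shape true false true true e f g h = three 1F 0F 2F 3F (λ ()) (λ ()) (λ ()) (λ ()) (λ ()) (λ ()) (differs 1F f) (weigh e f g h)
            shape false true true true e f g h = three 0F 1F 2F 3F (λ ()) (λ ()) (λ ()) (λ ()) (λ ()) (λ ()) (differs 0F e) (weigh e f g h)
            shape true true false false e f g h = five 2F 3F 0F 1F (λ ()) (λ ()) (λ ()) (λ ()) (λ ()) (λ ()) (differs 2F g) (differs 3F h) (weigh e f g h)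
            shape true false true false e f g h = five 1F 3F 0F 2F (λ ()) (λ ()) (λ ()) (λ ()) (λ ()) (λ ()) (differs 1F f) (differs 3F h) (weigh e f g h)
            shape true false false true e f g h = five 1F 2F 0F 3F (λ ()) (λ ()) (λ ()) (λ ()) (λ ()) (λ ()) (differs 1F f) (differs 2F g) (weigh e f g h)
            shape false true true false e f g h = five 0F 3F 1F 2F (λ ()) (λ ()) (λ ()) (λ ()) (λ ()) (λ ()) (differs 0F e) (differs 3F h) (weigh e f g h)
            shape false true false true e f g h = five 0F 2F 1F 3F (λ ()) (λ ()) (λ ()) (λ ()) (λ ()) (λ ()) (differs 0F e) (differs 2F g) (weigh e f g h)
            shape false false true true e f g h = five 0F 1F 2F 3F (λ ()) (λ ()) (λ ()) (λ ()) (λ ()) (λ ()) (differs 0F e) (differs 1F f) (weigh e f g h)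
            shape _ false false false e f g h = far 1F 2F 3F 0F
              (λ { 0F → inj₂ (inj₂ (inj₂ refl)) ; 1F → inj₁ refl ; 2F → inj₂ (inj₁ refl) ; 3F → inj₂ (inj₂ (inj₁ refl)) }) (differs 1F f) (differs 2F g) (differs 3F h)
            shape false true false false e f g h = far 0F 2F 3F 1F
              (λ { 0F → inj₁ refl ; 1F → inj₂ (inj₂ (inj₂ refl)) ; 2F → inj₂ (inj₁ refl) ; 3F → inj₂ (inj₂ (inj₁ refl)) }) (differs 0F e) (differs 2F g) (differs 3F h)
            shape false false true false e f g h = far 0F 1F 3F 2F
              (λ { 0F → inj₁ refl ; 1F → inj₂ (inj₁ refl) ; 2F → inj₂ (inj₂ (inj₂ refl)) ; 3F → inj₂ (inj₂ (inj₁ refl)) }) (differs 0F e) (differs 1F f) (differs 3F h)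
            shape false false false true e f g h = far 0F 1F 2F 3F
              (λ { 0F → inj₁ refl ; 1F → inj₂ (inj₁ refl) ; 2F → inj₂ (inj₂ (inj₁ refl)) ; 3F → inj₂ (inj₂ (inj₂ refl)) }) (differs 0F e) (differs 1F f) (differs 2F g)

        compatible : ∀ xs → Unique xs → (∀ x → x ∈ xs → x ∈ᵇ 𝓑) → (∀ x → ∑ xs (λ y → w y x) ≤ ½) → Compatible xs
        compatible [] _ _ _ = []
        compatible (x ∷ xs) (x∉ ∷ u) in𝓑 small =
          (All.tabulate (λ {y} y∈ → related {x} {y} (in𝓑 x (here refl)) (in𝓑 y (there y∈)) (λ e → All.lookup x∉ y∈ (sym e))) ,
           ≤-trans (x≤y+x (0≤w x x)) (small x)) ∷
          compatible xs u (λ y y∈ → in𝓑 y (there y∈)) (λ z → ≤-trans (x≤y+x (0≤w x z)) (small z))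
          where
          0≤w : ∀ y x → 0ℚ ≤ w y x
          0≤w y x = 0≤shared (agree 0F y x) (agree 1F y x) (agree 2F y x) (agree 3F y x)

        noClique : ∀ {h} → (∀ i → Unique (𝓑 i)) → (∀ i → length (𝓑 i) ≡ h) →
          ℕtoℚ 6 * (ℕtoℚ h * ℕtoℚ h * p ^ℚ 5) + ℕtoℚ 4 * (ℕtoℚ h * p ^ℚ 3) ≤ ½ →
          E p (ind ∘ none (map mask (quads 𝓑))) ≤ (1ℚ - ½ * p ^ℚ 6) ^ℚ (h ℕ.* (h ℕ.* (h ℕ.* h)))
        noClique {h} u len small = subst (λ l → E p (ind ∘ none (map mask (quads 𝓑))) ≤ (1ℚ - ½ * p ^ℚ 6) ^ℚ l) (quads-length 𝓑 len)
          (janson (^-nonneg 6 0≤p) (^-≤1 6 0≤p p≤1) (λ x → ^-antimono {p} {length (mask x)} {6} 0≤p p≤1 (mask-length x))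
            (compatible (quads 𝓑) (quads-unique 𝓑 u) (λ x → ∈-quads⁻ 𝓑) (λ x → ≤-trans (∑-shared 𝓑 u len x) small)))

-- Random K4's in all large vertex sets, and the passage to the union graph.

module OneGraph where
  open Rat
  open Sums
  open Prob
  open Slots
  open Scripts using (_>>=_; ∈->>=)
  open Explore using (Σℕ)
  open DRC
  open Cliques
  open import Data.Fin.Patterns
  open import Data.Vec as Vec using (Vec; lookup)
  open import Data.Vec.Properties using (lookup-zipWith)
  open import Data.Rational
  open import Data.Rational.Properties
  open import Data.Rational.Solver using (module +-*-Solver)

  subs-⊆ : ∀ {a} {A : Set a} {ys x} (xs : List A) → ys ∈ subs xs → x ∈ ys → x ∈ xs
  subs-⊆ [] (here refl) ()
  subs-⊆ (z ∷ xs) ys∈ x∈ with ∈-++⁻ (map (z ∷_) (subs xs)) ys∈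
  ... | inj₂ h = there (subs-⊆ xs h x∈)
  ... | inj₁ h with ∈-map⁻ (z ∷_) h | x∈
  ...   | zs , zs∈ , refl | here e = here e
  ...   | zs , zs∈ , refl | there x∈′ = there (subs-⊆ xs zs∈ x∈′)

  subs-unique : ∀ {a} {A : Set a} {ys} (xs : List A) → Unique xs → ys ∈ subs xs → Unique ys
  subs-unique [] _ (here refl) = []
  subs-unique (z ∷ xs) (z∉ ∷ u) ys∈ with ∈-++⁻ (map (z ∷_) (subs xs)) ys∈
  ... | inj₂ h = subs-unique xs u h
  ... | inj₁ h with ∈-map⁻ (z ∷_) h
  ...   | zs , zs∈ , refl = AllP.¬Any⇒All¬ zs (λ z∈ → All.lookup z∉ (subs-⊆ xs zs∈ z∈) refl) ∷ subs-unique xs u zs∈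

  length-subs : ∀ {a} {A : Set a} (xs : List A) → length (subs xs) ≡ 2 ℕ.^ length xs
  length-subs [] = refl
  length-subs (x ∷ xs) = trans (length-++ (map (x ∷_) (subs xs))) (trans (cong₂ ℕ._+_ (trans (length-map (x ∷_) (subs xs)) (length-subs xs)) (length-subs xs))
    (cong (2 ℕ.^ length xs ℕ.+_) (sym (ℕP.+-identityʳ _))))

  none-false : ∀ {m} (Is : List (List (Fin m))) {ω} → none Is ω ≡ false → ∃[ I ] (I ∈ Is × allT I ω ≡ true)
  none-false (I ∷ Is) {ω} h with allT I ω in e
  ... | true = I , here refl , e
  ... | false = let J , J∈ , k = none-false Is h in J , there J∈ , k

  hitAll : ∀ {m} → List (List (List (Fin m))) → Vec Bool m → Bool
  hitAll [] ω = true
  hitAll (F ∷ Fs) ω = not (none F ω) ∧ hitAll Fs ω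

  hitAll⁻ : ∀ {m} (Fs : List (List (List (Fin m)))) {ω} → hitAll Fs ω ≡ true → ∀ F → F ∈ Fs → none F ω ≡ false
  hitAll⁻ (G ∷ Fs) {ω} h F F∈ with none G ω in e
  hitAll⁻ (G ∷ Fs) {ω} h F (here refl) | false = e
  hitAll⁻ (G ∷ Fs) {ω} h F (there F∈) | false = hitAll⁻ Fs h F F∈

  hitAll-⊑ : ∀ {m} (Fs : List (List (List (Fin m)))) {ω ω′} → ω ⊑ ω′ → hitAll Fs ω ≡ true → hitAll Fs ω′ ≡ true
  hitAll-⊑ [] le h = refl
  hitAll-⊑ (F ∷ Fs) {ω} {ω′} le h with none F ω in e
  ... | false with none F ω′ in e′
  ...   | false = hitAll-⊑ Fs {ω} {ω′} le h
  ...   | true with trans (sym e) (none-⊑ F {ω} {ω′} le e′)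
  ...     | ()

  hitAll-likely : ∀ {m p} → 0ℚ ≤ p → p ≤ 1ℚ → (Fs : List (List (List (Fin m)))) →
    1ℚ - ∑ Fs (λ F → E p (ind ∘ none F)) ≤ E p (ind ∘ hitAll Fs)
  hitAll-likely {m} {p} _ _ [] = ≤-reflexive (sym (E-const m p 1ℚ))
  hitAll-likely {m} {p} 0≤p p≤1 (F ∷ Fs) = begin
    1ℚ - (E p (ind ∘ none F) + S) ≡⟨ solve 2 (λ a b → con 1ℚ :- (a :+ b) := (con 1ℚ :- b) :- a) refl (E p (ind ∘ none F)) S ⟩
    (1ℚ - S) - E p (ind ∘ none F) ≤⟨ +-monoˡ-≤ (- E p (ind ∘ none F)) (hitAll-likely 0≤p p≤1 Fs) ⟩
    E p (ind ∘ hitAll Fs) - E p (ind ∘ none F) ≡⟨ sym (E-sub p (ind ∘ hitAll Fs) (ind ∘ none F)) ⟩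
    E p (λ ω → ind (hitAll Fs ω) - ind (none F ω)) ≤⟨ E-mono 0≤p p≤1 (λ ω → pointwise (none F ω) (hitAll Fs ω)) ⟩
    E p (ind ∘ hitAll (F ∷ Fs)) ∎
    where
    open ≤-Reasoning
    open +-*-Solver
    S = ∑ Fs (λ F → E p (ind ∘ none F))
    pointwise : ∀ a b → ind b - ind a ≤ ind (not a ∧ b)
    pointwise false b = ≤-reflexive (+-identityʳ (ind b))
    pointwise true b = sub≤ {ind b} {1ℚ} {0ℚ} (ind≤1 b)

  module Slices {n : ℕ} (h : ℕ) (S : List (Fin n)) where

    rest : ℕ → List (Fin n)
    rest zero = S
    rest (suc i) = drop h (rest i)

    slice : Fin 4 → List (Fin n)
    slice i = take h (rest (toℕ i))

    rest-length : ∀ i → length (rest i) ≡ length S ℕ.∸ i ℕ.* h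
    rest-length zero = refl
    rest-length (suc i) = trans (length-drop h (rest i)) (trans (cong (ℕ._∸ h) (rest-length i))
      (trans (ℕP.∸-+-assoc (length S) (i ℕ.* h) h) (cong (length S ℕ.∸_) (ℕP.+-comm (i ℕ.* h) h))))

    ∈-drop : ∀ {x : Fin n} k xs → x ∈ drop k xs → x ∈ xs
    ∈-drop {x} k xs x∈ = subst (x ∈_) (take++drop≡id k xs) (∈-++⁺ʳ (take k xs) x∈)

    ∈-take : ∀ {x : Fin n} k xs → x ∈ take k xs → x ∈ xs
    ∈-take {x} k xs x∈ = subst (x ∈_) (take++drop≡id k xs) (∈-++⁺ˡ x∈)

    rest-⊆ : ∀ {x} i → x ∈ rest i → x ∈ S
    rest-⊆ zero x∈ = x∈
    rest-⊆ (suc i) x∈ = rest-⊆ i (∈-drop h (rest i) x∈)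

    slice-⊆ : ∀ {x} i → x ∈ slice i → x ∈ S
    slice-⊆ i x∈ = rest-⊆ (toℕ i) (∈-take h (rest (toℕ i)) x∈)

    module _ (u : Unique S) where

      rest-unique : ∀ i → Unique (rest i)
      rest-unique zero = u
      rest-unique (suc i) = Uniq.drop⁺ h (rest-unique i)

      slice-unique : ∀ i → Unique (slice i)
      slice-unique i = Uniq.take⁺ h (rest-unique (toℕ i))

      take-drop-disjoint : ∀ {x : Fin n} k {xs} → Unique xs → x ∈ take k xs → x ∉ drop k xs
      take-drop-disjoint (suc k) {y ∷ xs} (y∉ ∷ _) (here refl) x∈ = All.lookup y∉ (∈-drop k xs x∈) refl
      take-drop-disjoint (suc k) {y ∷ xs} (_ ∷ U) (there h₁) x∈ = take-drop-disjoint k U h₁ x∈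

      rest-mono : ∀ {x} i d → x ∈ rest (d ℕ.+ i) → x ∈ rest i
      rest-mono i zero x∈ = x∈
      rest-mono i (suc d) x∈ = rest-mono i d (∈-drop h (rest (d ℕ.+ i)) x∈)

      later : ∀ {x} i j → toℕ i ℕ.< toℕ j → x ∈ slice i → x ∉ slice j
      later {x} i j i<j x∈i x∈j = take-drop-disjoint h (rest-unique (toℕ i)) x∈i
        (rest-mono (suc (toℕ i)) (toℕ j ℕ.∸ suc (toℕ i))
          (subst (λ t → x ∈ rest t) (sym (ℕP.m∸n+n≡m i<j)) (∈-take h (rest (toℕ j)) x∈j)))

      slice-disjoint : ∀ {i j x} → x ∈ slice i → x ∈ slice j → i ≡ j
      slice-disjoint {i} {j} x∈i x∈j with FinP.<-cmp i j
      ... | tri≈ _ e _ = e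
      ... | tri< i<j _ _ = ⊥-elim (later i j i<j x∈i x∈j)
      ... | tri> _ _ j<i = ⊥-elim (later j i j<i x∈j x∈i)

    slice-length : 4 ℕ.* h ℕ.≤ length S → ∀ i → length (slice i) ≡ h
    slice-length 4h≤ i = trans (length-take h (rest (toℕ i))) (ℕP.m≤n⇒m⊓n≡m (subst (h ℕ.≤_) (sym (rest-length (toℕ i))) enough))
      where
      enough : h ℕ.≤ length S ℕ.∸ toℕ i ℕ.* h
      enough = subst (ℕ._≤ length S ℕ.∸ toℕ i ℕ.* h) (ℕP.m+n∸n≡m h (toℕ i ℕ.* h))
        (ℕP.∸-monoˡ-≤ (toℕ i ℕ.* h) (ℕP.≤-trans (ℕP.*-monoˡ-≤ h (FinP.toℕ<n i)) 4h≤))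

  module Union {n M : ℕ} (𝒮 : Slotting n M) where
    open Slotting 𝒮
    open Quadruples 𝒮

    -- One family for each vertex set of size at least 4 h: the cliques transversal to its first
    -- four slices of size h. Hitting every family puts a random K4 into every such set.
    families : ℕ → List (List (List (Fin M)))
    families h = map (λ S → map mask (quads (Slices.slice h S))) (filter (λ S → 4 ℕ.* h ℕ.≤? length S) (subs (allFin n)))

    SortedMono : Vec Bool M → (Fin n → Fin n → Bool) → Set
    SortedMono U χ = Σ (Fin n) λ a → Σ (Fin n) λ b → Σ (Fin n) λ c → Σ (Fin n) λ d → Σ Bool λ col →
      (a Fin.< b) × (b Fin.< c) × (c Fin.< d) ×
      (Adj U a b × Adj U a c × Adj U a d × Adj U b c × Adj U b d × Adj U c d) ×
      (χ a b ≡ col × χ a c ≡ col × χ a d ≡ col × χ b c ≡ col × χ b d ≡ col × χ c d ≡ col)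

    -- Decidability makes the argument by contradiction in `arrows` constructive.
    sortedMono? : ∀ U χ → Dec (SortedMono U χ)
    sortedMono? U χ = FinP.any? λ a → FinP.any? λ b → FinP.any? λ c → FinP.any? λ d → anyBool? λ col →
      (a FinP.<? b) ×-dec (b FinP.<? c) ×-dec (c FinP.<? d) ×-dec
      (Adj? U a b ×-dec Adj? U a c ×-dec Adj? U a d ×-dec Adj? U b c ×-dec Adj? U b d ×-dec Adj? U c d) ×-dec
      ((χ a b BoolP.≟ col) ×-dec (χ a c BoolP.≟ col) ×-dec (χ a d BoolP.≟ col) ×-dec (χ b c BoolP.≟ col) ×-dec (χ b d BoolP.≟ col) ×-dec (χ c d BoolP.≟ col))
      where
      anyBool? : ∀ {P : Bool → Set} → (∀ b → Dec (P b)) → Dec (Σ Bool P)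
      anyBool? P? with P? true | P? false
      ... | yes p | _ = yes (true , p)
      ... | no _ | yes p = yes (false , p)
      ... | no p | no q = no λ { (true , h) → p h ; (false , h) → q h }

    module Coloured (U : Vec Bool M) (χ : Fin n → Fin n → Bool) where

      -- A colouring is meaningful only on increasing pairs; dependent random choice meets edges
      -- from both ends and needs this symmetric version.
      χˢ : Fin n → Fin n → Bool
      χˢ x y = if does (x FinP.<? y) then χ x y else χ y x

      χˢ-< : ∀ {x y} → x Fin.< y → χˢ x y ≡ χ x y
      χˢ-< {x} {y} x<y = cong (if_then χ x y else χ y x) (dec-true (x FinP.<? y) x<y)

      χˢ-> : ∀ {x y} → y Fin.< x → χˢ x y ≡ χ y x
      χˢ-> {x} {y} y<x = cong (if_then χ x y else χ y x) (dec-false (x FinP.<? y) (FinP.<-asym y<x))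
        where open import Relation.Nullary.Decidable using (dec-false)

      W : Bool → Fin n → Fin n → Set
      W col x y = Adj U x y × χˢ x y ≡ col

      W-sym : ∀ {col x y} → W col x y → W col y x
      W-sym {col} {x} {y} (adj , e) = Adj-sym {U} adj , trans (flip (FinP.<-cmp x y)) e
        where
        flip : Relation.Binary.Tri (x Fin.< y) (x ≡ y) (y Fin.< x) → χˢ y x ≡ χˢ x y
        flip (tri< x<y _ _) = trans (χˢ-> x<y) (sym (χˢ-< x<y))
        flip (tri≈ _ refl _) = refl
        flip (tri> _ _ y<x) = trans (χˢ-< y<x) (sym (χˢ-> y<x))

      sorted : ∀ {col a b c d} → a Fin.< b → b Fin.< c → c Fin.< d →
        W col a b → W col a c → W col a d → W col b c → W col b d → W col c d → SortedMono U χ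
      sorted {col} {a} {b} {c} {d} a<b b<c c<d (ab , eab) (ac , eac) (ad , ead) (bc , ebc) (bd , ebd) (cd , ecd) =
        a , b , c , d , col , a<b , b<c , c<d , (ab , ac , ad , bc , bd , cd) ,
        (trans (sym (χˢ-< a<b)) eab , trans (sym (χˢ-< (FinP.<-trans a<b b<c))) eac , trans (sym (χˢ-< (FinP.<-trans a<b (FinP.<-trans b<c c<d)))) ead ,
         trans (sym (χˢ-< b<c)) ebc , trans (sym (χˢ-< (FinP.<-trans b<c c<d))) ebd , trans (sym (χˢ-< c<d)) ecd)

      order : ∀ {col x y} → W col x y → x Fin.< y ⊎ y Fin.< x
      order {col} {x} {y} (adj , _) with FinP.<-cmp x y
      ... | tri< h _ _ = inj₁ h
      ... | tri≈ _ e _ = ⊥-elim (Adj⇒≢ {U} adj e)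
      ... | tri> _ _ h = inj₂ h

      -- Merge sort with at most five comparisons: `a b` and `c d` are ordered first and then
      -- merged.
      sort : ∀ {col a b c d} → W col a b → W col a c → W col a d → W col b c → W col b d → W col c d → SortedMono U χ
      sort {col} ab ac ad bc bd cd = first ab ac ad bc bd cd
        where
        third : ∀ {a b c d} → a Fin.< b → c Fin.< d → a Fin.< c →
          W col a b → W col a c → W col a d → W col b c → W col b d → W col c d → SortedMono U χ
        third a<b c<d a<c ab ac ad bc bd cd with order bc
        ... | inj₁ b<c = sorted a<b b<c c<d ab ac ad bc bd cd
        ... | inj₂ c<b with order bd
        ...   | inj₁ b<d = sorted a<c c<b b<d ac ab ad (W-sym bc) cd bd
        ...   | inj₂ d<b = sorted a<c c<d d<b ac ad ab cd (W-sym bc) (W-sym bd)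
        second : ∀ {a b c d} → a Fin.< b → c Fin.< d →
          W col a b → W col a c → W col a d → W col b c → W col b d → W col c d → SortedMono U χ
        second a<b c<d ab ac ad bc bd cd with order ac
        ... | inj₁ a<c = third a<b c<d a<c ab ac ad bc bd cd
        ... | inj₂ c<a = third c<d a<b c<a cd (W-sym ac) (W-sym bc) (W-sym ad) (W-sym bd) ab
        half : ∀ {a b c d} → a Fin.< b →
          W col a b → W col a c → W col a d → W col b c → W col b d → W col c d → SortedMono U χ
        half a<b ab ac ad bc bd cd with order cd
        ... | inj₁ c<d = second a<b c<d ab ac ad bc bd cd
        ... | inj₂ d<c = second a<b d<c ab ad ac bd bc (W-sym cd)
        first : ∀ {a b c d} → W col a b → W col a c → W col a d → W col b c → W col b d → W col c d → SortedMono U χ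
        first ab ac ad bc bd cd with order ab
        ... | inj₁ a<b = half a<b ab ac ad bc bd cd
        ... | inj₂ b<a = half b<a (W-sym ab) bc bd ac ad cd

    adj : Vec Bool M → Fin n → Fin n → Bool
    adj G x y = does (Adj? G x y)

    adj⁻ : ∀ G {x y} → adj G x y ≡ true → Adj G x y
    adj⁻ G {x} {y} e with Adj? G x y
    ... | yes a = a

    adj⁺ : ∀ G {x y} → Adj G x y → adj G x y ≡ true
    adj⁺ G {x} {y} a = dec-true (Adj? G x y) a

    present : Vec Bool M → List (Fin M)
    present G = filter (λ k → lookup G k BoolP.≟ true) (allFin M)

    length->>=-Σ : ∀ {A B : Set} (xs : List A) (f : A → List B) → length (xs >>= f) ≡ Σℕ xs (length ∘ f)
    length->>=-Σ [] f = refl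
    length->>=-Σ (x ∷ xs) f = trans (length-++ (f x)) (cong (length (f x) ℕ.+_) (length->>=-Σ xs f))

    -- Each edge is counted from one of its ends only; the lost factor 2 merely affects the constant
    -- `B`.
    edges≤degrees : ∀ G → length (present G) ℕ.≤ Σℕ (allFin n) (λ u → Σℕ (allFin n) (λ x → bit (adj G x u)))
    edges≤degrees G = subst₂ ℕ._≤_ (length-map ends₂ (present G)) size
      (unique-length (Uniq.map⁺ ends₂-injective (Uniq.filter⁺ (λ k → lookup G k BoolP.≟ true) (Uniq.allFin⁺ M))) covered)
      where
      ends₂ : Fin M → Fin n × Fin n
      ends₂ k = proj₁ (joined k) , proj₁ (proj₂ (joined k))
      joins : ∀ k → Joins k (proj₁ (ends₂ k)) (proj₂ (ends₂ k))
      joins k = proj₂ (proj₂ (joined k))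
      ends₂-injective : ∀ {k l} → ends₂ k ≡ ends₂ l → k ≡ l
      ends₂-injective {k} {l} e = Joins-unique (joins k) (subst (λ t → Joins l (proj₁ t) (proj₂ t)) (sym e) (joins l))
      column : Fin n → List (Fin n × Fin n)
      column u = map (_, u) (filterᵇ (λ x → adj G x u) (allFin n))
      size : length (allFin n >>= column) ≡ Σℕ (allFin n) (λ u → Σℕ (allFin n) (λ x → bit (adj G x u)))
      size = trans (length->>=-Σ (allFin n) column) (Σℕ-cong (allFin n) (λ u →
        trans (length-map (_, u) (filterᵇ (λ x → adj G x u) (allFin n))) (length-filterᵇ (λ x → adj G x u) (allFin n))))
      ∈-filterᵇ⁺ : ∀ {A : Set} (f : A → Bool) {x} xs → x ∈ xs → f x ≡ true → x ∈ filterᵇ f xs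
      ∈-filterᵇ⁺ f (y ∷ ys) (here refl) e rewrite e = here refl
      ∈-filterᵇ⁺ f (y ∷ ys) (there x∈) e with f y
      ... | true = there (∈-filterᵇ⁺ f ys x∈ e)
      ... | false = ∈-filterᵇ⁺ f ys x∈ e
      covered : ∀ {e} → e ∈ map ends₂ (present G) → e ∈ (allFin n >>= column)
      covered e∈ with ∈-map⁻ ends₂ e∈
      ... | k , k∈ , refl = ∈->>= {xs = allFin n} {f = column} (∈-allFin (proj₂ (ends₂ k)))
            (∈-map⁺ (_, proj₂ (ends₂ k)) (∈-filterᵇ⁺ (λ x → adj G x (proj₂ (ends₂ k))) (allFin n) (∈-allFin (proj₁ (ends₂ k)))
              (adj⁺ G (k , joins k , proj₂ (∈-filter⁻ (λ k → lookup G k BoolP.≟ true) {xs = allFin M} k∈)))))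

    module _ (G ω : Vec Bool M) {h : ℕ} (hit : hitAll (families h) ω ≡ true) where

      cliques : ∀ S → S ∈ subs (allFin n) → 4 ℕ.* h ℕ.≤ length S → ∃[ a ] ∃[ b ] ∃[ c ] ∃[ d ] ((a ∈ S × b ∈ S × c ∈ S × d ∈ S) ×
        (adj ω a b ≡ true × adj ω a c ≡ true × adj ω a d ≡ true × adj ω b c ≡ true × adj ω b d ≡ true × adj ω c d ≡ true))
      cliques S S∈ 4h≤ =
        let I , I∈ , all = none-false (map mask (quads slice)) (hitAll⁻ (families h) hit _
              (∈-map⁺ (λ S → map mask (quads (Slices.slice h S))) (∈-filter⁺ (λ S → 4 ℕ.* h ℕ.≤? length S) S∈ 4h≤)))
            x , x∈ , I≡ = ∈-map⁻ mask I∈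
        in found x (∈-quads⁻ slice x∈) (subst (λ I → allT I ω ≡ true) I≡ all)
        where
        open Slices h S
        u : Unique S
        u = subs-unique (allFin n) (Uniq.allFin⁺ n) S∈
        found : ∀ x → x ∈ᵇ slice → allT (mask x) ω ≡ true → ∃[ a ] ∃[ b ] ∃[ c ] ∃[ d ] ((a ∈ S × b ∈ S × c ∈ S × d ∈ S) ×
          (adj ω a b ≡ true × adj ω a c ≡ true × adj ω a d ≡ true × adj ω b c ≡ true × adj ω b d ≡ true × adj ω c d ≡ true))
        found x x∈ all = lookup x 0F , lookup x 1F , lookup x 2F , lookup x 3F ,
          (slice-⊆ 0F (x∈ 0F) , slice-⊆ 1F (x∈ 1F) , slice-⊆ 2F (x∈ 2F) , slice-⊆ 3F (x∈ 3F)) ,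
          (edge (λ ()) , edge (λ ()) , edge (λ ()) , edge (λ ()) , edge (λ ()) , edge (λ ()))
          where
          edge : ∀ {i j} → i ≢ j → adj ω (lookup x i) (lookup x j) ≡ true
          edge {i} {j} i≢j = adj⁺ ω (proj₁ joint , proj₂ joint , allT⁻ {I = mask x} all (proj₁ joint) (∈-mask {0ℚ} ≤-refl x i≢j (proj₂ joint)))
            where
            joint : ∃[ k ] Joins k (lookup x i) (lookup x j)
            joint = joining (λ e → i≢j (slice-disjoint u (x∈ i) (subst (_∈ slice j) (sym e) (x∈ j))))

      U = Vec.zipWith _∨_ G ω

      arrows : ∀ {B r k} → 0 ℕ.< n → {{_ : ℕ.NonZero B}} → 4 ℕ.* h ℕ.* B ℕ.* r ℕ.≤ n → 2 ℕ.* B ℕ.* (n ℕ.* n) ℕ.< r ℕ.^ k →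
        2 ℕ.* B ℕ.* (4 ℕ.* h ℕ.* B ℕ.^ k) ℕ.≤ n → 4 ℕ.* (n ℕ.* n) ℕ.≤ B ℕ.* length (present G) →
        ∀ χ → SortedMono U χ
      arrows {B} {r} {k} 0<n codegree rounds survivors dense χ = decidable-stable (sortedMono? U χ) λ ¬mono →
        Ramsey.impossible g (adj ω) χˢ W W-sym W-dense W-random
          (λ ab ac ad bc bd cd → ¬mono (sort ab ac ad bc bd cd)) {4 ℕ.* h} cliques {B} {r} {k} 0<n codegree rounds survivors many
        where
        open Coloured U χ
        g : Bool → Fin n → Fin n → Bool
        g col x y = adj G x y ∧ does (χˢ x y BoolP.≟ col)
        U-lookup : ∀ k → lookup G k ≡ true ⊎ lookup ω k ≡ true → lookup U k ≡ true
        U-lookup k (inj₁ e) = trans (lookup-zipWith _∨_ k G ω) (cong (_∨ lookup ω k) e)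
        U-lookup k (inj₂ e) = trans (lookup-zipWith _∨_ k G ω) (trans (cong (lookup G k ∨_) e) (BoolP.∨-zeroʳ (lookup G k)))
        W-random : ∀ {x y} → adj ω x y ≡ true → W (χˢ x y) x y
        W-random e = let k , j , t = adj⁻ ω e in (k , j , U-lookup k (inj₂ t)) , refl
        W-dense : ∀ {col x y} → g col x y ≡ true → W col x y
        W-dense {col} {x} {y} e =
          let p , q = ∧-true (adj G x y) (does (χˢ x y BoolP.≟ col)) e
              k , j , t = adj⁻ G p
          in (k , j , U-lookup k (inj₁ t)) , does-true (χˢ x y BoolP.≟ col) q
          where
          ∧-true : ∀ a b → a ∧ b ≡ true → a ≡ true × b ≡ true
          ∧-true true true _ = refl , refl
          does-true : ∀ {P : Set} (P? : Dec P) → does P? ≡ true → P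
          does-true (yes p) _ = p
        degrees : Bool → ℕ
        degrees col = Σℕ (allFin n) (λ u → Σℕ (allFin n) (λ x → bit (g col x u)))
        split : ∀ b c → bit (b ∧ does (c BoolP.≟ true)) ℕ.+ bit (b ∧ does (c BoolP.≟ false)) ≡ bit b
        split true true = refl
        split true false = refl
        split false c = refl
        both : degrees true ℕ.+ degrees false ≡ Σℕ (allFin n) (λ u → Σℕ (allFin n) (λ x → bit (adj G x u)))
        both = trans (sym (Σℕ-+ (allFin n))) (Σℕ-cong (allFin n) (λ u → trans (sym (Σℕ-+ (allFin n))) (Σℕ-cong (allFin n) (λ x → split (adj G x u) (χˢ x u)))))
        many : 4 ℕ.* (n ℕ.* n) ℕ.≤ B ℕ.* (degrees true ℕ.+ degrees false)
        many = ℕP.≤-trans dense (ℕP.*-monoʳ-≤ B (ℕP.≤-trans (edges≤degrees G) (ℕP.≤-reflexive (sym both))))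

-- Choice of the integer parameters.

module Params where
  open import Data.Nat
  open import Data.Nat.Properties
  open import Data.Nat.Solver using (module +-*-Solver)

  root : ∀ k n → 1 ≤ n → ∃[ t ] (t ^ suc k ≤ n × n < suc t ^ suc k)
  root k (suc zero) _ = 1 , ≤-reflexive (^-zeroˡ (suc k)) , <-≤-trans (s≤s (s≤s z≤n)) (m≤m*n 2 (2 ^ k) {{m^n≢0 2 k}})
  root k (suc n@(suc _)) _ with root k n (s≤s z≤n)
  ... | t , lo , hi with suc n <? suc t ^ suc k
  ...   | yes h = t , m≤n⇒m≤1+n lo , h
  ...   | no ¬h = suc t , ≮⇒≥ ¬h , ≤-<-trans hi (^-monoˡ-< (suc k) (n<1+n (suc t)))

  ^-distrib-* : ∀ k m n → (m * n) ^ k ≡ m ^ k * n ^ k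
  ^-distrib-* zero m n = refl
  ^-distrib-* (suc k) m n = trans (cong (m * n *_) (^-distrib-* k m n))
    (solve 4 (λ a b c d → (a :* b) :* (c :* d) := (a :* c) :* (b :* d)) refl m n (m ^ k) (n ^ k))
    where open +-*-Solver

  -- The probability is lowered to 1 / q; every set of 4 h vertices is to contain a random K4;
  -- dependent random choice runs for k rounds with gain r in each. `B` is the inverse edge density
  -- up to a constant and `b` the denominator of ε.
  record Sizes (B b n : ℕ) : Set where
    field
      q h r k : ℕ
      0<n : 0 < n
      1≤q : 1 ≤ q
      sparse : ∀ a → 0 < a → n ^ b ≤ q ^ (2 * b) * n ^ (2 * a)
      manyCliques : 4 * (n * q ^ 6) ≤ h * (h * (h * h))
      fewOverlaps : 12 * (h * h) + 8 * (h * (q * q)) ≤ q ^ 5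
      codegree : 4 * h * B * r ≤ n
      rounds : 2 * B * (n * n) < r ^ k
      survivors : 2 * B * (4 * h * B ^ k) ≤ n

  -- The exponents are variables, as 2 ^ K would otherwise be unfolded.
  module Choose (B b s K k : ℕ) (s≡ : s ≡ b + 6) (K≡ : K ≡ s + s + 4) (k≡ : k ≡ suc (K + K)) (T : ℕ)
    (T₁ : 2 ^ (K * b) ≤ T) (T₂ : 4 * 2 ^ K ≤ T) (T₃ : 20 ≤ T) (T₄ : 4 * B ≤ T)
    (T₅ : 2 * B * (2 ^ K * 2 ^ K) + 1 ≤ T) (T₆ : 8 * B * B ^ k ≤ T) where

    module _ (n : ℕ) (n≥ : suc T ^ K ≤ n) where
      open ≤-Reasoning
      open +-*-Solver
      0<n : 0 < n
      0<n = ≤-trans (m^n>0 (suc T) K) n≥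
      K′≡ : suc (s + s + 3) ≡ K
      K′≡ = trans (sym (+-suc (s + s) 3)) (sym K≡)
      rt : ∃[ t ] (t ^ K ≤ n × n < suc t ^ K)
      rt = subst (λ K → ∃[ t ] (t ^ K ≤ n × n < suc t ^ K)) K′≡ (root (s + s + 3) n 0<n)
      t = proj₁ rt
      lo : t ^ K ≤ n
      lo = proj₁ (proj₂ rt)
      T≤t : T ≤ t
      T≤t = ≮⇒≥ λ t<T → <⇒≱ (proj₂ (proj₂ rt)) (≤-trans (^-monoˡ-≤ K (≤-trans t<T (n≤1+n T))) n≥)
      bound₁ : 2 ^ (K * b) ≤ t
      bound₁ = ≤-trans T₁ T≤t
      bound₂ : 4 * 2 ^ K ≤ t
      bound₂ = ≤-trans T₂ T≤t
      bound₃ : 20 ≤ t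
      bound₃ = ≤-trans T₃ T≤t
      bound₄ : 4 * B ≤ t
      bound₄ = ≤-trans T₄ T≤t
      bound₅ : 2 * B * (2 ^ K * 2 ^ K) + 1 ≤ t
      bound₅ = ≤-trans T₅ T≤t
      bound₆ : 8 * B * B ^ k ≤ t
      bound₆ = ≤-trans T₆ T≤t
      1≤t : 1 ≤ t
      1≤t = ≤-trans (s≤s z≤n) bound₃
      instance
        t≢0 : NonZero t
        t≢0 = >-nonZero 1≤t
        n≢0 : NonZero n
        n≢0 = >-nonZero 0<n
      hi : n ≤ 2 ^ K * t ^ K
      hi = begin
        n ≤⟨ <⇒≤ (proj₂ (proj₂ rt)) ⟩
        suc t ^ K ≤⟨ ^-monoˡ-≤ K (subst (suc t ≤_) (cong (t +_) (sym (+-identityʳ t))) (+-monoˡ-≤ t 1≤t)) ⟩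
        (2 * t) ^ K ≡⟨ ^-distrib-* K 2 t ⟩
        2 ^ K * t ^ K ∎
      x = t ^ s
      h = x * x * (t * t)
      1≤x : 1 ≤ x
      1≤x = m^n>0 t s
      t^K : t ^ K ≡ x * x * (t * t * t * t)
      t^K = begin-equality
        t ^ K ≡⟨ cong (t ^_) K≡ ⟩
        t ^ (s + s + 4) ≡⟨ trans (^-distribˡ-+-* t (s + s) 4) (cong (_* t ^ 4) (^-distribˡ-+-* t s s)) ⟩
        x * x * t ^ 4 ≡⟨ solve 2 (λ t x → x :* x :* (t :* (t :* (t :* (t :* con 1)))) := x :* x :* (t :* t :* t :* t)) refl t x ⟩
        x * x * (t * t * t * t) ∎
      t≤t⁴ : t ≤ t * t * t * t
      t≤t⁴ = ≤-trans (m≤m*n t (t * t * t) {{m*n≢0 (t * t) t {{m*n≢0 t t}}}})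
        (≤-reflexive (solve 1 (λ t → t :* (t :* t :* t) := t :* t :* t :* t) refl t))
      sparse : ∀ a → 0 < a → n ^ b ≤ x ^ (2 * b) * n ^ (2 * a)
      sparse a 0<a = begin
        n ^ b ≤⟨ ^-monoˡ-≤ b hi ⟩
        (2 ^ K * t ^ K) ^ b ≡⟨ trans (^-distrib-* b (2 ^ K) (t ^ K)) (cong₂ _*_ (^-*-assoc 2 K b) (^-*-assoc t K b)) ⟩
        2 ^ (K * b) * t ^ (K * b) ≤⟨ *-monoˡ-≤ (t ^ (K * b)) bound₁ ⟩
        t ^ (1 + K * b) ≤⟨ ^-monoʳ-≤ t exponents ⟩
        t ^ (s * (2 * b) + K * 2) ≡⟨ trans (^-distribˡ-+-* t (s * (2 * b)) (K * 2)) (cong₂ _*_ (sym (^-*-assoc t s (2 * b))) (sym (^-*-assoc t K 2))) ⟩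
        x ^ (2 * b) * (t ^ K) ^ 2 ≤⟨ *-monoʳ-≤ (x ^ (2 * b)) (≤-trans (^-monoˡ-≤ 2 lo) (^-monoʳ-≤ n (*-monoʳ-≤ 2 0<a))) ⟩
        x ^ (2 * b) * n ^ (2 * a) ∎
        where
        -- As K = 2 s + 4, the claim is 4 b + 1 ≤ 2 K, and s = b + 6 gives 2 K = 4 b + 32. So ε ≥ 1
        -- / b, that is a ≥ 1, is all that is used of ε.
        exponents : 1 + K * b ≤ s * (2 * b) + K * 2
        exponents rewrite K≡ | s≡ = ≤-trans (m≤m+n _ 31) (≤-reflexive (solve 1 (λ b →
          con 1 :+ ((b :+ con 6) :+ (b :+ con 6) :+ con 4) :* b :+ con 31 :=
          (b :+ con 6) :* (con 2 :* b) :+ ((b :+ con 6) :+ (b :+ con 6) :+ con 4) :* con 2) refl b))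
      manyCliques : 4 * (n * x ^ 6) ≤ h * (h * (h * h))
      manyCliques = begin
        4 * (n * x ^ 6) ≤⟨ *-monoʳ-≤ 4 (*-monoˡ-≤ (x ^ 6) hi) ⟩
        4 * (2 ^ K * t ^ K * x ^ 6) ≡⟨ cong (λ y → 4 * (2 ^ K * y * x ^ 6)) t^K ⟩
        4 * (2 ^ K * (x * x * (t * t * t * t)) * x ^ 6)
          ≡⟨ solve 3 (λ c x t → con 4 :* (c :* (x :* x :* (t :* t :* t :* t)) :* (x :* (x :* (x :* (x :* (x :* (x :* con 1)))))))
               := (con 4 :* c) :* (x :* x :* (x :* x) :* (x :* x :* (x :* x)) :* (t :* t :* t :* t))) refl (2 ^ K) x t ⟩
        (4 * 2 ^ K) * (x * x * (x * x) * (x * x * (x * x)) * (t * t * t * t)) ≤⟨ *-monoˡ-≤ _ (≤-trans bound₂ t≤t⁴) ⟩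
        (t * t * t * t) * (x * x * (x * x) * (x * x * (x * x)) * (t * t * t * t))
          ≡⟨ solve 2 (λ x t → (t :* t :* t :* t) :* (x :* x :* (x :* x) :* (x :* x :* (x :* x)) :* (t :* t :* t :* t))
               := (x :* x :* (t :* t)) :* ((x :* x :* (t :* t)) :* ((x :* x :* (t :* t)) :* (x :* x :* (t :* t))))) refl x t ⟩
        h * (h * (h * h)) ∎
      5≤s : 5 ≤ s
      5≤s = subst (5 ≤_) (sym s≡) (≤-trans (n≤1+n 5) (m≤n+m 6 b))
      fewOverlaps : 12 * (h * h) + 8 * (h * (x * x)) ≤ x ^ 5
      fewOverlaps = begin
        12 * (h * h) + 8 * (h * (x * x)) ≤⟨ +-monoʳ-≤ (12 * (h * h)) (*-monoʳ-≤ 8 (*-monoʳ-≤ h (m≤m*n (x * x) (t * t) {{m*n≢0 t t}}))) ⟩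
        12 * (h * h) + 8 * (h * h) ≡⟨ solve 2 (λ x t → con 12 :* ((x :* x :* (t :* t)) :* (x :* x :* (t :* t))) :+ con 8 :* ((x :* x :* (t :* t)) :* (x :* x :* (t :* t)))
             := (con 20 :* (t :* (t :* (t :* (t :* con 1))))) :* (x :* (x :* (x :* (x :* con 1))))) refl x t ⟩
        -- The constant and the four powers of t fit into t⁵ ≤ t^s = x; this is why s is at least 5.
        (20 * t ^ 4) * x ^ 4 ≤⟨ *-monoˡ-≤ (x ^ 4) (≤-trans (*-monoˡ-≤ (t ^ 4) bound₃) (^-monoʳ-≤ t 5≤s)) ⟩
        x * x ^ 4 ∎
      codegree : 4 * h * B * t ≤ n
      codegree = begin
        4 * h * B * t ≡⟨ solve 3 (λ x t B → con 4 :* (x :* x :* (t :* t)) :* B :* t := (con 4 :* B) :* (x :* x :* (t :* t) :* t)) refl x t B ⟩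
        (4 * B) * (h * t) ≤⟨ *-monoˡ-≤ (h * t) bound₄ ⟩
        t * (h * t) ≡⟨ solve 2 (λ x t → t :* (x :* x :* (t :* t) :* t) := x :* x :* (t :* t :* t :* t)) refl x t ⟩
        x * x * (t * t * t * t) ≡⟨ sym t^K ⟩
        t ^ K ≤⟨ lo ⟩
        n ∎
      -- By k = 2 K + 1, t^(2K) accounts for n² up to constants and the spare factor t absorbs them.
      rounds : 2 * B * (n * n) < t ^ k
      rounds = begin-strict
        2 * B * (n * n) ≤⟨ *-monoʳ-≤ (2 * B) (*-mono-≤ hi hi) ⟩
        2 * B * (2 ^ K * t ^ K * (2 ^ K * t ^ K))
          ≡⟨ solve 3 (λ B c y → con 2 :* B :* (c :* y :* (c :* y)) := con 2 :* B :* (c :* c) :* (y :* y)) refl B (2 ^ K) (t ^ K) ⟩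
        2 * B * (2 ^ K * 2 ^ K) * (t ^ K * t ^ K) <⟨ *-monoˡ-< (t ^ K * t ^ K) {{m*n≢0 (t ^ K) (t ^ K) {{m^n≢0 t K}} {{m^n≢0 t K}}}} (subst (_≤ t) (+-comm _ 1) bound₅) ⟩
        t * (t ^ K * t ^ K) ≡⟨ trans (cong (t *_) (sym (^-distribˡ-+-* t K K))) (cong (t ^_) (sym k≡)) ⟩
        t ^ k ∎
      survivors : 2 * B * (4 * h * B ^ k) ≤ n
      survivors = begin
        2 * B * (4 * h * B ^ k) ≡⟨ solve 4 (λ x t B c → con 2 :* B :* (con 4 :* (x :* x :* (t :* t)) :* c) := (con 8 :* B :* c) :* (x :* x :* (t :* t))) refl x t B (B ^ k) ⟩
        (8 * B * B ^ k) * h ≤⟨ *-monoˡ-≤ h (≤-trans bound₆ (m≤m*n t t)) ⟩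
        (t * t) * h ≡⟨ solve 2 (λ x t → (t :* t) :* (x :* x :* (t :* t)) := x :* x :* (t :* t :* t :* t)) refl x t ⟩
        x * x * (t * t * t * t) ≡⟨ sym t^K ⟩
        t ^ K ≤⟨ lo ⟩
        n ∎

    -- With t ≈ n^(1/K), the choice is q = t^s, h = t^(2s+2), r = t.
    chosen : ∃[ n₀ ] (∀ n → n₀ ≤ n → Sizes B b n)
    chosen = suc T ^ K , λ n n≥ → record
      { q = x n n≥ ; h = h n n≥ ; r = t n n≥ ; k = k ; 0<n = 0<n n n≥ ; 1≤q = 1≤x n n≥ ; sparse = sparse n n≥ ; manyCliques = manyCliques n n≥
      ; fewOverlaps = fewOverlaps n n≥ ; codegree = codegree n n≥ ; rounds = rounds n n≥ ; survivors = survivors n n≥ }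

  six : ∀ a b c d e f → let T = a + b + c + d + e + f in a ≤ T × b ≤ T × c ≤ T × d ≤ T × e ≤ T × f ≤ T
  six a b c d e f =
    ≤-trans ab abcdef , ≤-trans (m≤n+m b a) abcdef , ≤-trans (m≤n+m c (a + b)) cdef , ≤-trans (m≤n+m d (a + b + c)) def ,
    ≤-trans (m≤n+m e (a + b + c + d)) ef , m≤n+m f (a + b + c + d + e)
    where
    ef = m≤m+n (a + b + c + d + e) f
    def = ≤-trans (m≤m+n (a + b + c + d) e) ef
    cdef = ≤-trans (m≤m+n (a + b + c) d) def
    abcdef = ≤-trans (m≤m+n (a + b) c) cdef
    ab = m≤m+n a b

  sizes : ∀ B b → ∃[ n₀ ] (∀ n → n₀ ≤ n → Sizes B b n)
  sizes B b =
    let T₁ , T₂ , T₃ , T₄ , T₅ , T₆ = six (2 ^ (K * b)) (4 * 2 ^ K) 20 (4 * B) (2 * B * (2 ^ K * 2 ^ K) + 1) (8 * B * B ^ k)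
    in Choose.chosen B b (b + 6) K k refl refl refl _ T₁ T₂ T₃ T₄ T₅ T₆
    where
    K = b + 6 + (b + 6) + 4
    k = suc (K + K)

-- Part (i): the union bound over all large vertex sets.

module PartOne where
  open Rat
  open Sums
  open Prob
  open Slots
  open DRC using (subs)
  open Cliques
  open OneGraph
  open Params using (Sizes; sizes)
  open import Data.Rational
  open import Data.Rational.Properties
  open import Data.Rational.Solver using (module +-*-Solver)

  bernoulli : ∀ {y} → 0ℚ ≤ y → ∀ k → 1ℚ + ℕtoℚ k * y ≤ (1ℚ + y) ^ℚ k
  bernoulli {y} 0≤y zero = ≤-reflexive (trans (cong (1ℚ +_) (*-zeroˡ y)) (+-identityʳ 1ℚ))
  bernoulli {y} 0≤y (suc k) = begin
    1ℚ + ℕtoℚ (suc k) * y ≡⟨ cong (λ t → 1ℚ + t * y) (ℕtoℚ-+ 1 k) ⟩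
    1ℚ + (1ℚ + ℕtoℚ k) * y ≤⟨ x≤x+y (0≤* 0≤y (0≤* (0≤ℕ k) 0≤y)) ⟩
    1ℚ + (1ℚ + ℕtoℚ k) * y + y * (ℕtoℚ k * y) ≡⟨ solve 2 (λ y k → con 1ℚ :+ (con 1ℚ :+ k) :* y :+ y :* (k :* y) := (con 1ℚ :+ y) :* (con 1ℚ :+ k :* y)) refl y (ℕtoℚ k) ⟩
    (1ℚ + y) * (1ℚ + ℕtoℚ k * y) ≤⟨ *-monoˡ (0≤+ 0≤1 0≤y) (bernoulli 0≤y k) ⟩
    (1ℚ + y) * (1ℚ + y) ^ℚ k ∎
    where
    open ≤-Reasoning
    open +-*-Solver

  -- From (1 + y)^k ≥ 1 + k y = 2 and (1 - y)(1 + y) ≤ 1; it stands in for the exponential estimate.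
  decay : ∀ {y} k → 0ℚ ≤ y → y ≤ 1ℚ → ℕtoℚ k * y ≡ 1ℚ → (1ℚ - y) ^ℚ k ≤ ½
  decay {y} k 0≤y y≤1 ky≡1 = begin
    z ^ℚ k ≡⟨ solve 1 (λ a → a := con ½ :* (a :* con (1ℚ + 1ℚ))) refl (z ^ℚ k) ⟩
    ½ * (z ^ℚ k * (1ℚ + 1ℚ)) ≡⟨ cong (λ t → ½ * (z ^ℚ k * (1ℚ + t))) (sym ky≡1) ⟩
    ½ * (z ^ℚ k * (1ℚ + ℕtoℚ k * y)) ≤⟨ *-monoˡ 0≤½ (*-monoˡ (^-nonneg k 0≤z) (bernoulli 0≤y k)) ⟩
    ½ * (z ^ℚ k * (1ℚ + y) ^ℚ k) ≡⟨ cong (½ *_) (sym (^-distrib-* z (1ℚ + y) k)) ⟩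
    ½ * (z * (1ℚ + y)) ^ℚ k ≤⟨ *-monoˡ 0≤½ (^-≤1 k (0≤* 0≤z (0≤+ 0≤1 0≤y)) product≤1) ⟩
    ½ * 1ℚ ≡⟨ *-identityʳ ½ ⟩
    ½ ∎
    where
    open ≤-Reasoning
    open +-*-Solver
    z = 1ℚ - y
    0≤½ : 0ℚ ≤ ½
    0≤½ = nonNegative⁻¹ ½
    0≤z : 0ℚ ≤ z
    0≤z = 0≤sub y≤1
    product≤1 : z * (1ℚ + y) ≤ 1ℚ
    product≤1 = ≤-trans (≤-reflexive (solve 1 (λ y → (con 1ℚ :- y) :* (con 1ℚ :+ y) := con 1ℚ :- y :* y) refl y)) (sub≤self {1ℚ} (0≤* 0≤y 0≤y))

  ^-* : ∀ p a b → (p ^ℚ a) ^ℚ b ≡ p ^ℚ (a ℕ.* b)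
  ^-* p a zero = cong (p ^ℚ_) (sym (ℕP.*-zeroʳ a))
  ^-* p a (suc b) = trans (cong (p ^ℚ a *_) (^-* p a b)) (trans (sym (^-+ p a (a ℕ.* b))) (cong (p ^ℚ_) (sym (ℕP.*-suc a b))))

  1^ : ∀ k → 1ℚ ^ℚ k ≡ 1ℚ
  1^ zero = refl
  1^ (suc k) = trans (*-identityˡ _) (1^ k)

  module Hitting {n q h : ℕ} (1≤q : 1 ℕ.≤ q) (cliques : 4 ℕ.* (n ℕ.* q ℕ.^ 6) ℕ.≤ h ℕ.* (h ℕ.* (h ℕ.* h)))
    (overlaps : 12 ℕ.* (h ℕ.* h) ℕ.+ 8 ℕ.* (h ℕ.* (q ℕ.* q)) ℕ.≤ q ℕ.^ 5) where
    open ≤-Reasoning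
    open +-*-Solver

    Q = ℕtoℚ q
    u = proj₁ (reciprocal q 1≤q)
    0≤u : 0ℚ ≤ u
    0≤u = proj₁ (proj₂ (reciprocal q 1≤q))
    Qu≡1 : Q * u ≡ 1ℚ
    Qu≡1 = proj₂ (proj₂ (reciprocal q 1≤q))
    u≤1 : u ≤ 1ℚ
    u≤1 = begin
      u ≡⟨ sym (*-identityˡ u) ⟩
      1ℚ * u ≤⟨ *-monoʳ 0≤u (ℕtoℚ-mono 1≤q) ⟩
      Q * u ≡⟨ Qu≡1 ⟩
      1ℚ ∎

    Q^u^ : ∀ k → Q ^ℚ k * u ^ℚ k ≡ 1ℚ
    Q^u^ k = trans (sym (^-distrib-* Q u k)) (trans (cong (_^ℚ k) Qu≡1) (1^ k))

    y = ½ * u ^ℚ 6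
    0≤y : 0ℚ ≤ y
    0≤y = 0≤* (nonNegative⁻¹ ½) (^-nonneg 6 0≤u)
    y≤1 : y ≤ 1ℚ
    y≤1 = *-mono {½} {1ℚ} {u ^ℚ 6} {1ℚ} 0≤1 (^-nonneg 6 0≤u) (≤ᵇ⇒≤ _) (^-≤1 6 0≤u u≤1)

    -- The h⁴ cliques contain 2 n batches of 2 q⁶ each. Since 2 q⁶ y = 1, every batch halves the
    -- probability.
    rare : (1ℚ - y) ^ℚ (h ℕ.* (h ℕ.* (h ℕ.* h))) ≤ ½ ^ℚ (2 ℕ.* n)
    rare = begin
      (1ℚ - y) ^ℚ (h ℕ.* (h ℕ.* (h ℕ.* h))) ≤⟨ ^-antimono (0≤sub y≤1) (sub≤self {1ℚ} 0≤y) (ℕP.≤-trans (ℕP.≤-reflexive regroup) cliques) ⟩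
      (1ℚ - y) ^ℚ (2 ℕ.* q ℕ.^ 6 ℕ.* (2 ℕ.* n)) ≡⟨ sym (^-* (1ℚ - y) (2 ℕ.* q ℕ.^ 6) (2 ℕ.* n)) ⟩
      ((1ℚ - y) ^ℚ (2 ℕ.* q ℕ.^ 6)) ^ℚ (2 ℕ.* n) ≤⟨ ^-mono (2 ℕ.* n) (^-nonneg (2 ℕ.* q ℕ.^ 6) (0≤sub y≤1)) (decay (2 ℕ.* q ℕ.^ 6) 0≤y y≤1 Xy≡1) ⟩
      ½ ^ℚ (2 ℕ.* n) ∎
      where
      regroup : 2 ℕ.* q ℕ.^ 6 ℕ.* (2 ℕ.* n) ≡ 4 ℕ.* (n ℕ.* q ℕ.^ 6)
      regroup = swap (q ℕ.^ 6) n
        where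
        open import Data.Nat.Solver using () renaming (module +-*-Solver to ℕSolver)
        swap : ∀ x n → 2 ℕ.* x ℕ.* (2 ℕ.* n) ≡ 4 ℕ.* (n ℕ.* x)
        swap = ℕSolver.solve 2 (λ x n → ℕSolver.con 2 ℕSolver.:* x ℕSolver.:* (ℕSolver.con 2 ℕSolver.:* n) ℕSolver.:= ℕSolver.con 4 ℕSolver.:* (n ℕSolver.:* x)) refl
      Xy≡1 : ℕtoℚ (2 ℕ.* q ℕ.^ 6) * y ≡ 1ℚ
      Xy≡1 = begin-equality
        ℕtoℚ (2 ℕ.* q ℕ.^ 6) * (½ * u ^ℚ 6) ≡⟨ cong (_* y) (trans (ℕtoℚ-* 2 (q ℕ.^ 6)) (cong (ℕtoℚ 2 *_) (ℕtoℚ-^ q 6))) ⟩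
        ℕtoℚ 2 * Q ^ℚ 6 * (½ * u ^ℚ 6) ≡⟨ solve 2 (λ a b → con (ℕtoℚ 2) :* a :* (con ½ :* b) := a :* b) refl (Q ^ℚ 6) (u ^ℚ 6) ⟩
        Q ^ℚ 6 * u ^ℚ 6 ≡⟨ Q^u^ 6 ⟩
        1ℚ ∎

    -- This is the hypothesis `overlaps` divided by 2 q⁵, after writing u³ as q² u⁵.
    overlaps≤½ : ℕtoℚ 6 * (ℕtoℚ h * ℕtoℚ h * u ^ℚ 5) + ℕtoℚ 4 * (ℕtoℚ h * u ^ℚ 3) ≤ ½
    overlaps≤½ = begin
      ℕtoℚ 6 * (H * H * u ^ℚ 5) + ℕtoℚ 4 * (H * u ^ℚ 3)
        ≡⟨ cong (λ t → ℕtoℚ 6 * (H * H * u ^ℚ 5) + ℕtoℚ 4 * (H * t)) u³≡ ⟩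
      ℕtoℚ 6 * (H * H * u ^ℚ 5) + ℕtoℚ 4 * (H * (Q * Q * u ^ℚ 5))
        ≡⟨ solve 3 (λ H Q v → con (ℕtoℚ 6) :* (H :* H :* v) :+ con (ℕtoℚ 4) :* (H :* (Q :* Q :* v))
             := con ½ :* ((con (ℕtoℚ 12) :* (H :* H) :+ con (ℕtoℚ 8) :* (H :* (Q :* Q))) :* v)) refl H Q (u ^ℚ 5) ⟩
      ½ * ((ℕtoℚ 12 * (H * H) + ℕtoℚ 8 * (H * (Q * Q))) * u ^ℚ 5)
        ≤⟨ *-monoˡ {½} (nonNegative⁻¹ ½) (*-monoʳ (^-nonneg 5 0≤u) (subst₂ _≤_ cast (ℕtoℚ-^ q 5) (ℕtoℚ-mono overlaps))) ⟩
      ½ * (Q ^ℚ 5 * u ^ℚ 5) ≡⟨ cong (½ *_) (Q^u^ 5) ⟩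
      ½ * 1ℚ ≡⟨ *-identityʳ ½ ⟩
      ½ ∎
      where
      H = ℕtoℚ h
      cast : ℕtoℚ (12 ℕ.* (h ℕ.* h) ℕ.+ 8 ℕ.* (h ℕ.* (q ℕ.* q))) ≡ ℕtoℚ 12 * (H * H) + ℕtoℚ 8 * (H * (Q * Q))
      cast = trans (ℕtoℚ-+ (12 ℕ.* (h ℕ.* h)) (8 ℕ.* (h ℕ.* (q ℕ.* q)))) (cong₂ _+_
        (trans (ℕtoℚ-* 12 (h ℕ.* h)) (cong (ℕtoℚ 12 *_) (ℕtoℚ-* h h)))
        (trans (ℕtoℚ-* 8 (h ℕ.* (q ℕ.* q))) (cong (ℕtoℚ 8 *_) (trans (ℕtoℚ-* h (q ℕ.* q)) (cong (H *_) (ℕtoℚ-* q q))))))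
      u³≡ : u ^ℚ 3 ≡ Q * Q * u ^ℚ 5
      u³≡ = begin-equality
        u ^ℚ 3 ≡⟨ sym (trans (cong₂ (λ a b → a * b * u ^ℚ 3) Qu≡1 Qu≡1) (trans (cong (_* u ^ℚ 3) (*-identityˡ 1ℚ)) (*-identityˡ _))) ⟩
        (Q * u) * (Q * u) * u ^ℚ 3 ≡⟨ solve 3 (λ Q u v → (Q :* u) :* (Q :* u) :* v := Q :* Q :* (u :* (u :* v))) refl Q u (u ^ℚ 3) ⟩
        Q * Q * u ^ℚ 5 ∎

    module _ {M : ℕ} (𝒮 : Slotting n M) where
      open Quadruples 𝒮
      open Union 𝒮

      miss : ∀ F → F ∈ families h → E u (ind ∘ none F) ≤ ½ ^ℚ (2 ℕ.* n)
      miss F F∈ with ∈-map⁻ (λ S → map mask (quads (Slices.slice h S))) F∈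
      ... | S , S∈ , refl = ≤-trans (noClique 0≤u (slice-disjoint unique) u≤1 (slice-unique unique) (slice-length large) overlaps≤½) rare
        where
        open Slices h S
        sub : S ∈ subs (allFin n) × 4 ℕ.* h ℕ.≤ length S
        sub = ∈-filter⁻ (λ S → 4 ℕ.* h ℕ.≤? length S) {xs = subs (allFin n)} S∈
        large = proj₂ sub
        unique = subs-unique (allFin n) (Uniq.allFin⁺ n) (proj₁ sub)

      families-length : length (families h) ℕ.≤ 2 ℕ.^ n
      families-length = ℕP.≤-trans (ℕP.≤-reflexive (length-map (λ S → map mask (quads (Slices.slice h S))) (filter (λ S → 4 ℕ.* h ℕ.≤? length S) (subs (allFin n)))))
        (ℕP.≤-trans (length-filter (λ S → 4 ℕ.* h ℕ.≤? length S) (subs (allFin n)))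
        (ℕP.≤-reflexive (trans (length-subs (allFin n)) (cong (2 ℕ.^_) (length-tabulate {n = n} (λ i → i))))))

      -- At most 2^n families are missed with probability at most 2^(-2n) each, in total at most
      -- 2^(-n), which is below δ because d ≤ n ≤ 2^n. The estimate is made at `u` and carried over
      -- to `p` by monotonicity.
      likely : ∀ {p δ d} → u ≤ p → p ≤ 1ℚ → 0ℚ < δ → 1ℚ ≤ ℕtoℚ d * δ → d ℕ.≤ n → 1ℚ - δ ≤ E p (ind ∘ hitAll (families h))
      likely {p} {δ} {d} u≤p p≤1 0<δ 1≤dδ d≤n = begin
        1ℚ - δ ≤⟨ sub-mono {1ℚ} ≤-refl total ⟩
        1ℚ - ∑ (families h) (λ F → E u (ind ∘ none F)) ≤⟨ hitAll-likely 0≤u u≤1 (families h) ⟩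
        E u (ind ∘ hitAll (families h)) ≤⟨ E-monoᵖ 0≤u u≤p p≤1 (ind ∘ hitAll (families h)) (λ ω ω′ le → ind-mono (hitAll-⊑ (families h) {ω} {ω′} le)) ⟩
        E p (ind ∘ hitAll (families h)) ∎
        where
        half = ½ ^ℚ n
        0≤half : 0ℚ ≤ half
        0≤half = ^-nonneg n (nonNegative⁻¹ ½)
        0≤δ : 0ℚ ≤ δ
        0≤δ = <⇒≤ 0<δ
        cancel : ℕtoℚ (2 ℕ.^ n) * half ≡ 1ℚ
        cancel = trans (cong (_* half) (ℕtoℚ-^ 2 n)) (trans (sym (^-distrib-* (ℕtoℚ 2) ½ n)) (1^ n))
        n≤2^n : ∀ k → k ℕ.≤ 2 ℕ.^ k
        n≤2^n zero = z≤n
        n≤2^n (suc k) = ℕP.≤-trans (ℕP.+-mono-≤ (ℕP.m^n>0 2 k) (n≤2^n k)) (ℕP.+-monoʳ-≤ (2 ℕ.^ k) (ℕP.m≤m+n _ 0))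
        half≤δ : half ≤ δ
        half≤δ = begin
          half ≡⟨ sym (*-identityʳ half) ⟩
          half * 1ℚ ≤⟨ *-monoˡ 0≤half (≤-trans 1≤dδ (*-monoʳ 0≤δ (ℕtoℚ-mono (ℕP.≤-trans d≤n (n≤2^n n))))) ⟩
          half * (ℕtoℚ (2 ℕ.^ n) * δ) ≡⟨ solve 3 (λ a b c → a :* (b :* c) := b :* a :* c) refl half (ℕtoℚ (2 ℕ.^ n)) δ ⟩
          ℕtoℚ (2 ℕ.^ n) * half * δ ≡⟨ trans (cong (_* δ) cancel) (*-identityˡ δ) ⟩
          δ ∎
        total : ∑ (families h) (λ F → E u (ind ∘ none F)) ≤ δ
        total = begin
          ∑ (families h) (λ F → E u (ind ∘ none F)) ≤⟨ ∑-≤-length (families h) (½ ^ℚ (2 ℕ.* n)) miss ⟩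
          ℕtoℚ (length (families h)) * ½ ^ℚ (2 ℕ.* n) ≤⟨ *-monoʳ (^-nonneg (2 ℕ.* n) (nonNegative⁻¹ ½)) (ℕtoℚ-mono families-length) ⟩
          ℕtoℚ (2 ℕ.^ n) * ½ ^ℚ (2 ℕ.* n) ≡⟨ cong (ℕtoℚ (2 ℕ.^ n) *_) (trans (^-+ ½ n (n ℕ.+ 0)) (cong (λ k → half * ½ ^ℚ k) (ℕP.+-identityʳ n))) ⟩
          ℕtoℚ (2 ℕ.^ n) * (half * half) ≡⟨ trans (sym (*-assoc (ℕtoℚ (2 ℕ.^ n)) half half)) (trans (cong (_* half) cancel) (*-identityˡ half)) ⟩
          half ≤⟨ half≤δ ⟩
          δ ∎

    -- If q p < 1, then (q p)^(2b) ≤ q p < 1, whereas the two hypotheses combine to (q p)^(2b) n^b ≥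
    -- n^b.
    u≤ : ∀ {p} a b → 0 ℕ.< b → 0 ℕ.< n → 0ℚ ≤ p → n ℕ.^ b ℕ.≤ q ℕ.^ (2 ℕ.* b) ℕ.* n ℕ.^ (2 ℕ.* a) →
      ℕtoℚ n ^ℚ (2 ℕ.* a) ≤ (p ^ℚ (2 ℕ.* b)) * (ℕtoℚ n ^ℚ b) → u ≤ p
    u≤ {p} a b@(suc b′) _ 0<n 0≤p sparse dense = ≮⇒≥ λ p<u → <-irrefl refl (<-≤-trans (scaled p<u) (bound p<u))
      where
      n^b = ℕtoℚ n ^ℚ b
      0<n^b : 0ℚ < n^b
      0<n^b = <-≤-trans (positive⁻¹ 1ℚ) (≤-trans (≤-reflexive (sym (1^ b))) (^-mono b 0≤1 (ℕtoℚ-mono 0<n)))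
      Qp<1 : p < u → Q * p < 1ℚ
      Qp<1 p<u = subst (Q * p <_) Qu≡1 (*-monoʳ-<-pos Q {{positive (<-≤-trans (positive⁻¹ 1ℚ) (ℕtoℚ-mono 1≤q))}} p<u)
      0≤Qp : 0ℚ ≤ Q * p
      0≤Qp = 0≤* (0≤ℕ q) 0≤p
      scaled : p < u → (Q * p) * n^b < n^b
      scaled p<u = subst ((Q * p) * n^b <_) (*-identityˡ n^b) (*-monoˡ-<-pos n^b {{positive 0<n^b}} (Qp<1 p<u))
      bound : p < u → n^b ≤ (Q * p) * n^b
      bound p<u = begin
        n^b ≡⟨ sym (ℕtoℚ-^ n b) ⟩
        ℕtoℚ (n ℕ.^ b) ≤⟨ ℕtoℚ-mono sparse ⟩
        ℕtoℚ (q ℕ.^ (2 ℕ.* b) ℕ.* n ℕ.^ (2 ℕ.* a)) ≡⟨ trans (ℕtoℚ-* (q ℕ.^ (2 ℕ.* b)) (n ℕ.^ (2 ℕ.* a))) (cong₂ _*_ (ℕtoℚ-^ q (2 ℕ.* b)) (ℕtoℚ-^ n (2 ℕ.* a))) ⟩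
        Q ^ℚ (2 ℕ.* b) * ℕtoℚ n ^ℚ (2 ℕ.* a) ≤⟨ *-monoˡ (^-nonneg (2 ℕ.* b) (0≤ℕ q)) dense ⟩
        Q ^ℚ (2 ℕ.* b) * (p ^ℚ (2 ℕ.* b) * n^b) ≡⟨ trans (sym (*-assoc (Q ^ℚ (2 ℕ.* b)) _ n^b)) (cong (_* n^b) (sym (^-distrib-* Q p (2 ℕ.* b)))) ⟩
        (Q * p) ^ℚ (2 ℕ.* b) * n^b ≤⟨ *-monoʳ (<⇒≤ 0<n^b) (^-antimono {Q * p} {1} {2 ℕ.* b} 0≤Qp (<⇒≤ (Qp<1 p<u)) (s≤s z≤n)) ⟩
        Q * p * 1ℚ * n^b ≡⟨ cong (_* n^b) (*-identityʳ (Q * p)) ⟩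
        Q * p * n^b ∎

  toMonoK4 : ∀ {n} {U : Graph n} {χ : Colouring n} → Union.SortedMono (pairSlotting {n}) U χ → MonoK4 U χ
  toMonoK4 {n} {U} (a , b , c , d , col , a<b , b<c , c<d , (ab , ac , ad , bc , bd , cd) , colours) =
    a , b , c , d , col , a<b , b<c , c<d ,
    (Adj⇒Edge {n} {U} a<b ab , Adj⇒Edge {n} {U} (FinP.<-trans a<b b<c) ac , Adj⇒Edge {n} {U} (FinP.<-trans a<b (FinP.<-trans b<c c<d)) ad ,
     Adj⇒Edge {n} {U} b<c bc , Adj⇒Edge {n} {U} (FinP.<-trans b<c c<d) bd , Adj⇒Edge {n} {U} c<d cd) , colours

  -- The factor 4 allows for halving twice, when the denser colour is chosen and when vertices of
  -- low degree are discarded; `suc m` keeps the constant nonzero.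
  manyEdges : ∀ {γ m n e} → 1ℚ ≤ ℕtoℚ m * γ → γ * (ℕtoℚ n ^ℚ 2) ≤ ℕtoℚ e → 4 ℕ.* (n ℕ.* n) ℕ.≤ 4 ℕ.* suc m ℕ.* e
  manyEdges {γ} {m} {n} {e} 1≤ h = ℕP.≤-trans (ℕP.*-monoʳ-≤ 4 (ℕP.≤-trans (ℕtoℚ-cancel {n ℕ.* n} {m ℕ.* e} n²≤) (ℕP.*-monoˡ-≤ e (ℕP.n≤1+n m)))) (ℕP.≤-reflexive (sym (ℕP.*-assoc 4 (suc m) e)))
    where
    open ≤-Reasoning
    open +-*-Solver
    ν = ℕtoℚ n
    n²≤ : ℕtoℚ (n ℕ.* n) ≤ ℕtoℚ (m ℕ.* e)
    n²≤ = begin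
      ℕtoℚ (n ℕ.* n) ≡⟨ trans (ℕtoℚ-* n n) (sym (*-identityˡ (ν * ν))) ⟩
      1ℚ * (ν * ν) ≤⟨ *-monoʳ (0≤* (0≤ℕ n) (0≤ℕ n)) 1≤ ⟩
      ℕtoℚ m * γ * (ν * ν) ≡⟨ solve 3 (λ m γ ν → m :* γ :* (ν :* ν) := m :* (γ :* (ν :* (ν :* con 1ℚ)))) refl (ℕtoℚ m) γ ν ⟩
      ℕtoℚ m * (γ * (ν * (ν * 1ℚ))) ≤⟨ *-monoˡ (0≤ℕ m) h ⟩
      ℕtoℚ m * ℕtoℚ e ≡⟨ sym (ℕtoℚ-* m e) ⟩
      ℕtoℚ (m ℕ.* e) ∎

  arrowsLikely : ∀ {γ p δ} a b m d n → 0 ℕ.< a → 0 ℕ.< b → 0ℚ ≤ p → p ≤ 1ℚ → 0ℚ < δ → 1ℚ ≤ ℕtoℚ m * γ → 1ℚ ≤ ℕtoℚ d * δ → d ℕ.≤ n →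
    ℕtoℚ n ^ℚ (2 ℕ.* a) ≤ (p ^ℚ (2 ℕ.* b)) * (ℕtoℚ n ^ℚ b) → Sizes (4 ℕ.* suc m) b n →
    (G : Graph n) → γ * (ℕtoℚ n ^ℚ 2) ≤ ℕtoℚ (numEdges n G) → PrAtLeast n p (λ H → ArrowsK4 n (union n G H)) (1ℚ - δ)
  arrowsLikely {γ} {p} {δ} a b m d n 0<a 0<b 0≤p p≤1 0<δ 1≤mγ 1≤dδ d≤n large sz G dense =
    prAtLeast {n} (hitAll (families h)) sound
      (Hitting.likely {n} {q} {h} 1≤q manyCliques fewOverlaps 𝒮 {p} {δ} {d}
        (Hitting.u≤ {n} {q} {h} 1≤q manyCliques fewOverlaps {p} a b 0<b 0<n 0≤p (sparse a 0<a) large) p≤1 0<δ 1≤dδ d≤n)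
    where
    𝒮 = pairSlotting {n}
    open Sizes sz
    open Union 𝒮 using (families; arrows)
    edges : 4 ℕ.* (n ℕ.* n) ℕ.≤ 4 ℕ.* suc m ℕ.* length (edgeSlots {n} G)
    edges = subst (λ e → 4 ℕ.* (n ℕ.* n) ℕ.≤ 4 ℕ.* suc m ℕ.* e) (numEdges≡ {n} G) (manyEdges {γ} {m} {n} {numEdges n G} 1≤mγ dense)
    sound : ∀ ω → hitAll (families h) ω ≡ true → ArrowsK4 n (union n G ω)
    sound ω hit χ = toMonoK4 {n} {union n G ω} {χ} (arrows G ω {h} hit {4 ℕ.* suc m} {r} {k} 0<n codegree rounds survivors edges χ)

  -- With ε = a / b, the bound on p is cleared of roots and denominators. The threshold depends only
  -- on γ, b and δ, hence is uniform in G.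
  partOne : (γ : ℚ) → 0ℚ < γ → (a b : ℕ) → 0 ℕ.< a → 0 ℕ.< b →
    (p : ℕ → ℚ) → IsProb p →
    ((n : ℕ) → ℕtoℚ n ^ℚ (2 ℕ.* a) ≤ (p n ^ℚ (2 ℕ.* b)) * (ℕtoℚ n ^ℚ b)) →
    (δ : ℚ) → 0ℚ < δ →
    ∃[ n₀ ] ((n : ℕ) → n₀ ℕ.≤ n → (G : Graph n) →
      γ * (ℕtoℚ n ^ℚ 2) ≤ ℕtoℚ (numEdges n G) →
      PrAtLeast n (p n) (λ H → ArrowsK4 n (union n G H)) (1ℚ - δ))
  partOne γ 0<γ a b 0<a 0<b p prob large δ 0<δ = n₁ ℕ.+ d , λ n n≥ →
    arrowsLikely {γ} {p n} {δ} a b m d n 0<a 0<b (proj₁ (prob n)) (proj₂ (prob n)) 0<δ (proj₂ (archimedean 0<γ)) (proj₂ (archimedean 0<δ))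
      (ℕP.≤-trans (ℕP.m≤n+m d n₁) n≥) (large n) (proj₂ (sizes (4 ℕ.* suc m) b) n (ℕP.≤-trans (ℕP.m≤m+n n₁ d) n≥))
    where
    m = proj₁ (archimedean 0<γ)
    d = proj₁ (archimedean 0<δ)
    n₁ = proj₁ (sizes (4 ℕ.* suc m) b)

open import Data.Nat using (ℕ)
open import Data.Integer using (+_)
open import Data.Rational using (ℚ; 0ℚ; 1ℚ; _*_; _-_; _/_; _≤_; _<_)
open PartOne using (partOne)
open PartTwo using (partTwo-edges; partTwo-random)
open Bipartite using (bipartite)

theorem1p5 : ((γ : ℚ) → 0ℚ < γ → (a b : ℕ) → 0 Data.Nat.< a → 0 Data.Nat.< b →
    (p : ℕ → ℚ) → IsProb p →
    ((n : ℕ) → ℕtoℚ n ^ℚ (2 Data.Nat.* a) ≤ (p n ^ℚ (2 Data.Nat.* b)) * (ℕtoℚ n ^ℚ b)) →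
    (δ : ℚ) → 0ℚ < δ →
    ∃[ n₀ ] ((n : ℕ) → n₀ Data.Nat.≤ n → (G : Graph n) →
    γ * (ℕtoℚ n ^ℚ 2) ≤ ℕtoℚ (numEdges n G) →
    PrAtLeast n (p n) (λ H → ArrowsK4 n (union n G H)) (1ℚ - δ)))
    ×
    ((γ : ℚ) → 0ℚ < γ → γ < + 1 / 4 →
    Σ ((n : ℕ) → Graph n) λ G →
    (∃[ n₀ ] ((n : ℕ) → n₀ Data.Nat.≤ n → γ * (ℕtoℚ n ^ℚ 2) ≤ ℕtoℚ (numEdges n (G n))))
    ×
    ((p : ℕ → ℚ) → IsProb p →
    ((η : ℚ) → 0ℚ < η → ∃[ n₀ ] ((n : ℕ) → n₀ Data.Nat.≤ n → (p n ^ℚ 2) * ℕtoℚ n ≤ η)) →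
    (δ : ℚ) → 0ℚ < δ →
    ∃[ n₀ ] ((n : ℕ) → n₀ Data.Nat.≤ n →
    PrAtLeast n (p n) (λ H → ¬ ArrowsK4 n (union n (G n) H)) (1ℚ - δ))))
theorem1p5 = partOne , λ γ _ γ<¼ → bipartite , partTwo-edges γ<¼ , partTwo-random
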